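{- For every $\epsilon>0$ there is an explicit construction (a generalized Johnson graph) yielding, for infinitely many $n$, a graph $G$ on $n$ vertices such that (1) $\vartheta(G)/\alpha(G)=\Omega(n^{1-\epsilon})$; (2) $\vartheta(G)/c(G)=\Omega(n^{1-\epsilon})$; (3) $\chi(G)/\vartheta(G^c)=\Omega(n^{1-\epsilon})$, where the implied constants do not depend on $n$.
   Context: For a graph $G$ on $N$ vertices, the Lovász number is $\vartheta(G)=\max\sum_{i,j}b_{ij}$ over all $N\times N$ positive semidefinite matrices $B=(b_{ij})$ with trace $1$ and $b_{ij}=0$ whenever $ij$ is an edge. $\alpha(G)$ is the independence number, $\chi(G)$ the chromatic number, $G^c$ the complement of $G$. The Shannon capacity is $c(G)=\lim_{m\to\infty}\alpha(G^{\boxtimes m})^{1/m}$, where $\boxtimes$ is the strong product: $(u_1,v_1)\sim(u_2,v_2)$ in $G\boxtimes H$ iff ($u_1=u_2$ and $v_1\sim v_2$) or ($u_1\sim u_2$ and $v_1=v_2$) or ($u_1\sim u_2$ and $v_1\sim v_2$). A generalized Johnson graph $G(n,k,L)$, for $L\subset\{0,\ldots,k-1\}$, has vertex set the $k$-subsets of $\{1,\ldots,n\}$, with $A,B$ adjacent iff $|A\cap B|\notin L$. -}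

module Defs where

open import Data.Bool.Base using (true; false)
open import Data.Empty using (⊥)
open import Data.Fin.Base as Fin using (Fin; zero; suc; toℕ; remQuot)
import Data.Fin.Properties as Fin
open import Data.Fin.Subset using (Subset; inside; outside; ∣_∣; _∩_; _∈_; _∉_)
open import Data.Fin.Subset.Properties using (_∈?_; anySubset?; ∣p∣≤n; ∩-comm; ∉⊥; ∣⊥∣≡0)
import Data.Fin.Subset as Subset
open import Data.Integer.Base as ℤ using (ℤ; +_; -[1+_])
open import Data.Nat.Base as ℕ using (ℕ; zero; suc; z≤n; s≤s)
import Data.Nat.Properties as ℕ
open import Data.Nat.Combinatorics using (_C_; nCk+nC[k+1]≡[n+1]C[k+1])
open import Data.Product using (Σ; Σ-syntax; ∃; ∃-syntax; _×_; _,_; proj₁; proj₂)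
open import Data.Rational as ℚ using (ℚ; 0ℚ; 1ℚ; ½; ↥_; ↧ₙ_)
import Data.Rational.Properties as ℚ
open import Data.Rational.Solver using (module +-*-Solver)
open import Data.Sum.Base using (_⊎_; inj₁; inj₂)
open import Data.Sum.Function.Propositional using (_⊎-↔_)
open import Data.Vec.Base using (Vec; []; _∷_; lookup; tabulate)
open import Data.Vec.Properties using (lookup∘tabulate)
import Data.Vec.Functional as Vector
open import Function.Base using (_∘_; id)
open import Function.Bundles using (_↔_; mk↔ₛ′; Inverse)
open import Function.Properties.Inverse using (↔-sym; ↔-trans; ↔-refl)
open import Level using (0ℓ)
open import Relation.Binary.Core using (Rel)
open import Relation.Binary.Definitions using (Decidable; Symmetric; Irreflexive)
open import Relation.Binary.PropositionalEquality
open import Relation.Nullary using (¬_; Dec; yes; no; contradiction)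
open import Relation.Nullary.Decidable using (_×-dec_; _⊎-dec_; _→-dec_; ¬?; map′)

-- Real numbers: Cauchy sequences of rationals, with equality _≈ᴿ_.

record ℝ : Set where
  constructor mkℝ
  field
    seq    : ℕ → ℚ
    cauchy : ∀ δ → 0ℚ ℚ.< δ →
             ∃[ N ] ∀ m n → N ℕ.≤ m → N ℕ.≤ n → ℚ.∣ seq m ℚ.- seq n ∣ ℚ.≤ δ

open ℝ public

infix 4 _≈ᴿ_ _≤ᴿ_ _<ᴿ_

_≈ᴿ_ : ℝ → ℝ → Set
x ≈ᴿ y = ∀ δ → 0ℚ ℚ.< δ →
         ∃[ N ] ∀ n → N ℕ.≤ n → ℚ.∣ seq x n ℚ.- seq y n ∣ ℚ.≤ δ

_≤ᴿ_ : ℝ → ℝ → Set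
x ≤ᴿ y = ∀ δ → 0ℚ ℚ.< δ →
         ∃[ N ] ∀ n → N ℕ.≤ n → seq x n ℚ.≤ seq y n ℚ.+ δ

_<ᴿ_ : ℝ → ℝ → Set
x <ᴿ y = ∃[ δ ] 0ℚ ℚ.< δ ×
         ∃[ N ] ∀ n → N ℕ.≤ n → seq x n ℚ.+ δ ℚ.≤ seq y n

private
  open +-*-Solver

  half-pos : ∀ {δ} → 0ℚ ℚ.< δ → 0ℚ ℚ.< ½ ℚ.* δ
  half-pos {δ} 0<δ = subst (ℚ._< ½ ℚ.* δ) (ℚ.*-zeroʳ ½) (ℚ.*-monoʳ-<-pos ½ 0<δ)

  half+half : ∀ δ → ½ ℚ.* δ ℚ.+ ½ ℚ.* δ ≡ δ
  half+half δ = trans (sym (ℚ.*-distribʳ-+ δ ½ ½)) (ℚ.*-identityˡ δ)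

  +-rearrange : ∀ a b c d → (a ℚ.+ b) ℚ.- (c ℚ.+ d) ≡ (a ℚ.- c) ℚ.+ (b ℚ.- d)
  +-rearrange = solve 4 (λ a b c d → (a :+ b) :- (c :+ d) := (a :- c) :+ (b :- d)) refl

  neg-rearrange : ∀ a b → (ℚ.- a) ℚ.- (ℚ.- b) ≡ ℚ.- (a ℚ.- b)
  neg-rearrange = solve 2 (λ a b → (:- a) :- (:- b) := :- (a :- b)) refl

  *-rearrange : ∀ a b c d →
                a ℚ.* b ℚ.- c ℚ.* d ≡ a ℚ.* (b ℚ.- d) ℚ.+ (a ℚ.- c) ℚ.* d
  *-rearrange = solve 4 (λ a b c d →
    a :* b :- c :* d := a :* (b :- d) :+ (a :- c) :* d) refl

  sub-add : ∀ a b → b ℚ.+ (a ℚ.- b) ≡ a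
  sub-add = solve 2 (λ a b → b :+ (a :- b) := a) refl

  *-mono : ∀ {a b c d} → 0ℚ ℚ.≤ c → 0ℚ ℚ.≤ b → a ℚ.≤ b → c ℚ.≤ d → a ℚ.* c ℚ.≤ b ℚ.* d
  *-mono {a} {b} {c} {d} 0≤c 0≤b a≤b c≤d = ℚ.≤-trans
    (ℚ.*-monoʳ-≤-nonNeg c {{ℚ.nonNegative 0≤c}} a≤b)
    (ℚ.*-monoˡ-≤-nonNeg b {{ℚ.nonNegative 0≤b}} c≤d)

  0<1 : 0ℚ ℚ.< 1ℚ
  0<1 = ℚ.positive⁻¹ 1ℚ

  eventually-bounded : (x : ℝ) →
    ∃[ K ] 0ℚ ℚ.< K × ∃[ N ] ∀ n → N ℕ.≤ n → ℚ.∣ seq x n ∣ ℚ.≤ K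
  eventually-bounded x with cauchy x 1ℚ 0<1
  ... | N , close = ℚ.∣ seq x N ∣ ℚ.+ 1ℚ
                  , ℚ.+-mono-≤-< (ℚ.0≤∣p∣ (seq x N)) 0<1
                  , N , λ n N≤n → begin
    ℚ.∣ seq x n ∣                                    ≡⟨ cong ℚ.∣_∣ (sub-add (seq x n) (seq x N)) ⟨
    ℚ.∣ seq x N ℚ.+ (seq x n ℚ.- seq x N) ∣          ≤⟨ ℚ.∣p+q∣≤∣p∣+∣q∣ (seq x N) _ ⟩
    ℚ.∣ seq x N ∣ ℚ.+ ℚ.∣ seq x n ℚ.- seq x N ∣      ≤⟨ ℚ.+-monoʳ-≤ ℚ.∣ seq x N ∣ (close n N N≤n ℕ.≤-refl) ⟩
    ℚ.∣ seq x N ∣ ℚ.+ 1ℚ                             ∎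
    where open ℚ.≤-Reasoning

  share : ∀ K L δ → 0ℚ ℚ.< K → 0ℚ ℚ.< L → 0ℚ ℚ.< δ →
          ∃[ η ] 0ℚ ℚ.< η × K ℚ.* η ℚ.+ η ℚ.* L ≡ δ
  share K L δ 0<K 0<L 0<δ = inv (K ℚ.+ L) (ℚ.+-mono-< 0<K 0<L) refl
    where
    inv : ∀ s → 0ℚ ℚ.< s → s ≡ K ℚ.+ L → ∃[ η ] 0ℚ ℚ.< η × K ℚ.* η ℚ.+ η ℚ.* L ≡ δ
    inv s 0<s s≡K+L = δ ℚ.* s⁻¹ , ℚ.positive⁻¹ _ {{ℚ.pos*pos⇒pos δ s⁻¹}} , (begin
      K ℚ.* (δ ℚ.* s⁻¹) ℚ.+ δ ℚ.* s⁻¹ ℚ.* L   ≡⟨ cong (K ℚ.* (δ ℚ.* s⁻¹) ℚ.+_) (ℚ.*-comm (δ ℚ.* s⁻¹) L) ⟩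
      K ℚ.* (δ ℚ.* s⁻¹) ℚ.+ L ℚ.* (δ ℚ.* s⁻¹) ≡⟨ ℚ.*-distribʳ-+ (δ ℚ.* s⁻¹) K L ⟨
      (K ℚ.+ L) ℚ.* (δ ℚ.* s⁻¹)               ≡⟨ cong (ℚ._* (δ ℚ.* s⁻¹)) s≡K+L ⟨
      s ℚ.* (δ ℚ.* s⁻¹)                       ≡⟨ ℚ.*-comm s (δ ℚ.* s⁻¹) ⟩
      δ ℚ.* s⁻¹ ℚ.* s                         ≡⟨ ℚ.*-assoc δ s⁻¹ s ⟩
      δ ℚ.* (s⁻¹ ℚ.* s)                       ≡⟨ cong (δ ℚ.*_) (ℚ.*-inverseˡ s) ⟩
      δ ℚ.* 1ℚ                                ≡⟨ ℚ.*-identityʳ δ ⟩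
      δ                                       ∎)
      where
      open ≡-Reasoning
      instance
        s-positive : ℚ.Positive s
        s-positive = ℚ.positive 0<s

        s-nonZero : ℚ.NonZero s
        s-nonZero = ℚ.pos⇒nonZero s

        δ-positive : ℚ.Positive δ
        δ-positive = ℚ.positive 0<δ

      s⁻¹ : ℚ
      s⁻¹ = ℚ.1/ s

      instance
        s⁻¹-positive : ℚ.Positive s⁻¹
        s⁻¹-positive = ℚ.1/pos⇒pos s

  *-close : ∀ {K L η δ} a b c d → 0ℚ ℚ.< K → 0ℚ ℚ.< η →
            K ℚ.* η ℚ.+ η ℚ.* L ≡ δ →
            ℚ.∣ a ∣ ℚ.≤ K → ℚ.∣ d ∣ ℚ.≤ L →
            ℚ.∣ a ℚ.- c ∣ ℚ.≤ η → ℚ.∣ b ℚ.- d ∣ ℚ.≤ η →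
            ℚ.∣ a ℚ.* b ℚ.- c ℚ.* d ∣ ℚ.≤ δ
  *-close {K} {L} {η} {δ} a b c d 0<K 0<η split a≤K d≤L ac≤η bd≤η = begin
    ℚ.∣ a ℚ.* b ℚ.- c ℚ.* d ∣
      ≡⟨ cong ℚ.∣_∣ (*-rearrange a b c d) ⟩
    ℚ.∣ a ℚ.* (b ℚ.- d) ℚ.+ (a ℚ.- c) ℚ.* d ∣
      ≤⟨ ℚ.∣p+q∣≤∣p∣+∣q∣ (a ℚ.* (b ℚ.- d)) ((a ℚ.- c) ℚ.* d) ⟩
    ℚ.∣ a ℚ.* (b ℚ.- d) ∣ ℚ.+ ℚ.∣ (a ℚ.- c) ℚ.* d ∣
      ≡⟨ cong₂ ℚ._+_ (ℚ.∣p*q∣≡∣p∣*∣q∣ a (b ℚ.- d)) (ℚ.∣p*q∣≡∣p∣*∣q∣ (a ℚ.- c) d) ⟩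
    ℚ.∣ a ∣ ℚ.* ℚ.∣ b ℚ.- d ∣ ℚ.+ ℚ.∣ a ℚ.- c ∣ ℚ.* ℚ.∣ d ∣
      ≤⟨ ℚ.+-mono-≤ (*-mono (ℚ.0≤∣p∣ (b ℚ.- d)) (ℚ.<⇒≤ 0<K) a≤K bd≤η)
                    (*-mono (ℚ.0≤∣p∣ d) (ℚ.<⇒≤ 0<η) ac≤η d≤L) ⟩
    K ℚ.* η ℚ.+ η ℚ.* L
      ≡⟨ split ⟩
    δ ∎
    where open ℚ.≤-Reasoning

  *-cauchy : ∀ x y δ → 0ℚ ℚ.< δ → ∃[ N ] ∀ m n → N ℕ.≤ m → N ℕ.≤ n →
             ℚ.∣ seq x m ℚ.* seq y m ℚ.- seq x n ℚ.* seq y n ∣ ℚ.≤ δ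
  *-cauchy x y δ 0<δ =
    let K , 0<K , A , boundˣ = eventually-bounded x
        L , 0<L , B , boundʸ = eventually-bounded y
        η , 0<η , split      = share K L δ 0<K 0<L 0<δ
        M , closeˣ           = cauchy x η 0<η
        N , closeʸ           = cauchy y η 0<η
    in combine A B M N 0<K 0<η split boundˣ boundʸ closeˣ closeʸ
    where
    combine : ∀ A B M N {K L η} → 0ℚ ℚ.< K → 0ℚ ℚ.< η → K ℚ.* η ℚ.+ η ℚ.* L ≡ δ →
              (∀ n → A ℕ.≤ n → ℚ.∣ seq x n ∣ ℚ.≤ K) →
              (∀ n → B ℕ.≤ n → ℚ.∣ seq y n ∣ ℚ.≤ L) →
              (∀ m n → M ℕ.≤ m → M ℕ.≤ n → ℚ.∣ seq x m ℚ.- seq x n ∣ ℚ.≤ η) →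
              (∀ m n → N ℕ.≤ m → N ℕ.≤ n → ℚ.∣ seq y m ℚ.- seq y n ∣ ℚ.≤ η) →
              ∃[ N ] ∀ m n → N ℕ.≤ m → N ℕ.≤ n →
                ℚ.∣ seq x m ℚ.* seq y m ℚ.- seq x n ℚ.* seq y n ∣ ℚ.≤ δ
    combine A B M N 0<K 0<η split boundˣ boundʸ closeˣ closeʸ =
      (A ℕ.⊔ B) ℕ.⊔ (M ℕ.⊔ N) , λ m n m≥ n≥ →
      let AB≤m = ℕ.m⊔n≤o⇒m≤o (A ℕ.⊔ B) (M ℕ.⊔ N) m≥
          AB≤n = ℕ.m⊔n≤o⇒m≤o (A ℕ.⊔ B) (M ℕ.⊔ N) n≥
          MN≤m = ℕ.m⊔n≤o⇒n≤o (A ℕ.⊔ B) (M ℕ.⊔ N) m≥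
          MN≤n = ℕ.m⊔n≤o⇒n≤o (A ℕ.⊔ B) (M ℕ.⊔ N) n≥
      in *-close (seq x m) (seq y m) (seq x n) (seq y n) 0<K 0<η split
           (boundˣ m (ℕ.m⊔n≤o⇒m≤o A B AB≤m))
           (boundʸ n (ℕ.m⊔n≤o⇒n≤o A B AB≤n))
           (closeˣ m n (ℕ.m⊔n≤o⇒m≤o M N MN≤m) (ℕ.m⊔n≤o⇒m≤o M N MN≤n))
           (closeʸ m n (ℕ.m⊔n≤o⇒n≤o M N MN≤m) (ℕ.m⊔n≤o⇒n≤o M N MN≤n))

infixl 6 _+ᴿ_ _-ᴿ_
infixl 7 _*ᴿ_
infixr 8 _^ᴿ_
infix  8 -ᴿ_

fromℚ : ℚ → ℝ
fromℚ q = mkℝ (λ _ → q) λ δ 0<δ → 0 , λ _ _ _ _ →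
  subst (λ z → ℚ.∣ z ∣ ℚ.≤ δ) (sym (ℚ.+-inverseʳ q)) (ℚ.<⇒≤ 0<δ)

fromℕ : ℕ → ℝ
fromℕ n = fromℚ (+ n ℚ./ 1)

0ᴿ 1ᴿ : ℝ
0ᴿ = fromℚ 0ℚ
1ᴿ = fromℚ 1ℚ

_+ᴿ_ : ℝ → ℝ → ℝ
seq (x +ᴿ y) n = seq x n ℚ.+ seq y n
cauchy (x +ᴿ y) δ 0<δ
  with cauchy x (½ ℚ.* δ) (half-pos 0<δ) | cauchy y (½ ℚ.* δ) (half-pos 0<δ)
... | M , closeˣ | N , closeʸ = M ℕ.⊔ N , λ m n m≥ n≥ → begin
  ℚ.∣ (seq x m ℚ.+ seq y m) ℚ.- (seq x n ℚ.+ seq y n) ∣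
    ≡⟨ cong ℚ.∣_∣ (+-rearrange (seq x m) (seq y m) (seq x n) (seq y n)) ⟩
  ℚ.∣ (seq x m ℚ.- seq x n) ℚ.+ (seq y m ℚ.- seq y n) ∣
    ≤⟨ ℚ.∣p+q∣≤∣p∣+∣q∣ (seq x m ℚ.- seq x n) _ ⟩
  ℚ.∣ seq x m ℚ.- seq x n ∣ ℚ.+ ℚ.∣ seq y m ℚ.- seq y n ∣
    ≤⟨ ℚ.+-mono-≤ (closeˣ m n (ℕ.m⊔n≤o⇒m≤o M N m≥) (ℕ.m⊔n≤o⇒m≤o M N n≥))
                  (closeʸ m n (ℕ.m⊔n≤o⇒n≤o M N m≥) (ℕ.m⊔n≤o⇒n≤o M N n≥)) ⟩
  ½ ℚ.* δ ℚ.+ ½ ℚ.* δ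
    ≡⟨ half+half δ ⟩
  δ ∎
  where open ℚ.≤-Reasoning

-ᴿ_ : ℝ → ℝ
seq (-ᴿ x) n = ℚ.- seq x n
cauchy (-ᴿ x) δ 0<δ with cauchy x δ 0<δ
... | N , close = N , λ m n m≥ n≥ →
  subst (ℚ._≤ δ)
    (sym (trans (cong ℚ.∣_∣ (neg-rearrange (seq x m) (seq x n)))
                (ℚ.∣-p∣≡∣p∣ (seq x m ℚ.- seq x n))))
    (close m n m≥ n≥)

_-ᴿ_ : ℝ → ℝ → ℝ
x -ᴿ y = x +ᴿ (-ᴿ y)

_*ᴿ_ : ℝ → ℝ → ℝ
seq (x *ᴿ y) n = seq x n ℚ.* seq y n
cauchy (x *ᴿ y) = *-cauchy x y

_^ᴿ_ : ℝ → ℕ → ℝ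
x ^ᴿ zero  = 1ᴿ
x ^ᴿ suc n = x *ᴿ x ^ᴿ n

∑ : ∀ {n} → (Fin n → ℝ) → ℝ
∑ = Vector.foldr _+ᴿ_ 0ᴿ

_⟶_ : (ℕ → ℝ) → ℝ → Set
s ⟶ l = ∀ δ → 0ᴿ <ᴿ δ → ∃[ M ] ∀ m → M ℕ.≤ m → l -ᴿ δ ≤ᴿ s m × s m ≤ᴿ l +ᴿ δ

-- The quotient x / y is at least r; part of the claim is that y is positive.
_/_≥ᴿ_ : ℝ → ℝ → ℝ → Set
x / y ≥ᴿ r = 0ᴿ <ᴿ y × r *ᴿ y ≤ᴿ x

IsRoot : ℕ → ℝ → ℝ → Set
IsRoot m x r = 0ᴿ ≤ᴿ r × r ^ᴿ m ≈ᴿ x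

-- IsRationalPower b p r : r = b ^ p, for b ≥ 1.
IsRationalPower : ℕ → ℚ → ℝ → Set
IsRationalPower b p r = 0ᴿ ≤ᴿ r × root-equation (↥ p)
  where
  root-equation : ℤ → Set
  root-equation (+ a)    = r ^ᴿ (↧ₙ p) ≈ᴿ fromℕ b ^ᴿ a
  root-equation -[1+ a ] = r ^ᴿ (↧ₙ p) *ᴿ fromℕ b ^ᴿ suc a ≈ᴿ 1ᴿ

-- IsPower b x y : y = b ^ x = sup { b ^ p : p rational, p ≤ x }, for b ≥ 1.
IsPower : ℕ → ℝ → ℝ → Set
IsPower b x y = UpperBound y × (∀ u → UpperBound u → y ≤ᴿ u)
  where
  UpperBound : ℝ → Set
  UpperBound u = ∀ p r → fromℚ p ≤ᴿ x → IsRationalPower b p r → r ≤ᴿ u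

record Graph (n : ℕ) : Set₁ where
  field
    Adj        : Rel (Fin n) 0ℓ
    adj?       : Decidable Adj
    adj-sym    : Symmetric Adj
    adj-irrefl : Irreflexive _≡_ Adj

open Graph public

complement : ∀ {n} → Graph n → Graph n
complement G = record
  { Adj        = λ i j → i ≢ j × ¬ Adj G i j
  ; adj?       = λ i j → ¬? (i Fin.≟ j) ×-dec ¬? (adj? G i j)
  ; adj-sym    = λ (i≢j , ¬adj) → i≢j ∘ sym , ¬adj ∘ adj-sym G
  ; adj-irrefl = λ i≡j (i≢j , _) → i≢j i≡j
  }

infixr 7 _⊠_
infixr 8 _^⊠_

-- remQuot : Fin (n * m) → Fin n × Fin m is the standard bijection.
_⊠_ : ∀ {n m} → Graph n → Graph m → Graph (n ℕ.* m)
_⊠_ {n} {m} G H = record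
  { Adj        = λ i j → AdjPair (remQuot {n} m i) (remQuot {n} m j)
  ; adj?       = λ i j → adjPair? (remQuot {n} m i) (remQuot {n} m j)
  ; adj-sym    = symPair
  ; adj-irrefl = λ { refl (inj₁ (_ , a))        → adj-irrefl H refl a
                   ; refl (inj₂ (inj₁ (a , _))) → adj-irrefl G refl a
                   ; refl (inj₂ (inj₂ (a , _))) → adj-irrefl G refl a }
  }
  where
  AdjPair : Rel (Fin n × Fin m) 0ℓ
  AdjPair (u₁ , v₁) (u₂ , v₂) =
    (u₁ ≡ u₂ × Adj H v₁ v₂) ⊎ (Adj G u₁ u₂ × v₁ ≡ v₂) ⊎ (Adj G u₁ u₂ × Adj H v₁ v₂)

  adjPair? : Decidable AdjPair
  adjPair? (u₁ , v₁) (u₂ , v₂) =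
    (u₁ Fin.≟ u₂ ×-dec adj? H v₁ v₂) ⊎-dec
    (adj? G u₁ u₂ ×-dec v₁ Fin.≟ v₂) ⊎-dec
    (adj? G u₁ u₂ ×-dec adj? H v₁ v₂)

  symPair : ∀ {p q} → AdjPair p q → AdjPair q p
  symPair (inj₁ (e , a))        = inj₁ (sym e , adj-sym H a)
  symPair (inj₂ (inj₁ (a , e))) = inj₂ (inj₁ (adj-sym G a , sym e))
  symPair (inj₂ (inj₂ (a , b))) = inj₂ (inj₂ (adj-sym G a , adj-sym H b))

_^⊠_ : ∀ {n} → Graph n → (m : ℕ) → Graph (n ℕ.^ m)
G ^⊠ zero = record
  { Adj        = λ _ _ → ⊥
  ; adj?       = λ _ _ → no id
  ; adj-sym    = id
  ; adj-irrefl = λ _ → id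
  }
G ^⊠ suc m = G ⊠ (G ^⊠ m)

Independent : ∀ {n} → Graph n → Subset n → Set
Independent G S = ∀ i j → i ∈ S → j ∈ S → ¬ Adj G i j

IsIndependenceNumber : ∀ {n} → Graph n → ℕ → Set
IsIndependenceNumber G a =
  (∃[ S ] Independent G S × ∣ S ∣ ≡ a) × (∀ S → Independent G S → ∣ S ∣ ℕ.≤ a)

Colourable : ∀ {n} → Graph n → ℕ → Set
Colourable {n} G c = Σ[ f ∈ (Fin n → Fin c) ] (∀ i j → Adj G i j → f i ≢ f j)

IsChromaticNumber : ∀ {n} → Graph n → ℕ → Set
IsChromaticNumber G c = Colourable G c × (∀ d → Colourable G d → c ℕ.≤ d)

private
  greatest : ∀ {P : ℕ → Set} → (∀ k → Dec (P k)) → P 0 →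
             ∀ b → (∀ k → P k → k ℕ.≤ b) → ∃[ a ] P a × (∀ k → P k → k ℕ.≤ a)
  greatest P? P0 zero    bound = 0 , P0 , bound
  greatest P? P0 (suc b) bound with P? (suc b)
  ... | yes Pb = suc b , Pb , bound
  ... | no ¬Pb = greatest P? P0 b λ k Pk →
    ℕ.s≤s⁻¹ (ℕ.≤∧≢⇒< (bound k Pk) λ { refl → ¬Pb Pk })

  least : ∀ {P : ℕ → Set} → (∀ k → Dec (P k)) →
          ∀ b → P b → ∃[ a ] P a × (∀ k → P k → a ℕ.≤ k)
  least P? zero    Pb = 0 , Pb , λ _ _ → z≤n
  least P? (suc b) Pb with P? 0
  ... | yes P0 = 0 , P0 , λ _ _ → z≤n
  ... | no ¬P0 with least (P? ∘ suc) b Pb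
  ...   | a , Pa , min = suc a , Pa , λ
          { zero P0 → contradiction P0 ¬P0 ; (suc k) Pk → s≤s (min k Pk) }

  independent? : ∀ {n} (G : Graph n) S → Dec (Independent G S)
  independent? G S = Fin.all? λ i → Fin.all? λ j →
    (i ∈? S) →-dec ((j ∈? S) →-dec ¬? (adj? G i j))

  anyVec? : ∀ {c n} {P : Vec (Fin c) n → Set} → (∀ v → Dec (P v)) → Dec (∃ P)
  anyVec? {n = zero}  P? = map′ (λ p → [] , p) (λ { ([] , p) → p }) (P? [])
  anyVec? {n = suc n} P? = map′
    (λ (i , v , p) → i ∷ v , p) (λ { (i ∷ v , p) → i , v , p })
    (Fin.any? λ i → anyVec? λ v → P? (i ∷ v))

  colourable? : ∀ {n} (G : Graph n) c → Dec (Colourable G c)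
  colourable? G c = map′
    (λ (v , proper) → lookup v , proper)
    (λ (f , proper) → tabulate f , λ i j a e → proper i j a
      (trans (sym (lookup∘tabulate f i)) (trans e (lookup∘tabulate f j))))
    (anyVec? λ v → Fin.all? λ i → Fin.all? λ j →
      adj? G i j →-dec ¬? (lookup v i Fin.≟ lookup v j))

independenceNumber : ∀ {n} (G : Graph n) → ∃ (IsIndependenceNumber G)
independenceNumber {n} G
  with greatest
         (λ a → anySubset? λ S → independent? G S ×-dec (∣ S ∣ ℕ.≟ a))
         (Subset.⊥ , (λ _ _ i∈⊥ → contradiction i∈⊥ ∉⊥) , ∣⊥∣≡0 n)
         n (λ { _ (S , _ , refl) → ∣p∣≤n S })
... | a , attained , max = a , attained , λ S ind → max ∣ S ∣ (S , ind , refl)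

chromaticNumber : ∀ {n} (G : Graph n) → ∃ (IsChromaticNumber G)
chromaticNumber {n} G = least (colourable? G) n
  (id , λ { i .i a refl → adj-irrefl G refl a })

α χ : ∀ {n} → Graph n → ℕ
α = proj₁ ∘ independenceNumber
χ = proj₁ ∘ chromaticNumber

Matrix : ℕ → Set
Matrix n = Fin n → Fin n → ℝ

PositiveSemidefinite : ∀ {n} → Matrix n → Set
PositiveSemidefinite {n} B =
  (∀ i j → B i j ≈ᴿ B j i) ×
  (∀ (x : Fin n → ℝ) → 0ᴿ ≤ᴿ ∑ λ i → ∑ λ j → x i *ᴿ B i j *ᴿ x j)

LovászFeasible : ∀ {n} → Graph n → Matrix n → Set
LovászFeasible G B =
  PositiveSemidefinite B ×
  (∑ λ i → B i i) ≈ᴿ 1ᴿ ×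
  (∀ i j → Adj G i j → B i j ≈ᴿ 0ᴿ)

entrySum : ∀ {n} → Matrix n → ℝ
entrySum B = ∑ λ i → ∑ λ j → B i j

-- Relational, as is IsShannonCapacity: a maximum over real matrices, or the
-- limit of a sequence with no known rate of convergence, exists classically
-- but is not given constructively as a function of the graph.
IsLovászNumber : ∀ {n} → Graph n → ℝ → Set
IsLovászNumber G ϑ =
  (∃[ B ] LovászFeasible G B × entrySum B ≈ᴿ ϑ) ×
  (∀ B → LovászFeasible G B → entrySum B ≤ᴿ ϑ)

-- The sequence is indexed from 0, so its m-th term uses the (m+1)-st power.
IsShannonCapacity : ∀ {n} → Graph n → ℝ → Set
IsShannonCapacity G c = Σ[ s ∈ (ℕ → ℝ) ]
  (∀ m → IsRoot (suc m) (fromℕ (α (G ^⊠ suc m))) (s m)) × s ⟶ c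

KSubset : ℕ → ℕ → Set
KSubset n k = Σ[ S ∈ Subset n ] ∣ S ∣ ≡ k

private
  KSubset-≡ : ∀ {n k} {A B : KSubset n k} → proj₁ A ≡ proj₁ B → A ≡ B
  KSubset-≡ {A = A , p} {B = .A , q} refl = cong (A ,_) (ℕ.≡-irrelevant p q)

  cast↔ : ∀ {m n} → m ≡ n → Fin m ↔ Fin n
  cast↔ refl = ↔-refl

  pascal : ∀ {n k} → (KSubset n k ⊎ KSubset n (suc k)) ↔ KSubset (suc n) (suc k)
  pascal = mk↔ₛ′
    (λ { (inj₁ (S , p)) → inside ∷ S , cong suc p ; (inj₂ (S , p)) → outside ∷ S , p })
    (λ { (true ∷ S , p) → inj₁ (S , ℕ.suc-injective p) ; (false ∷ S , p) → inj₂ (S , p) })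
    (λ { (true ∷ S , p) → KSubset-≡ refl ; (false ∷ S , p) → refl })
    (λ { (inj₁ (S , p)) → cong inj₁ (KSubset-≡ refl) ; (inj₂ (S , p)) → refl })

  add-outside : ∀ {n} → KSubset n 0 ↔ KSubset (suc n) 0
  add-outside = mk↔ₛ′
    (λ { (S , p) → outside ∷ S , p })
    (λ { (false ∷ S , p) → S , p ; (true ∷ S , ()) })
    (λ { (false ∷ S , p) → refl ; (true ∷ S , ()) })
    (λ { (S , p) → refl })

kSubsets : ∀ n k → Fin (n C k) ↔ KSubset n k
kSubsets zero zero = mk↔ₛ′ (λ _ → [] , refl) (λ _ → zero)
  (λ { ([] , p) → KSubset-≡ refl }) (λ { zero → refl })
kSubsets zero (suc k) = mk↔ₛ′ (λ ()) (λ { ([] , ()) }) (λ { ([] , ()) }) (λ ())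
kSubsets (suc n) zero = ↔-trans (kSubsets n zero) add-outside
kSubsets (suc n) (suc k) =
  ↔-trans (cast↔ (sym (nCk+nC[k+1]≡[n+1]C[k+1] n k)))
  (↔-trans Fin.+↔⊎
  (↔-trans (kSubsets n k ⊎-↔ kSubsets n (suc k)) pascal))

kSubset : ∀ n k → Fin (n C k) → Subset n
kSubset n k i = proj₁ (Inverse.to (kSubsets n k) i)

-- Vertices are required to be distinct, since k ∉ L would otherwise make
-- every vertex a loop.
johnson : (n k : ℕ) (L : Subset k) → Graph (n C k)
johnson n k L = record
  { Adj        = λ i j → i ≢ j × ¬ InL (meet i j)
  ; adj?       = λ i j → ¬? (i Fin.≟ j) ×-dec
                     ¬? (Fin.any? λ l → (l ∈? L) ×-dec (toℕ l ℕ.≟ meet i j))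
  ; adj-sym    = λ {i} {j} (i≢j , ∉L) → i≢j ∘ sym ,
               ∉L ∘ subst InL (cong ∣_∣ (∩-comm (kSubset n k j) (kSubset n k i)))
  ; adj-irrefl = λ i≡j (i≢j , _) → i≢j i≡j
  }
  where
  meet : Fin (n C k) → Fin (n C k) → ℕ
  meet i j = ∣ kSubset n k i ∩ kSubset n k j ∣

  InL : ℕ → Set
  InL m = ∃[ l ] l ∈ L × toℕ l ≡ m

record JohnsonParameters : Set where
  field
    ground : ℕ
    k      : ℕ
    L      : Subset k

  order : ℕ
  order = ground C k

  graph : Graph order
  graph = johnson ground k L

{-# OPTIONS --safe #-}
module Submission where

-- Let q be a power of 2, k = q² - 1, and let k-subsets A ≠ B of an n-set be adjacent when
-- |A ∩ B| ≡ -1 mod q.  By Lucas' theorem C(x, q - 1) is odd exactly for x ≡ -1 mod q, so over 𝔽₂ the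
-- incidence vectors of the (q - 1)-subsets of A have a Gram matrix with unit diagonal that vanishes on
-- non-edges.  This representation is multiplicative under ⊠, and a family of orthonormal vectors in 𝔽₂ᵈ
-- has at most d members, which gives α, c ≤ R and N ≤ χ R for R = C(n, q - 1).
--
-- For ϑ, every l < k admits a positive semidefinite kernel h(|A ∩ B|) with h(l) = -1 and h(k) = O(n).
-- Multiplying out 1 + h over the q - 1 sizes l ≡ -1 mod q below k gives, by Schur's theorem, a kernel F
-- that vanishes on edges, has diagonal f = O(n^(q-1)), and for which F - J is positive semidefinite.
-- Then F / (N f) is feasible for G, so ϑ(G) ≥ N / f, and pairing F with a feasible matrix of the
-- complement gives ϑ(Gᶜ) ≤ f.  Thus all three quotients are at least N / (f R) up to a constant, where
-- f R = O(n^(2(q-1))) is at most a small power of N ~ n^(q²-1) once q is large.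

open import Algebra.Bundles using (CommutativeSemiring; CommutativeRing)
import Algebra.Properties.Monoid.Mult
import Algebra.Properties.Semiring.Sum
open import Data.Bool.Base using (Bool; true; false; _∧_; _∨_; _xor_; not; if_then_else_)
import Data.Bool.Properties as Bool
open import Data.Fin.Base as Fin
  using (Fin; zero; suc; toℕ; fromℕ<; splitAt; remQuot; quotRem; combine; funToFin; finToFun)
import Data.Fin.Properties as Fin
open import Data.Fin.Subset using (Subset; inside; outside; ∣_∣; _∩_; _∈_; ⊥; ⁅_⁆)
open import Data.Fin.Subset.Properties
  using (x∈⁅y⁆⇒x≡y; ∣⁅x⁆∣≡1; ∣⊥∣≡0; ∣p∩q∣≤∣p∣; ∣p∩q∣≤∣q∣; ∩-comm; ∩-idem)
open import Data.Integer.Base as ℤ using (+_; -[1+_])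
import Data.Integer.Properties as ℤ
open import Data.Nat.Base as ℕ using (ℕ; zero; suc; s≤s; z≤n; _!; _<_)
open import Data.Nat.Combinatorics using (nCk+nC[k+1]≡[n+1]C[k+1]; nCn≡1) renaming (_C_ to _choose_)
import Data.Nat.Properties as ℕ
open import Data.Nat.Solver renaming (module +-*-Solver to ℕ-Solver)
open import Data.Product using (Σ-syntax; ∃-syntax; _×_; _,_; proj₁; proj₂; map₁; map₂; swap; uncurry)
open import Data.Rational as ℚ using (ℚ; mkℚ; 0ℚ; 1ℚ; ½; ↥_; ↧ₙ_; toℚᵘ)
import Data.Rational.Properties as ℚ
open import Data.Rational.Solver renaming (module +-*-Solver to ℚ-Solver)
open import Data.Rational.Unnormalised.Base as ℚᵘ using (mkℚᵘ; *≡*; *≤*)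
import Data.Rational.Unnormalised.Properties as ℚᵘ
import Data.Sum.Base as Sum
open import Data.Sum.Base using (_⊎_; inj₁; inj₂; [_,_]′)
open import Data.Vec.Base using ([]; _∷_; here; there; tabulate)
open import Data.Vec.Properties using (lookup∘tabulate; []=⇒lookup; lookup⇒[]=)
open import Defs
open import Function.Base using (_∘_)
open import Function.Bundles using (Inverse)
open import Relation.Binary.PropositionalEquality hiding (setoid; J)
open import Relation.Nullary using (¬_; yes; no; contradiction)
open import Relation.Nullary.Decidable using (from-yes; from-no)
open JohnsonParameters using (order; graph)

-- The choice k = q² - 1 meets two demands. It lies in the class -1 mod q, so the Gram diagonal over
-- 𝔽₂ is 1, and only q - 1 smaller sizes share that class. Each of those costs a factor O(n) in f,
-- and R has degree q - 1 as well, while N has degree k = (q - 1)(q + 1) in n. The loss is therefore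
-- about N^(2/(q + 1)), which is below N^ε once q is large; all hidden constants depend on q alone.
-- The number N^(1-ε) is a supremum of rational powers, and ϑ and c are given only by their defining
-- properties. So these reals are handled through rational bounds, and the comparison with N^(1-ε)
-- becomes N^a (T R)^b ≤ (`constant` N)^b in natural numbers, for all a/b ≤ 1 - 1/e, where 1/e ≤ ε
-- and T is an integer bound on f.

-- Binomial coefficients and subsets of fixed size

binom : ℕ → ℕ → ℕ
binom _       zero    = 1
binom zero    (suc l) = 0
binom (suc m) (suc l) = binom m l ℕ.+ binom m (suc l)

binom≤^ : ∀ m l → binom m l ℕ.≤ m ℕ.^ l
binom≤^ m       zero    = ℕ.≤-refl
binom≤^ zero    (suc l) = z≤n
binom≤^ (suc m) (suc l) = begin
  binom m l ℕ.+ binom m (suc l)               ≤⟨ ℕ.+-mono-≤ (binom≤^ m l) (binom≤^ m (suc l)) ⟩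
  suc m ℕ.* m ℕ.^ l                           ≤⟨ ℕ.*-monoʳ-≤ (suc m) (ℕ.^-monoˡ-≤ l (ℕ.n≤1+n m)) ⟩
  suc m ℕ.* suc m ℕ.^ l                       ∎
  where open ℕ.≤-Reasoning

infix 4 _⊆ᵇ_
_⊆ᵇ_ : ∀ {n} → Subset n → Subset n → Bool
[]      ⊆ᵇ []      = true
(s ∷ S) ⊆ᵇ (x ∷ X) = (not s ∨ x) ∧ (S ⊆ᵇ X)

⊥⊆ᵇ : ∀ {n} (X : Subset n) → (⊥ ⊆ᵇ X) ≡ true
⊥⊆ᵇ []      = refl
⊥⊆ᵇ (x ∷ X) = ⊥⊆ᵇ X

⊆ᵇ-∩ : ∀ {n} (S X Y : Subset n) → (S ⊆ᵇ X ∩ Y) ≡ (S ⊆ᵇ X) ∧ (S ⊆ᵇ Y)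
⊆ᵇ-∩ []          []          []          = refl
⊆ᵇ-∩ (false ∷ S) (_ ∷ X)     (_ ∷ Y)     = ⊆ᵇ-∩ S X Y
⊆ᵇ-∩ (true ∷ S)  (false ∷ X) (_ ∷ Y)     = refl
⊆ᵇ-∩ (true ∷ S)  (true ∷ X)  (false ∷ Y) = sym (Bool.∧-zeroʳ _)
⊆ᵇ-∩ (true ∷ S)  (true ∷ X)  (true ∷ Y)  = ⊆ᵇ-∩ S X Y

-- The index follows Pascal's rule, so a sum over l-subsets splits by membership of the first
-- element just as `binom` unfolds.
subsetsOfSize : ∀ m l → Fin (binom m l) → Subset m
subsetsOfSize m       zero    _ = ⊥
subsetsOfSize (suc m) (suc l) t =
  [ (inside ∷_) ∘ subsetsOfSize m l , (outside ∷_) ∘ subsetsOfSize m (suc l) ]′ (splitAt (binom m l) t)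

∣subsetsOfSize∣ : ∀ m l t → ∣ subsetsOfSize m l t ∣ ≡ l
∣subsetsOfSize∣ m zero _ = ∣⊥∣≡0 m
∣subsetsOfSize∣ (suc m) (suc l) t with splitAt (binom m l) t
... | inj₁ t′ = cong suc (∣subsetsOfSize∣ m l t′)
... | inj₂ t′ = ∣subsetsOfSize∣ m (suc l) t′

-- Used over 𝔽₂ for the dimension bounds and over ℚ for the positive semidefinite kernels.
module Sums {c ℓ} (R : CommutativeSemiring c ℓ) where
  open CommutativeSemiring R hiding (zero) renaming (refl to ≈-refl; sym to ≈-sym; trans to ≈-trans)
  open Algebra.Properties.Semiring.Sum semiring public
    using (sum; sum-cong-≋; sum-replicate-zero; ∑-distrib-+; ∑-comm; *-distribˡ-sum; *-distribʳ-sum)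
  open Algebra.Properties.Monoid.Mult +-monoid public using (×-homo-+) renaming (_×_ to _∙_)
  open import Relation.Binary.Reasoning.Setoid setoid

  sum-splitAt : ∀ m {n} (h : Fin m ⊎ Fin n → Carrier) →
                sum (h ∘ splitAt m) ≈ sum (h ∘ inj₁) + sum (h ∘ inj₂)
  sum-splitAt zero    h = ≈-sym (+-identityˡ _)
  sum-splitAt (suc m) {n} h = begin
    h (inj₁ zero) + sum (h ∘ splitAt (suc m) ∘ suc)                  ≈⟨ +-congˡ (sum-splitAt m (h ∘ Sum.map₁ suc)) ⟩
    h (inj₁ zero) + (sum (h ∘ inj₁ ∘ suc) + sum (h ∘ inj₂))          ≈⟨ +-assoc _ _ _ ⟨
    sum (h ∘ inj₁) + sum (h ∘ inj₂)                                  ∎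

  sum-remQuot : ∀ m {n} (h : Fin m × Fin n → Carrier) →
                sum (h ∘ remQuot {m} n) ≈ sum λ i → sum λ j → h (i , j)
  sum-remQuot zero        h = ≈-refl
  sum-remQuot (suc m) {n} h = ≈-trans
    (sum-splitAt n (h ∘ swap ∘ [ (_, zero) , map₂ suc ∘ quotRem {m} n ]′))
    (+-congˡ (sum-remQuot m (h ∘ map₁ suc)))

  ⟦_⟧ : Bool → Carrier
  ⟦ b ⟧ = if b then 1# else 0#

  ⟦⟧-∧ : ∀ a b → ⟦ a ∧ b ⟧ ≈ ⟦ a ⟧ * ⟦ b ⟧
  ⟦⟧-∧ false b = ≈-sym (zeroˡ _)
  ⟦⟧-∧ true  b = ≈-sym (*-identityˡ _)

  -- Counts the l-subsets of X inside the semiring: over 𝔽₂ this is the parity of the binomial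
  -- coefficient, over ℚ its value.
  sum-⊆ : ∀ {m} l (X : Subset m) → sum (λ t → ⟦ subsetsOfSize m l t ⊆ᵇ X ⟧) ≈ binom ∣ X ∣ l ∙ 1#
  sum-⊆ {m} zero X rewrite ⊥⊆ᵇ X = ≈-refl
  sum-⊆ (suc l) [] = ≈-refl
  sum-⊆ {suc m} (suc l) (x ∷ X) = ≈-trans
    (sum-splitAt (binom m l)
      (λ s → ⟦ [ (inside ∷_) ∘ subsetsOfSize m l , (outside ∷_) ∘ subsetsOfSize m (suc l) ]′ s ⊆ᵇ (x ∷ X) ⟧))
    (rest x)
    where
    rest : ∀ x → sum (λ t → ⟦ x ∧ (subsetsOfSize m l t ⊆ᵇ X) ⟧) +
                 sum (λ t → ⟦ subsetsOfSize m (suc l) t ⊆ᵇ X ⟧) ≈ binom ∣ x ∷ X ∣ (suc l) ∙ 1#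
    rest false = ≈-trans (+-cong (sum-replicate-zero (binom m l)) (sum-⊆ (suc l) X)) (+-identityˡ _)
    rest true = ≈-trans (+-cong (sum-⊆ l X) (sum-⊆ (suc l) X))
                        (≈-sym (×-homo-+ 1# (binom ∣ X ∣ l) (binom ∣ X ∣ (suc l))))

-- Orthonormal representations over 𝔽₂

module 𝔽₂ = Sums (CommutativeRing.commutativeSemiring Bool.xor-∧-commutativeRing)

-- Parity as the image of n in 𝔽₂, so that additivity and `sum-⊆` apply directly.
odd : ℕ → Bool
odd n = n 𝔽₂.∙ true

dot : ∀ {d} → (Fin d → Bool) → (Fin d → Bool) → Bool
dot v w = 𝔽₂.sum λ t → v t ∧ w t

record Orthonormal {a d : ℕ} (v : Fin a → Fin d → Bool) : Set where
  field
    unit       : ∀ i → dot (v i) (v i) ≡ true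
    orthogonal : ∀ i j → i ≢ j → dot (v i) (v j) ≡ false

-- The 2ᵃ linear combinations of the vectors are distinct.
orthonormal⇒≤ : ∀ {a d} {v : Fin a → Fin d → Bool} → Orthonormal v → a ℕ.≤ d
orthonormal⇒≤ {a} {d} {v} on = ℕ.≮⇒≥ λ d<a →
  ℕ.<⇒≱ (ℕ.^-monoʳ-< 2 (s≤s (s≤s z≤n)) d<a) (Fin.injective⇒≤ {f = encode} encode-injective)
  where
  open Orthonormal on
  open 𝔽₂
  open ≡-Reasoning
  open Inverse Fin.2↔Bool using (to; from; strictlyInverseˡ; strictlyInverseʳ)

  sum-delta : ∀ {a} (x : Fin a → Bool) j (y : Fin a → Bool) → y j ≡ true → (∀ i → i ≢ j → y i ≡ false) →
              sum (λ i → x i ∧ y i) ≡ x j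
  sum-delta {suc a} x zero y yj≡1 y≡0 = begin
    (x zero ∧ y zero) xor sum (λ i → x (suc i) ∧ y (suc i))
      ≡⟨ cong₂ _xor_ (trans (cong (x zero ∧_) yj≡1) (Bool.∧-identityʳ _))
           (trans (sum-cong-≋ λ i → trans (cong (x (suc i) ∧_) (y≡0 (suc i) λ ())) (Bool.∧-zeroʳ _))
                  (sum-replicate-zero a)) ⟩
    x zero xor false ≡⟨ Bool.xor-identityʳ _ ⟩
    x zero ∎
  sum-delta x (suc j) y yj≡1 y≡0 = cong₂ _xor_
    (trans (cong (x zero ∧_) (y≡0 zero λ ())) (Bool.∧-zeroʳ _))
    (sum-delta (x ∘ suc) j (y ∘ suc) yj≡1 λ i i≢j → y≡0 (suc i) (i≢j ∘ Fin.suc-injective))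

  combination : (Fin a → Bool) → Fin d → Bool
  combination x t = sum λ i → x i ∧ v i t

  -- Orthonormality lets the coefficients be read off a combination; this gives injectivity by
  -- counting, with no theory of rank.
  coefficient : ∀ x j → dot (combination x) (v j) ≡ x j
  coefficient x j = begin
    sum (λ t → sum (λ i → x i ∧ v i t) ∧ v j t)
      ≡⟨ sum-cong-≋ (λ t → *-distribʳ-sum (v j t) λ i → x i ∧ v i t) ⟩
    sum (λ t → sum λ i → (x i ∧ v i t) ∧ v j t)
      ≡⟨ ∑-comm (λ t i → (x i ∧ v i t) ∧ v j t) ⟩
    sum (λ i → sum λ t → (x i ∧ v i t) ∧ v j t)
      ≡⟨ sum-cong-≋ (λ i → trans (sum-cong-≋ λ t → Bool.∧-assoc (x i) (v i t) (v j t))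
           (sym (*-distribˡ-sum (x i) λ t → v i t ∧ v j t))) ⟩
    sum (λ i → x i ∧ dot (v i) (v j))
      ≡⟨ sum-delta x j (λ i → dot (v i) (v j)) (unit j) (λ i → orthogonal i j) ⟩
    x j ∎

  decode : ∀ n → Fin (2 ℕ.^ n) → Fin n → Bool
  decode n p = to ∘ finToFun {2} {n} p

  decode-injective : ∀ n {p q : Fin (2 ℕ.^ n)} → decode n p ≗ decode n q → p ≡ q
  decode-injective n {p} {q} eq = begin
    p                       ≡⟨ Fin.funToFin-finToFin {n} {2} p ⟨
    funToFin (finToFun {2} {n} p) ≡⟨ funToFin-cong (λ i → from-to (eq i)) ⟩
    funToFin (finToFun {2} {n} q) ≡⟨ Fin.funToFin-finToFin {n} {2} q ⟩
    q                       ∎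
    where
    from-to : ∀ {b c} → to b ≡ to c → b ≡ c
    from-to {b} {c} e = trans (sym (strictlyInverseʳ b)) (trans (cong from e) (strictlyInverseʳ c))

    funToFin-cong : ∀ {n} {f g : Fin n → Fin 2} → f ≗ g → funToFin f ≡ funToFin g
    funToFin-cong {zero}  f≗g = refl
    funToFin-cong {suc n} f≗g = cong₂ combine (f≗g zero) (funToFin-cong (f≗g ∘ suc))

  encode : Fin (2 ℕ.^ a) → Fin (2 ℕ.^ d)
  encode p = funToFin (from ∘ combination (decode a p))

  decode-encode : ∀ p → decode d (encode p) ≗ combination (decode a p)
  decode-encode p t = trans (cong to (Fin.finToFun-funToFin (from ∘ combination (decode a p)) t)) (strictlyInverseˡ _)

  encode-injective : ∀ {p q} → encode p ≡ encode q → p ≡ q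
  encode-injective {p} {q} e = decode-injective a λ j → begin
    decode a p j                             ≡⟨ coefficient (decode a p) j ⟨
    dot (combination (decode a p)) (v j)     ≡⟨ sum-cong-≋ (λ t → cong (_∧ v j t) (same t)) ⟩
    dot (combination (decode a q)) (v j)     ≡⟨ coefficient (decode a q) j ⟩
    decode a q j                             ∎
    where
    same : combination (decode a p) ≗ combination (decode a q)
    same t = trans (sym (decode-encode p t)) (trans (cong (λ r → decode d r t) e) (decode-encode q t))

_⊗_ : ∀ {d d′} → (Fin d → Bool) → (Fin d′ → Bool) → Fin (d ℕ.* d′) → Bool
_⊗_ {d} {d′} v w = (λ (s , t) → v s ∧ w t) ∘ remQuot {d} d′

dot-⊗ : ∀ {d d′} (v v′ : Fin d → Bool) (w w′ : Fin d′ → Bool) →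
        dot (v ⊗ w) (v′ ⊗ w′) ≡ dot v v′ ∧ dot w w′
dot-⊗ {d} {d′} v v′ w w′ = begin
  dot (v ⊗ w) (v′ ⊗ w′)
    ≡⟨ sum-remQuot d (λ (s , t) → (v s ∧ w t) ∧ (v′ s ∧ w′ t)) ⟩
  sum (λ s → sum λ t → (v s ∧ w t) ∧ (v′ s ∧ w′ t))
    ≡⟨ sum-cong-≋ (λ s → sum-cong-≋ λ t → interchange (v s) (w t) (v′ s) (w′ t)) ⟩
  sum (λ s → sum λ t → (v s ∧ v′ s) ∧ (w t ∧ w′ t))
    ≡⟨ sum-cong-≋ (λ s → sym (*-distribˡ-sum (v s ∧ v′ s) λ t → w t ∧ w′ t)) ⟩
  sum (λ s → (v s ∧ v′ s) ∧ dot w w′)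
    ≡⟨ *-distribʳ-sum (dot w w′) (λ s → v s ∧ v′ s) ⟨
  dot v v′ ∧ dot w w′ ∎
  where
  open 𝔽₂
  open ≡-Reasoning
  interchange : ∀ a b c d → (a ∧ b) ∧ (c ∧ d) ≡ (a ∧ c) ∧ (b ∧ d)
  interchange false b c     d = refl
  interchange true  b true  d = refl
  interchange true  b false d = Bool.∧-zeroʳ b

-- Haemers' bound over 𝔽₂: a Gram matrix with unit diagonal that vanishes on non-edges.
record Representation {n} (G : Graph n) (d : ℕ) : Set where
  field
    vector     : Fin n → Fin d → Bool
    unit       : ∀ i → dot (vector i) (vector i) ≡ true
    orthogonal : ∀ i j → i ≢ j → ¬ Adj G i j → dot (vector i) (vector j) ≡ false

  equal-or-adjacent : ∀ i j → dot (vector i) (vector j) ≡ true → i ≡ j ⊎ Adj G i j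
  equal-or-adjacent i j e with i Fin.≟ j | adj? G i j
  ... | yes i≡j | _        = inj₁ i≡j
  ... | no _    | yes adj  = inj₂ adj
  ... | no i≢j  | no ¬adj  = contradiction (trans (sym e) (orthogonal i j i≢j ¬adj)) λ ()

open Representation

∧-true⁻ : ∀ {a b} → a ∧ b ≡ true → a ≡ true × b ≡ true
∧-true⁻ {true} {true} _ = refl , refl

-- The product of tensors is the product of the two dot products, so a nonzero value forces "equal
-- or adjacent" in both coordinates. Of the four cases one is equality of the pairs, and the other
-- three are the clauses of adjacency in the strong product.
⊠-representation : ∀ {n m d d′} {G : Graph n} {H : Graph m} →
  Representation G d → Representation H d′ → Representation (G ⊠ H) (d ℕ.* d′)
⊠-representation {n} {m} {G = G} {H} U V = record
  { vector     = λ p → vector U (proj₁ (pair p)) ⊗ vector V (proj₂ (pair p))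
  ; unit       = λ p → trans (dot-⊗ (vector U (proj₁ (pair p))) _ (vector V (proj₂ (pair p))) _)
                   (cong₂ _∧_ (unit U (proj₁ (pair p))) (unit V (proj₂ (pair p))))
  ; orthogonal = λ p r p≢r ¬adj → Bool.¬-not λ e →
      separate p r p≢r ¬adj (∧-true⁻ (trans (sym (dot-⊗ (vector U (proj₁ (pair p))) _ (vector V (proj₂ (pair p))) _)) e))
  }
  where
  pair : Fin (n ℕ.* m) → Fin n × Fin m
  pair = remQuot {n} m

  separate : ∀ p r → p ≢ r → ¬ Adj (G ⊠ H) p r →
    ¬ (dot (vector U (proj₁ (pair p))) (vector U (proj₁ (pair r))) ≡ true ×
       dot (vector V (proj₂ (pair p))) (vector V (proj₂ (pair r))) ≡ true)
  separate p r p≢r ¬adj (eU , eV)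
    with equal-or-adjacent U _ _ eU | equal-or-adjacent V _ _ eV
  ... | inj₁ u≡ | inj₁ v≡ = p≢r (begin
    p                        ≡⟨ Fin.combine-remQuot {n} m p ⟨
    uncurry combine (pair p) ≡⟨ cong₂ combine u≡ v≡ ⟩
    uncurry combine (pair r) ≡⟨ Fin.combine-remQuot {n} m r ⟩
    r                        ∎)
    where open ≡-Reasoning
  ... | inj₁ u≡ | inj₂ v~ = ¬adj (inj₁ (u≡ , v~))
  ... | inj₂ u~ | inj₁ v≡ = ¬adj (inj₂ (inj₁ (u~ , v≡)))
  ... | inj₂ u~ | inj₂ v~ = ¬adj (inj₂ (inj₂ (u~ , v~)))

^⊠-representation : ∀ {n d} {G : Graph n} → Representation G d → ∀ m → Representation (G ^⊠ m) (d ℕ.^ m)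
^⊠-representation U zero = record
  { vector     = λ _ _ → true
  ; unit       = λ _ → refl
  ; orthogonal = λ { zero zero 0≢0 _ → contradiction refl 0≢0 }
  }
^⊠-representation U (suc m) = ⊠-representation U (^⊠-representation U m)

-- Bounds on the independence and chromatic numbers

element : ∀ {n} (S : Subset n) → Fin ∣ S ∣ → Fin n
element (true ∷ S)  zero    = zero
element (true ∷ S)  (suc i) = suc (element S i)
element (false ∷ S) i       = suc (element S i)

element-∈ : ∀ {n} (S : Subset n) i → element S i ∈ S
element-∈ (true ∷ S)  zero    = here
element-∈ (true ∷ S)  (suc i) = there (element-∈ S i)
element-∈ (false ∷ S) i       = there (element-∈ S i)

element-injective : ∀ {n} (S : Subset n) {i j} → element S i ≡ element S j → i ≡ j
element-injective (true ∷ S)  {zero}  {zero}  _ = refl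
element-injective (true ∷ S)  {suc i} {suc j} e = cong suc (element-injective S (Fin.suc-injective e))
element-injective (false ∷ S)                 e = element-injective S (Fin.suc-injective e)

-- On an independent set all distinct pairs are non-adjacent, so the vectors there are orthonormal.
α≤dimension : ∀ {n d} {G : Graph n} → Representation G d → α G ℕ.≤ d
α≤dimension {d = d} {G} U = subst (ℕ._≤ d) ∣S∣≡α (orthonormal⇒≤ {v = vector U ∘ element S} record
  { unit       = unit U ∘ element S
  ; orthogonal = λ i j i≢j → orthogonal U _ _ (i≢j ∘ element-injective S)
      (independent _ _ (element-∈ S i) (element-∈ S j))
  })
  where
  largest : ∃[ S ] Independent G S × ∣ S ∣ ≡ α G
  largest = proj₁ (proj₂ (independenceNumber G))
  S           = proj₁ largest
  independent = proj₁ (proj₂ largest)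
  ∣S∣≡α       = proj₂ (proj₂ largest)

1≤α : ∀ {n} (G : Graph n) → Fin n → 1 ℕ.≤ α G
1≤α G v = subst (ℕ._≤ α G) (∣⁅x⁆∣≡1 v) (proj₂ (proj₂ (independenceNumber G)) ⁅ v ⁆ λ i j i∈ j∈ →
  adj-irrefl G (trans (x∈⁅y⁆⇒x≡y v i∈) (sym (x∈⁅y⁆⇒x≡y v j∈))))

-- Tensoring each vector with the basis vector of its colour makes the whole family orthonormal.
order≤χ*dimension : ∀ {n d} {G : Graph n} → Representation G d → n ℕ.≤ χ G ℕ.* d
order≤χ*dimension {n} {d} {G} U = orthonormal⇒≤ {v = λ i → basis (f i) ⊗ vector U i} record
  { unit       = λ i → trans (dot-⊗ (basis (f i)) _ (vector U i) _) (cong₂ _∧_ (basis-unit (f i)) (unit U i))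
  ; orthogonal = λ i j i≢j → trans (dot-⊗ (basis (f i)) _ (vector U i) _) (separate i j i≢j)
  }
  where
  colouring : Colourable G (χ G)
  colouring = proj₁ (proj₂ (chromaticNumber G))
  f      = proj₁ colouring
  proper = proj₂ colouring

  basis : ∀ {c} → Fin c → Fin c → Bool
  basis zero    zero    = true
  basis zero    (suc _) = false
  basis (suc _) zero    = false
  basis (suc s) (suc t) = basis s t

  zeros : ∀ c → 𝔽₂.sum {c} (λ _ → false) ≡ false
  zeros = 𝔽₂.sum-replicate-zero

  basis-unit : ∀ {c} (s : Fin c) → dot (basis s) (basis s) ≡ true
  basis-unit {suc c} zero    = cong not (zeros c)
  basis-unit (suc s)         = basis-unit s

  basis-orthogonal : ∀ {c} (s t : Fin c) → s ≢ t → dot (basis s) (basis t) ≡ false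
  basis-orthogonal zero    zero    0≢0 = contradiction refl 0≢0
  basis-orthogonal {suc c} zero (suc t) _ = zeros c
  basis-orthogonal {suc c} (suc s) zero _ = trans (𝔽₂.sum-cong-≋ λ t → Bool.∧-zeroʳ (basis s t)) (zeros c)
  basis-orthogonal (suc s) (suc t) s≢t = basis-orthogonal s t (s≢t ∘ cong suc)

  -- Vertices of one colour are non-adjacent, so the second factor vanishes; for two colours the
  -- first one does.
  separate : ∀ i j → i ≢ j → dot (basis (f i)) (basis (f j)) ∧ dot (vector U i) (vector U j) ≡ false
  separate i j i≢j with f i Fin.≟ f j
  ... | yes e = trans (cong (dot (basis (f i)) (basis (f j)) ∧_) (orthogonal U i j i≢j λ adj → proper i j adj e)) (Bool.∧-zeroʳ _)
  ... | no ne = cong (_∧ _) (basis-orthogonal (f i) (f j) ne)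

-- Binomial coefficients modulo 2

double : ℕ → ℕ
double zero    = zero
double (suc n) = suc (suc (double n))

double≡ : ∀ n → double n ≡ n ℕ.+ n
double≡ zero    = refl
double≡ (suc n) = cong suc (trans (cong suc (double≡ n)) (sym (ℕ.+-suc n n)))

-- The number 2^e - 1, built by appending binary digits 1, which is the recursion that Lucas'
-- theorem follows.
mersenne : ℕ → ℕ
mersenne zero    = 0
mersenne (suc e) = suc (double (mersenne e))

n≤mersenne : ∀ n → n ℕ.≤ mersenne n
n≤mersenne zero    = z≤n
n≤mersenne (suc n) = s≤s (ℕ.≤-trans (n≤mersenne n)
  (subst (mersenne n ℕ.≤_) (sym (double≡ (mersenne n))) (ℕ.m≤m+n _ _)))

odd-+ : ∀ a b → odd (a ℕ.+ b) ≡ odd a xor odd b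
odd-+ = 𝔽₂.×-homo-+ true

-- The coefficient form of (1 + t)² = 1 + t² mod 2: Pascal's rule used twice yields the middle term
-- twice.
odd-binom-step : ∀ n j → odd (binom (2 ℕ.+ n) (2 ℕ.+ j)) ≡ odd (binom n j) xor odd (binom n (2 ℕ.+ j))
odd-binom-step n j
  rewrite odd-+ (binom n j ℕ.+ binom n (suc j)) (binom n (suc j) ℕ.+ binom n (2 ℕ.+ j))
        | odd-+ (binom n j) (binom n (suc j)) | odd-+ (binom n (suc j)) (binom n (2 ℕ.+ j))
  = cancel (odd (binom n j)) (odd (binom n (suc j))) (odd (binom n (2 ℕ.+ j)))
  where
  cancel : ∀ a b c → (a xor b) xor (b xor c) ≡ a xor c
  cancel false false c = refl
  cancel false true  c = Bool.not-involutive c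
  cancel true  false c = refl
  cancel true  true  c = refl

-- Lucas' theorem modulo 2.
odd-binom-double : ∀ x y → odd (binom (double x) (double y)) ≡ odd (binom x y)
odd-binom-double x       zero    = refl
odd-binom-double zero    (suc y) = refl
odd-binom-double (suc x) (suc y) = begin
  odd (binom (double (suc x)) (double (suc y)))
    ≡⟨ odd-binom-step (double x) (double y) ⟩
  odd (binom (double x) (double y)) xor odd (binom (double x) (double (suc y)))
    ≡⟨ cong₂ _xor_ (odd-binom-double x y) (odd-binom-double x (suc y)) ⟩
  odd (binom x y) xor odd (binom x (suc y))
    ≡⟨ odd-+ (binom x y) (binom x (suc y)) ⟨
  odd (binom (suc x) (suc y)) ∎
  where open ≡-Reasoning

-- Modulo 2, (1 + t)^(2x) = (1 + t²)^x has no odd powers of t.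
even-binom-double-suc : ∀ x y → odd (binom (double x) (suc (double y))) ≡ false
even-binom-double-suc zero    y       = refl
even-binom-double-suc (suc x) zero    = trans (Bool.not-involutive _) (even-binom-double-suc x zero)
even-binom-double-suc (suc x) (suc y) = trans (odd-binom-step (double x) (suc (double y)))
  (cong₂ _xor_ (even-binom-double-suc x y) (even-binom-double-suc x (suc y)))

odd-binom-suc-double : ∀ x y → odd (binom (suc (double x)) (suc (double y))) ≡ odd (binom x y)
odd-binom-suc-double x y = begin
  odd (binom (suc (double x)) (suc (double y)))
    ≡⟨ odd-+ (binom (double x) (double y)) _ ⟩
  odd (binom (double x) (double y)) xor odd (binom (double x) (suc (double y)))
    ≡⟨ cong₂ _xor_ (odd-binom-double x y) (even-binom-double-suc x y) ⟩
  odd (binom x y) xor false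
    ≡⟨ Bool.xor-identityʳ _ ⟩
  odd (binom x y) ∎
  where open ≡-Reasoning

-- Appending a binary digit 1 carries the class -1 modulo μ + 1 to the class -1 modulo 2 (μ + 1),
-- with the same quotient j.
suc-double-residue : ∀ μ j → suc (double (μ ℕ.+ j ℕ.* suc μ)) ≡ suc (double μ) ℕ.+ j ℕ.* suc (suc (double μ))
suc-double-residue μ j rewrite double≡ (μ ℕ.+ j ℕ.* suc μ) | double≡ μ =
  solve 2 (λ μ j → con 1 :+ ((μ :+ j :* (con 1 :+ μ)) :+ (μ :+ j :* (con 1 :+ μ))) :=
                   (con 1 :+ (μ :+ μ)) :+ j :* (con 2 :+ (μ :+ μ))) refl μ j
  where open ℕ-Solver

-- All e binary digits of `mersenne e` are 1, so by Lucas the coefficient is odd exactly when the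
-- last e digits of the upper argument are 1. The recursion strips one digit at a time, here and in
-- the converse below.
odd-binom-mersenne⁺ : ∀ e j → odd (binom (mersenne e ℕ.+ j ℕ.* suc (mersenne e)) (mersenne e)) ≡ true
odd-binom-mersenne⁺ zero    j = refl
odd-binom-mersenne⁺ (suc e) j = trans
  (cong (λ x → odd (binom x (mersenne (suc e)))) (sym (suc-double-residue (mersenne e) j)))
  (trans (odd-binom-suc-double _ (mersenne e)) (odd-binom-mersenne⁺ e j))

odd-binom-mersenne⁻ : ∀ e x → odd (binom x (mersenne e)) ≡ true →
                      ∃[ j ] x ≡ mersenne e ℕ.+ j ℕ.* suc (mersenne e)
odd-binom-mersenne⁻ zero    x _ = x , sym (ℕ.*-identityʳ x)
odd-binom-mersenne⁻ (suc e) x o with halve x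
  where
  halve : ∀ x → (∃[ y ] x ≡ double y) ⊎ (∃[ y ] x ≡ suc (double y))
  halve zero = inj₁ (0 , refl)
  halve (suc x) with halve x
  ... | inj₁ (y , e) = inj₂ (y , cong suc e)
  ... | inj₂ (y , e) = inj₁ (suc y , cong suc e)
... | inj₁ (y , refl) = contradiction (trans (sym o) (even-binom-double-suc y (mersenne e))) λ ()
... | inj₂ (y , refl) =
  let j , y≡ = odd-binom-mersenne⁻ e y (trans (sym (odd-binom-suc-double y (mersenne e))) o)
  in j , trans (cong (suc ∘ double) y≡) (suc-double-residue (mersenne e) j)

-- Generalized Johnson graphs

∩-full⇒≡ : ∀ {n} (X Y : Subset n) → ∣ X ∩ Y ∣ ≡ ∣ X ∣ → ∣ X ∩ Y ∣ ≡ ∣ Y ∣ → X ≡ Y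
∩-full⇒≡ []          []          _ _ = refl
∩-full⇒≡ (true ∷ X)  (true ∷ Y)  p q = cong (true ∷_) (∩-full⇒≡ X Y (ℕ.suc-injective p) (ℕ.suc-injective q))
∩-full⇒≡ (false ∷ X) (false ∷ Y) p q = cong (false ∷_) (∩-full⇒≡ X Y p q)
∩-full⇒≡ (true ∷ X)  (false ∷ Y) p q = contradiction (subst (ℕ._≤ ∣ X ∣) p (∣p∩q∣≤∣p∣ X Y)) ℕ.1+n≰n
∩-full⇒≡ (false ∷ X) (true ∷ Y)  p q = contradiction (subst (ℕ._≤ ∣ Y ∣) q (∣p∩q∣≤∣q∣ X Y)) ℕ.1+n≰n

module _ (n k : ℕ) where

  meet : Fin (n choose k) → Fin (n choose k) → ℕ
  meet i j = ∣ kSubset n k i ∩ kSubset n k j ∣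

  ∣kSubset∣ : ∀ i → ∣ kSubset n k i ∣ ≡ k
  ∣kSubset∣ i = proj₂ (Inverse.to (kSubsets n k) i)

  kSubset-injective : ∀ {i j} → kSubset n k i ≡ kSubset n k j → i ≡ j
  kSubset-injective {i} {j} e =
    trans (sym (strictlyInverseʳ i)) (trans (cong from (same (to i) (to j) e)) (strictlyInverseʳ j))
    where
    open Inverse (kSubsets n k)
    same : (A B : KSubset n k) → proj₁ A ≡ proj₁ B → A ≡ B
    same (A , p) (.A , q) refl = cong (A ,_) (ℕ.≡-irrelevant p q)

  meet-diagonal : ∀ i → meet i i ≡ k
  meet-diagonal i = trans (cong ∣_∣ (∩-idem (kSubset n k i))) (∣kSubset∣ i)

  meet<k : ∀ {i j} → i ≢ j → meet i j ℕ.< k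
  meet<k {i} {j} i≢j = ℕ.≤∧≢⇒< (subst (meet i j ℕ.≤_) (∣kSubset∣ i) (∣p∩q∣≤∣p∣ (kSubset n k i) (kSubset n k j))) λ e →
    i≢j (kSubset-injective (∩-full⇒≡ (kSubset n k i) (kSubset n k j)
      (trans e (sym (∣kSubset∣ i))) (trans e (sym (∣kSubset∣ j)))))

-- The non-adjacent sizes, given by parity because parity is what the Gram matrix over 𝔽₂ computes.
-- Only for a Mersenne number r is this turned into a residue condition.
evenBinomials : ∀ k r → Subset k
evenBinomials k r = tabulate λ l → not (odd (binom (toℕ l) r))

module _ {n k r : ℕ} where

  odd⇒adjacent : ∀ {i j} → i ≢ j → odd (binom (meet n k i j) r) ≡ true → Adj (johnson n k (evenBinomials k r)) i j
  odd⇒adjacent {i} {j} i≢j o = i≢j , λ (l , l∈L , l≡) → contradiction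
    (trans (sym ([]=⇒lookup l∈L)) (trans (lookup∘tabulate _ l) (cong not (trans (cong (λ x → odd (binom x r)) l≡) o)))) λ ()

  adjacent⇒odd : ∀ {i j} → Adj (johnson n k (evenBinomials k r)) i j → odd (binom (meet n k i j) r) ≡ true
  adjacent⇒odd {i} {j} (i≢j , ∉L) with odd (binom (meet n k i j) r) in e
  ... | true  = refl
  ... | false = contradiction
    (fromℕ< (meet<k n k i≢j) ,
     lookup⇒[]= _ _ (trans (lookup∘tabulate _ (fromℕ< (meet<k n k i≢j)))
       (cong not (trans (cong (λ x → odd (binom x r)) (Fin.toℕ-fromℕ< (meet<k n k i≢j))) e))) ,
     Fin.toℕ-fromℕ< (meet<k n k i≢j)) ∉L

  johnson-representation : odd (binom k r) ≡ true →
    Representation (johnson n k (evenBinomials k r)) (binom n r)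
  johnson-representation oddk = record
    { vector     = λ i t → subsetsOfSize n r t ⊆ᵇ kSubset n k i
    ; unit       = λ i → trans (gram i i) (trans (cong (λ x → odd (binom x r)) (meet-diagonal n k i)) oddk)
    ; orthogonal = λ i j i≢j ¬adj → Bool.¬-not λ e → ¬adj (odd⇒adjacent i≢j (trans (sym (gram i j)) e))
    }
    where
    -- The common r-subsets of two sets are the r-subsets of their intersection.
    gram : ∀ i j → dot (λ t → subsetsOfSize n r t ⊆ᵇ kSubset n k i) (λ t → subsetsOfSize n r t ⊆ᵇ kSubset n k j)
                   ≡ odd (binom (meet n k i j) r)
    gram i j = trans
      (𝔽₂.sum-cong-≋ λ t → trans (sym (⊆ᵇ-∩ (subsetsOfSize n r t) (kSubset n k i) (kSubset n k j)))
        (indicator (subsetsOfSize n r t ⊆ᵇ kSubset n k i ∩ kSubset n k j)))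
      (𝔽₂.sum-⊆ r (kSubset n k i ∩ kSubset n k j))
      where
      indicator : ∀ b → b ≡ 𝔽₂.⟦ b ⟧
      indicator true  = refl
      indicator false = refl

binom≡C : ∀ n k → binom n k ≡ n choose k
binom≡C n       zero    = refl
binom≡C zero    (suc k) = refl
binom≡C (suc n) (suc k) = trans (cong₂ ℕ._+_ (binom≡C n k) (binom≡C n (suc k))) (nCk+nC[k+1]≡[n+1]C[k+1] n k)

binom-diagonal : ∀ l → binom l l ≡ 1
binom-diagonal l = trans (binom≡C l l) (nCn≡1 l)

1≤binom : ∀ {n k} → k ℕ.≤ n → 1 ℕ.≤ binom n k
1≤binom z≤n       = ℕ.≤-refl
1≤binom (s≤s k≤n) = ℕ.≤-trans (1≤binom k≤n) (ℕ.m≤m+n _ _)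

-- Growth of binomial coefficients

binom-absorption : ∀ n k → suc k ℕ.* binom (suc n) (suc k) ≡ suc n ℕ.* binom n k
binom-absorption zero    zero    = refl
binom-absorption zero    (suc k) = ℕ.*-zeroʳ (suc (suc k))
binom-absorption (suc n) zero    = begin
  1 ℕ.* (1 ℕ.+ binom (suc n) 1)          ≡⟨ solve 1 (λ b → con 1 :* (con 1 :+ b) := con 1 :+ con 1 :* b) refl (binom (suc n) 1) ⟩
  1 ℕ.+ 1 ℕ.* binom (suc n) 1            ≡⟨ cong suc (binom-absorption n zero) ⟩
  1 ℕ.+ suc n ℕ.* 1                      ∎
  where
  open ≡-Reasoning
  open ℕ-Solver
binom-absorption (suc n) (suc k) = begin
  suc (suc k) ℕ.* (binom (suc n) (suc k) ℕ.+ binom (suc n) (suc (suc k)))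
    ≡⟨ solve 3 (λ k b c → (con 2 :+ k) :* (b :+ c) := b :+ ((con 1 :+ k) :* b :+ (con 2 :+ k) :* c)) refl
         k (binom (suc n) (suc k)) (binom (suc n) (suc (suc k))) ⟩
  binom (suc n) (suc k) ℕ.+ (suc k ℕ.* binom (suc n) (suc k) ℕ.+ suc (suc k) ℕ.* binom (suc n) (suc (suc k)))
    ≡⟨ cong (binom (suc n) (suc k) ℕ.+_) (cong₂ ℕ._+_ (binom-absorption n k) (binom-absorption n (suc k))) ⟩
  binom (suc n) (suc k) ℕ.+ (suc n ℕ.* binom n k ℕ.+ suc n ℕ.* binom n (suc k))
    ≡⟨ cong (binom (suc n) (suc k) ℕ.+_) (ℕ.*-distribˡ-+ (suc n) (binom n k) (binom n (suc k))) ⟨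
  suc (suc n) ℕ.* binom (suc n) (suc k) ∎
  where
  open ≡-Reasoning
  open ℕ-Solver

-- The right side equals (i + 1)(i + 2) ... (i + k), and each factor is at least i + 1.
^≤!*binom : ∀ k i → suc i ℕ.^ k ℕ.≤ k ! ℕ.* binom (k ℕ.+ i) k
^≤!*binom zero    i = ℕ.≤-refl
^≤!*binom (suc k) i = begin
  suc i ℕ.* suc i ℕ.^ k
    ≤⟨ ℕ.*-mono-≤ (s≤s (ℕ.m≤n+m i k)) (^≤!*binom k i) ⟩
  suc (k ℕ.+ i) ℕ.* (k ! ℕ.* binom (k ℕ.+ i) k)
    ≡⟨ solve 3 (λ n f b → n :* (f :* b) := f :* (n :* b)) refl (suc (k ℕ.+ i)) (k !) (binom (k ℕ.+ i) k) ⟩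
  k ! ℕ.* (suc (k ℕ.+ i) ℕ.* binom (k ℕ.+ i) k)
    ≡⟨ cong (k ! ℕ.*_) (binom-absorption (k ℕ.+ i) k) ⟨
  k ! ℕ.* (suc k ℕ.* binom (suc (k ℕ.+ i)) (suc k))
    ≡⟨ solve 3 (λ f k b → f :* (k :* b) := k :* f :* b) refl (k !) (suc k) (binom (suc (k ℕ.+ i)) (suc k)) ⟩
  suc k ! ℕ.* binom (suc k ℕ.+ i) (suc k) ∎
  where
  open ℕ.≤-Reasoning
  open ℕ-Solver

^-distribʳ-* : ∀ m n o → (m ℕ.* n) ℕ.^ o ≡ m ℕ.^ o ℕ.* n ℕ.^ o
^-distribʳ-* m n zero    = refl
^-distribʳ-* m n (suc o) = trans (cong (m ℕ.* n ℕ.*_) (^-distribʳ-* m n o))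
  (solve 4 (λ m n x y → m :* n :* (x :* y) := m :* x :* (n :* y)) refl m n (m ℕ.^ o) (n ℕ.^ o))
  where open ℕ-Solver

-- From k + i ≤ k (i + 1): passing from i + 1 to the full ground size costs only k^k, which is
-- independent of i.
^≤binom : ∀ k i → 1 ℕ.≤ k → (k ℕ.+ i) ℕ.^ k ℕ.≤ k ℕ.^ k ℕ.* k ! ℕ.* binom (k ℕ.+ i) k
^≤binom k i 1≤k = begin
  (k ℕ.+ i) ℕ.^ k                              ≤⟨ ℕ.^-monoˡ-≤ k k+i≤ ⟩
  (k ℕ.* suc i) ℕ.^ k                          ≡⟨ ^-distribʳ-* k (suc i) k ⟩
  k ℕ.^ k ℕ.* suc i ℕ.^ k                      ≤⟨ ℕ.*-monoʳ-≤ (k ℕ.^ k) (^≤!*binom k i) ⟩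
  k ℕ.^ k ℕ.* (k ! ℕ.* binom (k ℕ.+ i) k)      ≡⟨ ℕ.*-assoc (k ℕ.^ k) (k !) _ ⟨
  k ℕ.^ k ℕ.* k ! ℕ.* binom (k ℕ.+ i) k        ∎
  where
  open ℕ.≤-Reasoning
  k+i≤ : k ℕ.+ i ℕ.≤ k ℕ.* suc i
  k+i≤ = subst (k ℕ.+ i ℕ.≤_) (sym (ℕ.*-suc k i)) (ℕ.+-monoʳ-≤ k
    (subst (ℕ._≤ k ℕ.* i) (ℕ.*-identityˡ i) (ℕ.*-monoˡ-≤ i 1≤k)))

^-cancelˡ-≤ : ∀ e {a b} → a ℕ.^ suc e ℕ.≤ b ℕ.^ suc e → a ℕ.≤ b
^-cancelˡ-≤ e a^≤b^ = ℕ.≮⇒≥ λ b<a → ℕ.<⇒≱ (ℕ.^-monoˡ-< (suc e) b<a) a^≤b^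

1≤^ₙ : ∀ {a} n → 1 ℕ.≤ a → 1 ℕ.≤ a ℕ.^ n
1≤^ₙ {a} n 1≤a = subst (ℕ._≤ a ℕ.^ n) (ℕ.^-zeroˡ n) (ℕ.^-monoˡ-≤ n 1≤a)

-- If Dᵉ ≤ cᵉ N then N ^ (a / b) ≤ c N / D whenever a / b ≤ 1 - 1 / e.
power-tradeoff : ∀ e {D c N} → D ℕ.^ suc e ℕ.≤ c ℕ.^ suc e ℕ.* N → 1 ℕ.≤ N →
  ∀ a b → suc e ℕ.* a ℕ.+ suc b ℕ.≤ suc e ℕ.* suc b → N ℕ.^ a ℕ.* D ℕ.^ suc b ℕ.≤ (c ℕ.* N) ℕ.^ suc b
-- In e-th powers the hypothesis on D applies b times and leaves N^(ea + b), which is at most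
-- N^(eb).
power-tradeoff e′ {D} {c} {N} D^e≤ 1≤N a b′ ea+b≤eb = ^-cancelˡ-≤ e′ (begin
  (N ℕ.^ a ℕ.* D ℕ.^ b) ℕ.^ e
    ≡⟨ ^-distribʳ-* (N ℕ.^ a) (D ℕ.^ b) e ⟩
  (N ℕ.^ a) ℕ.^ e ℕ.* (D ℕ.^ b) ℕ.^ e
    ≡⟨ cong₂ ℕ._*_ (trans (ℕ.^-*-assoc N a e) (cong (N ℕ.^_) (ℕ.*-comm a e))) (^-swap D b e) ⟩
  N ℕ.^ (e ℕ.* a) ℕ.* (D ℕ.^ e) ℕ.^ b
    ≤⟨ ℕ.*-monoʳ-≤ (N ℕ.^ (e ℕ.* a)) (ℕ.^-monoˡ-≤ b D^e≤) ⟩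
  N ℕ.^ (e ℕ.* a) ℕ.* (c ℕ.^ e ℕ.* N) ℕ.^ b
    ≡⟨ cong (N ℕ.^ (e ℕ.* a) ℕ.*_) (^-distribʳ-* (c ℕ.^ e) N b) ⟩
  N ℕ.^ (e ℕ.* a) ℕ.* ((c ℕ.^ e) ℕ.^ b ℕ.* N ℕ.^ b)
    ≡⟨ solve 3 (λ x y z → x :* (y :* z) := y :* (x :* z)) refl (N ℕ.^ (e ℕ.* a)) ((c ℕ.^ e) ℕ.^ b) (N ℕ.^ b) ⟩
  (c ℕ.^ e) ℕ.^ b ℕ.* (N ℕ.^ (e ℕ.* a) ℕ.* N ℕ.^ b)
    ≡⟨ cong₂ ℕ._*_ (^-swap c e b) (sym (ℕ.^-distribˡ-+-* N (e ℕ.* a) b)) ⟩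
  (c ℕ.^ b) ℕ.^ e ℕ.* N ℕ.^ (e ℕ.* a ℕ.+ b)
    ≤⟨ ℕ.*-monoʳ-≤ ((c ℕ.^ b) ℕ.^ e) (ℕ.^-monoʳ-≤ N {{ℕ.>-nonZero 1≤N}} ea+b≤eb) ⟩
  (c ℕ.^ b) ℕ.^ e ℕ.* N ℕ.^ (e ℕ.* b)
    ≡⟨ cong ((c ℕ.^ b) ℕ.^ e ℕ.*_) (trans (cong (N ℕ.^_) (ℕ.*-comm e b)) (sym (ℕ.^-*-assoc N b e))) ⟩
  (c ℕ.^ b) ℕ.^ e ℕ.* (N ℕ.^ b) ℕ.^ e
    ≡⟨ trans (cong (ℕ._^ e) (^-distribʳ-* c N b)) (^-distribʳ-* (c ℕ.^ b) (N ℕ.^ b) e) ⟨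
  ((c ℕ.* N) ℕ.^ b) ℕ.^ e ∎)
  where
  open ℕ.≤-Reasoning
  open ℕ-Solver
  e b : ℕ
  e = suc e′
  b = suc b′
  ^-swap : ∀ x m n → (x ℕ.^ m) ℕ.^ n ≡ (x ℕ.^ n) ℕ.^ m
  ^-swap x m n = trans (ℕ.^-*-assoc x m n) (trans (cong (x ℕ.^_) (ℕ.*-comm m n)) (sym (ℕ.^-*-assoc x n m)))

open ℚ-Solver using (solve; con; _:=_; _:+_; _:*_; _:-_; :-_)

-- Rationals and reals

ι : ℕ → ℚ
ι n = + n ℚ./ 1

toℚᵘ-/1 : ∀ i → toℚᵘ (i ℚ./ 1) ℚᵘ.≃ mkℚᵘ i 0
toℚᵘ-/1 i = ℚ.toℚᵘ-fromℚᵘ (mkℚᵘ i 0)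

ι-+ : ∀ m n → ι (m ℕ.+ n) ≡ ι m ℚ.+ ι n
ι-+ m n = ℚ.toℚᵘ-injective (begin
  toℚᵘ (ι (m ℕ.+ n))                ≈⟨ toℚᵘ-/1 (+ (m ℕ.+ n)) ⟩
  mkℚᵘ (+ (m ℕ.+ n)) 0              ≈⟨ *≡* (cong (ℤ._* + 1) (sym (cong₂ ℤ._+_ (ℤ.*-identityʳ (+ m)) (ℤ.*-identityʳ (+ n))))) ⟩
  mkℚᵘ (+ m) 0 ℚᵘ.+ mkℚᵘ (+ n) 0    ≈⟨ ℚᵘ.+-cong (toℚᵘ-/1 (+ m)) (toℚᵘ-/1 (+ n)) ⟨
  toℚᵘ (ι m) ℚᵘ.+ toℚᵘ (ι n)        ≈⟨ ℚ.toℚᵘ-homo-+ (ι m) (ι n) ⟨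
  toℚᵘ (ι m ℚ.+ ι n)                ∎)
  where open ℚᵘ.≃-Reasoning

ι-* : ∀ m n → ι (m ℕ.* n) ≡ ι m ℚ.* ι n
ι-* m n = ℚ.toℚᵘ-injective (begin
  toℚᵘ (ι (m ℕ.* n))                ≈⟨ toℚᵘ-/1 (+ (m ℕ.* n)) ⟩
  mkℚᵘ (+ (m ℕ.* n)) 0              ≈⟨ *≡* (cong (ℤ._* + 1) (ℤ.pos-* m n)) ⟩
  mkℚᵘ (+ m) 0 ℚᵘ.* mkℚᵘ (+ n) 0    ≈⟨ ℚᵘ.*-cong (toℚᵘ-/1 (+ m)) (toℚᵘ-/1 (+ n)) ⟨
  toℚᵘ (ι m) ℚᵘ.* toℚᵘ (ι n)        ≈⟨ ℚ.toℚᵘ-homo-* (ι m) (ι n) ⟨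
  toℚᵘ (ι m ℚ.* ι n)                ∎)
  where open ℚᵘ.≃-Reasoning

ι-mono-≤ : ∀ {m n} → m ℕ.≤ n → ι m ℚ.≤ ι n
ι-mono-≤ {m} {n} m≤n = ℚ.toℚᵘ-cancel-≤ (begin
  toℚᵘ (ι m)   ≃⟨ toℚᵘ-/1 (+ m) ⟩
  mkℚᵘ (+ m) 0 ≤⟨ *≤* (ℤ.*-monoʳ-≤-nonNeg (+ 1) (ℤ.+≤+ m≤n)) ⟩
  mkℚᵘ (+ n) 0 ≃⟨ toℚᵘ-/1 (+ n) ⟨
  toℚᵘ (ι n)   ∎)
  where open ℚᵘ.≤-Reasoning

ι-cancel-≤ : ∀ {m n} → ι m ℚ.≤ ι n → m ℕ.≤ n
ι-cancel-≤ {m} {n} ιm≤ιn with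
  ℚᵘ.≤-trans (ℚᵘ.≤-reflexive (ℚᵘ.≃-sym (toℚᵘ-/1 (+ m))))
  (ℚᵘ.≤-trans (ℚ.toℚᵘ-mono-≤ ιm≤ιn) (ℚᵘ.≤-reflexive (toℚᵘ-/1 (+ n))))
... | *≤* m≤n = ℤ.drop‿+≤+ (ℤ.*-cancelʳ-≤-pos (+ m) (+ n) (+ 1) m≤n)

0≤ι : ∀ n → 0ℚ ℚ.≤ ι n
0≤ι n = ι-mono-≤ {0} {n} z≤n

*-denominator : ∀ p → p ℚ.* ι (↧ₙ p) ≡ ↥ p ℚ./ 1
*-denominator p@record{} = ℚ.toℚᵘ-injective (begin
  toℚᵘ (p ℚ.* ι (↧ₙ p))               ≈⟨ ℚ.toℚᵘ-homo-* p (ι (↧ₙ p)) ⟩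
  toℚᵘ p ℚᵘ.* toℚᵘ (ι (↧ₙ p))         ≈⟨ ℚᵘ.*-congˡ {toℚᵘ p} (toℚᵘ-/1 (+ ↧ₙ p)) ⟩
  toℚᵘ p ℚᵘ.* mkℚᵘ (+ ↧ₙ p) 0         ≈⟨ *≡* (trans (ℤ.*-identityʳ _) (cong (↥ p ℤ.*_) (sym (ℤ.*-identityʳ (+ ↧ₙ p))))) ⟩
  mkℚᵘ (↥ p) 0                        ≈⟨ toℚᵘ-/1 (↥ p) ⟨
  toℚᵘ (↥ p ℚ./ 1)                    ∎)
  where open ℚᵘ.≃-Reasoning

*-mono-≤ : ∀ {a b c d} → 0ℚ ℚ.≤ c → 0ℚ ℚ.≤ b → a ℚ.≤ b → c ℚ.≤ d → a ℚ.* c ℚ.≤ b ℚ.* d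
*-mono-≤ {a} {b} {c} {d} 0≤c 0≤b a≤b c≤d = ℚ.≤-trans
  (ℚ.*-monoʳ-≤-nonNeg c {{ℚ.nonNegative 0≤c}} a≤b)
  (ℚ.*-monoˡ-≤-nonNeg b {{ℚ.nonNegative 0≤b}} c≤d)

0≤* : ∀ {a b} → 0ℚ ℚ.≤ a → 0ℚ ℚ.≤ b → 0ℚ ℚ.≤ a ℚ.* b
0≤* {a} {b} 0≤a 0≤b = subst (ℚ._≤ a ℚ.* b) (ℚ.*-zeroˡ 0ℚ) (*-mono-≤ ℚ.≤-refl 0≤a 0≤a 0≤b)

0≤+ : ∀ {a b} → 0ℚ ℚ.≤ a → 0ℚ ℚ.≤ b → 0ℚ ℚ.≤ a ℚ.+ b
0≤+ = ℚ.+-mono-≤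

0≤x² : ∀ x → 0ℚ ℚ.≤ x ℚ.* x
0≤x² x with ℚ.≤-total 0ℚ x
... | inj₁ 0≤x = 0≤* 0≤x 0≤x
... | inj₂ x≤0 = subst (0ℚ ℚ.≤_) (solve 1 (λ x → (:- x) :* (:- x) := x :* x) refl x) (0≤* 0≤-x 0≤-x)
  where
  0≤-x = ℚ.neg-antimono-≤ x≤0

p≤∣p∣ : ∀ p → p ℚ.≤ ℚ.∣ p ∣
p≤∣p∣ p with ℚ.≤-total 0ℚ p
... | inj₁ 0≤p = ℚ.≤-reflexive (sym (ℚ.0≤p⇒∣p∣≡p 0≤p))
... | inj₂ p≤0 = ℚ.≤-trans p≤0 (ℚ.0≤∣p∣ p)

p≤p+q : ∀ {p q} → 0ℚ ℚ.≤ q → p ℚ.≤ p ℚ.+ q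
p≤p+q {p} {q} 0≤q = subst (ℚ._≤ p ℚ.+ q) (ℚ.+-identityʳ p) (ℚ.+-monoʳ-≤ p 0≤q)

sub-add : ∀ a b → b ℚ.+ (a ℚ.- b) ≡ a
sub-add = solve 2 (λ a b → b :+ (a :- b) := a) refl

∣p-q∣≤r⇒p≤q+r : ∀ {p q r} → ℚ.∣ p ℚ.- q ∣ ℚ.≤ r → p ℚ.≤ q ℚ.+ r
∣p-q∣≤r⇒p≤q+r {p} {q} ≤r = subst (ℚ._≤ _) (sub-add p q) (ℚ.+-monoʳ-≤ q (ℚ.≤-trans (p≤∣p∣ (p ℚ.- q)) ≤r))

0<½* : ∀ {δ} → 0ℚ ℚ.< δ → 0ℚ ℚ.< ½ ℚ.* δ
0<½* {δ} 0<δ = subst (ℚ._< ½ ℚ.* δ) (ℚ.*-zeroʳ ½) (ℚ.*-monoʳ-<-pos ½ 0<δ)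

½+½ : ∀ δ → ½ ℚ.* δ ℚ.+ ½ ℚ.* δ ≡ δ
½+½ δ = trans (sym (ℚ.*-distribʳ-+ δ ½ ½)) (ℚ.*-identityˡ δ)

inverse : ∀ q → 0ℚ ℚ.< q → ∃[ r ] 0ℚ ℚ.< r × q ℚ.* r ≡ 1ℚ
inverse q 0<q = ℚ.1/ q , ℚ.positive⁻¹ _ {{ℚ.1/pos⇒pos q}} , ℚ.*-inverseʳ q
  where
  instance
    q-positive : ℚ.Positive q
    q-positive = ℚ.positive 0<q

    q-nonZero : ℚ.NonZero q
    q-nonZero = ℚ.pos⇒nonZero q

0<* : ∀ {p q} → 0ℚ ℚ.< p → 0ℚ ℚ.< q → 0ℚ ℚ.< p ℚ.* q
0<* {p} {q} 0<p 0<q = ℚ.positive⁻¹ _ {{ℚ.pos*pos⇒pos p {{ℚ.positive 0<p}} q {{ℚ.positive 0<q}}}}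

-- Take η = δ / (M + δ): the δ in the denominator covers M = 0 and also makes η ≤ 1.
small-factor : ∀ M δ → 0ℚ ℚ.≤ M → 0ℚ ℚ.< δ → ∃[ η ] 0ℚ ℚ.< η × η ℚ.≤ 1ℚ × M ℚ.* η ℚ.≤ δ
small-factor M δ 0≤M 0<δ = go (inverse (M ℚ.+ δ) 0<s)
  where
  0<s : 0ℚ ℚ.< M ℚ.+ δ
  0<s = ℚ.+-mono-≤-< 0≤M 0<δ

  go : (∃[ r ] 0ℚ ℚ.< r × (M ℚ.+ δ) ℚ.* r ≡ 1ℚ) → ∃[ η ] 0ℚ ℚ.< η × η ℚ.≤ 1ℚ × M ℚ.* η ℚ.≤ δ
  go (r , 0<r , sr≡1) = δ ℚ.* r , 0<* 0<δ 0<r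
    , subst (δ ℚ.* r ℚ.≤_) sr≡1 (*-mono-≤ {δ} (ℚ.<⇒≤ 0<r) (ℚ.<⇒≤ 0<s) δ≤s ℚ.≤-refl)
    , (begin
      M ℚ.* (δ ℚ.* r)           ≡⟨ solve 3 (λ M δ r → M :* (δ :* r) := δ :* (M :* r)) refl M δ r ⟩
      δ ℚ.* (M ℚ.* r)           ≤⟨ ℚ.*-monoˡ-≤-nonNeg δ {{ℚ.nonNegative (ℚ.<⇒≤ 0<δ)}} Mr≤1 ⟩
      δ ℚ.* 1ℚ                  ≡⟨ ℚ.*-identityʳ δ ⟩
      δ                         ∎)
    where
    open ℚ.≤-Reasoning
    δ≤s : δ ℚ.≤ M ℚ.+ δ
    δ≤s = subst (ℚ._≤ M ℚ.+ δ) (ℚ.+-identityˡ δ) (ℚ.+-monoˡ-≤ δ 0≤M)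
    Mr≤1 : M ℚ.* r ℚ.≤ 1ℚ
    Mr≤1 = subst (M ℚ.* r ℚ.≤_) sr≡1 (*-mono-≤ {M} (ℚ.<⇒≤ 0<r) (ℚ.<⇒≤ 0<s) (p≤p+q {M} (ℚ.<⇒≤ 0<δ)) ℚ.≤-refl)

-- The order of the Cauchy reals

Eventually : (ℕ → Set) → Set
Eventually P = ∃[ N ] ∀ n → N ℕ.≤ n → P n

eventually-map : ∀ {P Q} → (∀ n → P n → Q n) → Eventually P → Eventually Q
eventually-map f (N , p) = N , λ n N≤n → f n (p n N≤n)

eventually-map₂ : ∀ {P Q R} → (∀ n → P n → Q n → R n) → Eventually P → Eventually Q → Eventually R
eventually-map₂ f (M , p) (N , q) = M ℕ.⊔ N , λ n ≤n →
  f n (p n (ℕ.m⊔n≤o⇒m≤o M N ≤n)) (q n (ℕ.m⊔n≤o⇒n≤o M N ≤n))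

pointwise-≤ : ∀ {x y} → (∀ n → seq x n ℚ.≤ seq y n) → x ≤ᴿ y
pointwise-≤ x≤y δ 0<δ = 0 , λ n _ → ℚ.≤-trans (x≤y n) (p≤p+q (ℚ.<⇒≤ 0<δ))

pointwise-≡ : ∀ {x y} → (∀ n → seq x n ≡ seq y n) → x ≤ᴿ y
pointwise-≡ {x} {y} x≡y = pointwise-≤ {x} {y} (ℚ.≤-reflexive ∘ x≡y)

pointwise-≈ : ∀ {x y} → (∀ n → seq x n ≡ seq y n) → x ≈ᴿ y
pointwise-≈ {x} {y} x≡y δ 0<δ = 0 , λ n _ → begin
  ℚ.∣ seq x n ℚ.- seq y n ∣ ≡⟨ cong (λ z → ℚ.∣ z ℚ.- seq y n ∣) (x≡y n) ⟩
  ℚ.∣ seq y n ℚ.- seq y n ∣ ≡⟨ cong ℚ.∣_∣ (ℚ.+-inverseʳ (seq y n)) ⟩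
  0ℚ                        ≤⟨ ℚ.<⇒≤ 0<δ ⟩
  δ                         ∎
  where open ℚ.≤-Reasoning

≈⇒≤ : ∀ {x y} → x ≈ᴿ y → x ≤ᴿ y
≈⇒≤ x≈y δ 0<δ = eventually-map (λ _ → ∣p-q∣≤r⇒p≤q+r) (x≈y δ 0<δ)

≈-sym : ∀ {x y} → x ≈ᴿ y → y ≈ᴿ x
≈-sym {x} {y} x≈y δ 0<δ = eventually-map
  (λ n → subst (ℚ._≤ δ) (trans (sym (ℚ.∣-p∣≡∣p∣ _)) (cong ℚ.∣_∣ (flip (seq x n) (seq y n))))) (x≈y δ 0<δ)
  where
  flip : ∀ a b → ℚ.- (a ℚ.- b) ≡ b ℚ.- a
  flip = solve 2 (λ a b → :- (a :- b) := b :- a) refl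

≤ᴿ-trans : ∀ {x y z} → x ≤ᴿ y → y ≤ᴿ z → x ≤ᴿ z
≤ᴿ-trans {x} {y} {z} x≤y y≤z δ 0<δ = eventually-map₂ step (x≤y _ (0<½* 0<δ)) (y≤z _ (0<½* 0<δ))
  where
  open ℚ.≤-Reasoning
  step : ∀ n → seq x n ℚ.≤ seq y n ℚ.+ ½ ℚ.* δ → seq y n ℚ.≤ seq z n ℚ.+ ½ ℚ.* δ → seq x n ℚ.≤ seq z n ℚ.+ δ
  step n p q = begin
    seq x n                                   ≤⟨ p ⟩
    seq y n ℚ.+ ½ ℚ.* δ                       ≤⟨ ℚ.+-monoˡ-≤ (½ ℚ.* δ) q ⟩
    (seq z n ℚ.+ ½ ℚ.* δ) ℚ.+ ½ ℚ.* δ         ≡⟨ ℚ.+-assoc (seq z n) _ _ ⟩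
    seq z n ℚ.+ (½ ℚ.* δ ℚ.+ ½ ℚ.* δ)         ≡⟨ cong (seq z n ℚ.+_) (½+½ δ) ⟩
    seq z n ℚ.+ δ                             ∎

≤ᴿ-refl : ∀ {x} → x ≤ᴿ x
≤ᴿ-refl {x} = pointwise-≤ {x} {x} λ _ → ℚ.≤-refl

+ᴿ-mono-≤ : ∀ {x y z w} → x ≤ᴿ y → z ≤ᴿ w → x +ᴿ z ≤ᴿ y +ᴿ w
+ᴿ-mono-≤ {x} {y} {z} {w} x≤y z≤w δ 0<δ = eventually-map₂ step (x≤y _ (0<½* 0<δ)) (z≤w _ (0<½* 0<δ))
  where
  open ℚ.≤-Reasoning
  step : ∀ n → seq x n ℚ.≤ seq y n ℚ.+ ½ ℚ.* δ → seq z n ℚ.≤ seq w n ℚ.+ ½ ℚ.* δ →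
         seq x n ℚ.+ seq z n ℚ.≤ (seq y n ℚ.+ seq w n) ℚ.+ δ
  step n p q = begin
    seq x n ℚ.+ seq z n
      ≤⟨ ℚ.+-mono-≤ p q ⟩
    (seq y n ℚ.+ ½ ℚ.* δ) ℚ.+ (seq w n ℚ.+ ½ ℚ.* δ)
      ≡⟨ solve 3 (λ y w d → (y :+ d) :+ (w :+ d) := (y :+ w) :+ (d :+ d)) refl (seq y n) (seq w n) (½ ℚ.* δ) ⟩
    (seq y n ℚ.+ seq w n) ℚ.+ (½ ℚ.* δ ℚ.+ ½ ℚ.* δ)
      ≡⟨ cong ((seq y n ℚ.+ seq w n) ℚ.+_) (½+½ δ) ⟩
    (seq y n ℚ.+ seq w n) ℚ.+ δ ∎

∑-mono-≤ : ∀ {n} {x y : Fin n → ℝ} → (∀ i → x i ≤ᴿ y i) → ∑ x ≤ᴿ ∑ y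
∑-mono-≤ {zero}  x≤y = ≤ᴿ-refl {0ᴿ}
∑-mono-≤ {suc n} {x} {y} x≤y =
  +ᴿ-mono-≤ {x zero} {y zero} {∑ (x ∘ suc)} {∑ (y ∘ suc)} (x≤y zero) (∑-mono-≤ {n} {x ∘ suc} {y ∘ suc} (x≤y ∘ suc))

∑-≤-single : ∀ {n} (x : Fin n → ℝ) i → (∀ j → i ≢ j → x j ≤ᴿ 0ᴿ) → ∑ x ≤ᴿ x i
∑-≤-single {suc n} x zero x≤0 = ≤ᴿ-trans {∑ x} {x zero +ᴿ 0ᴿ} {x zero}
  (+ᴿ-mono-≤ {x zero} {x zero} {∑ (x ∘ suc)} {0ᴿ} (≤ᴿ-refl {x zero}) (∑≤0 (x ∘ suc) (λ j → x≤0 (suc j) λ ())))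
  (pointwise-≡ {x zero +ᴿ 0ᴿ} {x zero} λ k → ℚ.+-identityʳ _)
  where
  ∑≤0 : ∀ {n} (x : Fin n → ℝ) → (∀ j → x j ≤ᴿ 0ᴿ) → ∑ x ≤ᴿ 0ᴿ
  ∑≤0 {zero}  x x≤0 = ≤ᴿ-refl {0ᴿ}
  ∑≤0 {suc n} x x≤0 = ≤ᴿ-trans {∑ x} {0ᴿ +ᴿ 0ᴿ} {0ᴿ}
    (+ᴿ-mono-≤ {x zero} {0ᴿ} {∑ (x ∘ suc)} {0ᴿ} (x≤0 zero) (∑≤0 (x ∘ suc) (x≤0 ∘ suc)))
    (pointwise-≡ {0ᴿ +ᴿ 0ᴿ} {0ᴿ} λ k → refl)
∑-≤-single {suc n} x (suc i) x≤0 = ≤ᴿ-trans {∑ x} {0ᴿ +ᴿ x (suc i)} {x (suc i)}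
  (+ᴿ-mono-≤ {x zero} {0ᴿ} {∑ (x ∘ suc)} {x (suc i)} (x≤0 zero λ ())
    (∑-≤-single (x ∘ suc) i λ j i≢j → x≤0 (suc j) (i≢j ∘ Fin.suc-injective)))
  (pointwise-≡ {0ᴿ +ᴿ x (suc i)} {x (suc i)} λ k → ℚ.+-identityˡ _)

scale-mono-≤ : ∀ {c x y} → 0ℚ ℚ.≤ c → x ≤ᴿ y → fromℚ c *ᴿ x ≤ᴿ fromℚ c *ᴿ y
scale-mono-≤ {c} {x} {y} 0≤c x≤y δ 0<δ =
  let η , 0<η , _ , cη≤δ = small-factor c δ 0≤c 0<δ in
  eventually-map (λ n p → begin
    c ℚ.* seq x n                ≤⟨ ℚ.*-monoˡ-≤-nonNeg c {{ℚ.nonNegative 0≤c}} p ⟩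
    c ℚ.* (seq y n ℚ.+ η)        ≡⟨ ℚ.*-distribˡ-+ c (seq y n) η ⟩
    c ℚ.* seq y n ℚ.+ c ℚ.* η    ≤⟨ ℚ.+-monoʳ-≤ (c ℚ.* seq y n) cη≤δ ⟩
    c ℚ.* seq y n ℚ.+ δ          ∎) (x≤y η 0<η)
  where open ℚ.≤-Reasoning

fromℚ-mono-≤ : ∀ {p q} → p ℚ.≤ q → fromℚ p ≤ᴿ fromℚ q
fromℚ-mono-≤ {p} {q} p≤q = pointwise-≤ {fromℚ p} {fromℚ q} λ _ → p≤q

-- If q < p, a rational δ strictly between them makes δ - q a tolerance too small for the real
-- inequality. Constancy is only asked termwise, so that finite sums such as `pairing` with constant
-- entries qualify.
constant-≤ : ∀ {x y p q} → (∀ k → seq x k ≡ p) → (∀ k → seq y k ≡ q) → x ≤ᴿ y → p ℚ.≤ q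
constant-≤ {x} {y} {p} {q} x≡p y≡q x≤y = ℚ.≮⇒≥ λ q<p → absurd q<p (ℚ.<-dense q<p)
  where
  absurd : q ℚ.< p → ¬ (∃[ δ ] q ℚ.< δ × δ ℚ.< p)
  absurd q<p (δ , q<δ , δ<p) = ℚ.<-irrefl refl (ℚ.<-≤-trans δ<p (subst (p ℚ.≤_) (sub-add δ q)
    (subst₂ (λ a b → a ℚ.≤ b ℚ.+ (δ ℚ.- q)) (x≡p (proj₁ close)) (y≡q (proj₁ close)) (proj₂ close (proj₁ close) ℕ.≤-refl))))
    where
    close : Eventually λ k → seq x k ℚ.≤ seq y k ℚ.+ (δ ℚ.- q)
    close = x≤y (δ ℚ.- q) (subst (ℚ._< δ ℚ.- q) (ℚ.+-inverseʳ q) (ℚ.+-monoˡ-< (ℚ.- q) q<δ))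

fromℚ-cancel-≤ : ∀ {p q} → fromℚ p ≤ᴿ fromℚ q → p ℚ.≤ q
fromℚ-cancel-≤ {p} {q} = constant-≤ {fromℚ p} {fromℚ q} (λ _ → refl) (λ _ → refl)

-- Powers and roots

infixr 8 _^ℚ_
_^ℚ_ : ℚ → ℕ → ℚ
p ^ℚ zero  = 1ℚ
p ^ℚ suc n = p ℚ.* p ^ℚ n

seq-^ : ∀ x m n → seq (x ^ᴿ m) n ≡ seq x n ^ℚ m
seq-^ x zero    n = refl
seq-^ x (suc m) n = cong (seq x n ℚ.*_) (seq-^ x m n)

0≤^ : ∀ {p} n → 0ℚ ℚ.≤ p → 0ℚ ℚ.≤ p ^ℚ n
0≤^ zero    0≤p = ℚ.nonNegative⁻¹ 1ℚ
0≤^ (suc n) 0≤p = 0≤* 0≤p (0≤^ n 0≤p)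

0<^ : ∀ {p} n → 0ℚ ℚ.< p → 0ℚ ℚ.< p ^ℚ n
0<^ zero    0<p = ℚ.positive⁻¹ 1ℚ
0<^ (suc n) 0<p = 0<* 0<p (0<^ n 0<p)

^-monoˡ-≤ : ∀ {p q} n → 0ℚ ℚ.≤ p → p ℚ.≤ q → p ^ℚ n ℚ.≤ q ^ℚ n
^-monoˡ-≤ zero    0≤p p≤q = ℚ.≤-refl
^-monoˡ-≤ (suc n) 0≤p p≤q = *-mono-≤ (0≤^ n 0≤p) (ℚ.≤-trans 0≤p p≤q) p≤q (^-monoˡ-≤ n 0≤p p≤q)

1≤^ : ∀ {p} n → 1ℚ ℚ.≤ p → 1ℚ ℚ.≤ p ^ℚ n
1≤^ zero    1≤p = ℚ.≤-refl
1≤^ (suc n) 1≤p = *-mono-≤ {1ℚ} (ℚ.nonNegative⁻¹ 1ℚ) (ℚ.≤-trans (ℚ.nonNegative⁻¹ 1ℚ) 1≤p) 1≤p (1≤^ n 1≤p)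

ι-^ : ∀ b n → ι (b ℕ.^ n) ≡ ι b ^ℚ n
ι-^ b zero    = refl
ι-^ b (suc n) = trans (ι-* b (b ℕ.^ n)) (cong (ι b ℚ.*_) (ι-^ b n))

^-distrib-* : ∀ p q n → (p ℚ.* q) ^ℚ n ≡ p ^ℚ n ℚ.* q ^ℚ n
^-distrib-* p q zero    = refl
^-distrib-* p q (suc n) = trans (cong (p ℚ.* q ℚ.*_) (^-distrib-* p q n))
  (solve 4 (λ p q x y → p :* q :* (x :* y) := p :* x :* (q :* y)) refl p q (p ^ℚ n) (q ^ℚ n))

-- An explicit gap between the powers of u and u + δ, used to extract roots without continuity
-- arguments.
^-superadditive : ∀ {u δ} n → 0ℚ ℚ.≤ u → 0ℚ ℚ.≤ δ → u ^ℚ suc n ℚ.+ δ ^ℚ suc n ℚ.≤ (u ℚ.+ δ) ^ℚ suc n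
^-superadditive {u} {δ} n 0≤u 0≤δ = begin
  u ℚ.* u ^ℚ n ℚ.+ δ ℚ.* δ ^ℚ n
    ≤⟨ ℚ.+-mono-≤ (ℚ.*-monoˡ-≤-nonNeg u {{ℚ.nonNegative 0≤u}} (^-monoˡ-≤ n 0≤u u≤s))
                  (ℚ.*-monoˡ-≤-nonNeg δ {{ℚ.nonNegative 0≤δ}} (^-monoˡ-≤ n 0≤δ δ≤s)) ⟩
  u ℚ.* (u ℚ.+ δ) ^ℚ n ℚ.+ δ ℚ.* (u ℚ.+ δ) ^ℚ n
    ≡⟨ ℚ.*-distribʳ-+ ((u ℚ.+ δ) ^ℚ n) u δ ⟨
  (u ℚ.+ δ) ^ℚ suc n ∎
  where
  open ℚ.≤-Reasoning
  u≤s : u ℚ.≤ u ℚ.+ δ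
  u≤s = p≤p+q 0≤δ
  δ≤s : δ ℚ.≤ u ℚ.+ δ
  δ≤s = subst (ℚ._≤ u ℚ.+ δ) (ℚ.+-identityˡ δ) (ℚ.+-monoˡ-≤ δ 0≤u)

-- Let ζ = δ / 2 and m = n + 1. A term of r above u + δ has m-th power strictly above (u + ζ)^m,
-- hence above u^m + ζ^m; the tolerance ζ^m in the hypothesis rules this out.
root-≤ : ∀ {r u} n → 0ℚ ℚ.≤ u → r ^ᴿ suc n ≤ᴿ fromℚ (u ^ℚ suc n) → r ≤ᴿ fromℚ u
root-≤ {r} {u} n 0≤u r^≤u^ δ 0<δ = eventually-map step (r^≤u^ (ζ ^ℚ suc n) (0<^ (suc n) 0<ζ))
  where
  open ℚ.≤-Reasoning
  ζ : ℚ
  ζ = ½ ℚ.* δ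
  0<ζ : 0ℚ ℚ.< ζ
  0<ζ = 0<½* 0<δ
  0≤u+ζ : 0ℚ ℚ.≤ u ℚ.+ ζ
  0≤u+ζ = 0≤+ 0≤u (ℚ.<⇒≤ 0<ζ)

  beyond : ∀ x → u ℚ.+ δ ℚ.< x → (u ℚ.+ ζ) ^ℚ suc n ℚ.< x ^ℚ suc n
  beyond x u+δ<x = begin-strict
    (u ℚ.+ ζ) ^ℚ suc n
      ≡⟨ ℚ.+-identityʳ _ ⟨
    (u ℚ.+ ζ) ^ℚ suc n ℚ.+ 0ℚ
      <⟨ ℚ.+-monoʳ-< ((u ℚ.+ ζ) ^ℚ suc n) (0<^ (suc n) 0<ζ) ⟩
    (u ℚ.+ ζ) ^ℚ suc n ℚ.+ ζ ^ℚ suc n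
      ≤⟨ ^-superadditive n 0≤u+ζ (ℚ.<⇒≤ 0<ζ) ⟩
    ((u ℚ.+ ζ) ℚ.+ ζ) ^ℚ suc n
      ≡⟨ cong (_^ℚ suc n) (trans (ℚ.+-assoc u ζ ζ) (cong (u ℚ.+_) (½+½ δ))) ⟩
    (u ℚ.+ δ) ^ℚ suc n
      ≤⟨ ^-monoˡ-≤ (suc n) (0≤+ 0≤u (ℚ.<⇒≤ 0<δ)) (ℚ.<⇒≤ u+δ<x) ⟩
    x ^ℚ suc n ∎

  step : ∀ i → seq (r ^ᴿ suc n) i ℚ.≤ u ^ℚ suc n ℚ.+ ζ ^ℚ suc n → seq r i ℚ.≤ u ℚ.+ δ
  step i p = ℚ.≮⇒≥ λ u+δ<r → ℚ.<-irrefl refl (ℚ.<-≤-trans (beyond (seq r i) u+δ<r) (begin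
    seq r i ^ℚ suc n                ≡⟨ seq-^ r (suc n) i ⟨
    seq (r ^ᴿ suc n) i              ≤⟨ p ⟩
    u ^ℚ suc n ℚ.+ ζ ^ℚ suc n       ≤⟨ ^-superadditive n 0≤u (ℚ.<⇒≤ 0<ζ) ⟩
    (u ℚ.+ ζ) ^ℚ suc n              ∎))

-- The hypothesis 0 ≤ r excludes the negative roots of even order.
½≤root : ∀ {r} n → 0ᴿ ≤ᴿ r → 1ᴿ ≤ᴿ r ^ᴿ suc n → fromℚ ½ ≤ᴿ r
½≤root {r} n 0≤r 1≤r^ δ 0<δ = N , λ i N≤i → ℚ.≤-trans (proj₂ eventually i N≤i) (p≤p+q (ℚ.<⇒≤ 0<δ))
  where
  open ℚ.≤-Reasoning
  0<¼ : 0ℚ ℚ.< ½ ℚ.* ½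
  0<¼ = ℚ.positive⁻¹ (½ ℚ.* ½)

  small-power : ∀ x → ℚ.∣ x ∣ ℚ.≤ ½ → x ^ℚ suc n ℚ.≤ ½
  small-power x ∣x∣≤½ = begin
    x ^ℚ suc n                     ≤⟨ p≤∣p∣ (x ^ℚ suc n) ⟩
    ℚ.∣ x ^ℚ suc n ∣               ≡⟨ abs-^ (suc n) ⟩
    ℚ.∣ x ∣ ^ℚ suc n               ≤⟨ *-mono-≤ {ℚ.∣ x ∣} {½} {ℚ.∣ x ∣ ^ℚ n} {1ℚ} (0≤^ n (ℚ.0≤∣p∣ x)) (ℚ.nonNegative⁻¹ ½) ∣x∣≤½ (≤1 n) ⟩
    ½ ℚ.* 1ℚ                       ≡⟨ ℚ.*-identityʳ ½ ⟩
    ½                              ∎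
    where
    abs-^ : ∀ n → ℚ.∣ x ^ℚ n ∣ ≡ ℚ.∣ x ∣ ^ℚ n
    abs-^ zero    = refl
    abs-^ (suc n) = trans (ℚ.∣p*q∣≡∣p∣*∣q∣ x (x ^ℚ n)) (cong (ℚ.∣ x ∣ ℚ.*_) (abs-^ n))

    one : ∀ n → 1ℚ ^ℚ n ≡ 1ℚ
    one zero    = refl
    one (suc n) = trans (ℚ.*-identityˡ _) (one n)

    ≤1 : ∀ n → ℚ.∣ x ∣ ^ℚ n ℚ.≤ 1ℚ
    ≤1 n = subst (ℚ.∣ x ∣ ^ℚ n ℚ.≤_) (one n)
      (^-monoˡ-≤ n (ℚ.0≤∣p∣ x) (ℚ.≤-trans ∣x∣≤½ (from-yes (½ ℚ.≤? 1ℚ))))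

  -- The tolerances are ½ and ¼. A term that is at most ½ is also at least -½, so its power is at
  -- most ½, and ½ + ¼ < 1.
  step : ∀ i → 0ℚ ℚ.≤ seq r i ℚ.+ ½ → 1ℚ ℚ.≤ seq (r ^ᴿ suc n) i ℚ.+ ½ ℚ.* ½ → ½ ℚ.≤ seq r i
  step i 0≤r+½ 1≤ with ℚ.≤-total ½ (seq r i)
  ... | inj₁ ½≤r = ½≤r
  ... | inj₂ r≤½ = contradiction (begin
    1ℚ                                   ≤⟨ 1≤ ⟩
    seq (r ^ᴿ suc n) i ℚ.+ ½ ℚ.* ½       ≡⟨ cong (ℚ._+ ½ ℚ.* ½) (seq-^ r (suc n) i) ⟩
    seq r i ^ℚ suc n ℚ.+ ½ ℚ.* ½         ≤⟨ ℚ.+-monoˡ-≤ (½ ℚ.* ½) (small-power (seq r i) ∣r∣≤½) ⟩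
    ½ ℚ.+ ½ ℚ.* ½                        ∎) (from-no (1ℚ ℚ.≤? ½ ℚ.+ ½ ℚ.* ½))
    where
    ∣r∣≤½ : ℚ.∣ seq r i ∣ ℚ.≤ ½
    ∣r∣≤½ with ℚ.∣p∣≡p∨∣p∣≡-p (seq r i)
    ... | inj₁ e = subst (ℚ._≤ ½) (sym e) r≤½
    ... | inj₂ e = subst₂ ℚ._≤_ (trans (ℚ.+-identityˡ _) (sym e))
      (solve 2 (λ r h → (r :+ h) :+ :- r := h) refl (seq r i) ½) (ℚ.+-monoˡ-≤ (ℚ.- seq r i) 0≤r+½)

  eventually : Eventually (λ i → ½ ℚ.≤ seq r i)
  eventually = eventually-map₂ step (0≤r ½ (ℚ.positive⁻¹ ½)) (1≤r^ (½ ℚ.* ½) 0<¼)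

  N : ℕ
  N = proj₁ eventually

-- The common last step for all three ratios: γ y z ≤ γ U V ≤ x, with y the real power and z the
-- denominator.
quotient-≥ : ∀ {γ U V : ℚ} {x y z : ℝ} → 0ℚ ℚ.≤ γ → 0ℚ ℚ.≤ U → 0ℚ ℚ.≤ V →
             y ≤ᴿ fromℚ U → 0ᴿ <ᴿ z → z ≤ᴿ fromℚ V → fromℚ (γ ℚ.* U ℚ.* V) ≤ᴿ x →
             x / z ≥ᴿ (fromℚ γ *ᴿ y)
quotient-≥ {γ} {U} {V} {x} {y} {z} 0≤γ 0≤U 0≤V y≤U 0<z@(ζ , 0<ζ , 0≤ζ≤z) z≤V CUV≤x =
  0<z , ≤ᴿ-trans {fromℚ γ *ᴿ y *ᴿ z} {fromℚ (γ ℚ.* U ℚ.* V)} {x} bound CUV≤x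
  where
  open ℚ.≤-Reasoning
  -- (U + η)(V + η) exceeds U V by η (U + V + η), which is at most η (U + V + 1) when η ≤ 1.
  M : ℚ
  M = γ ℚ.* (U ℚ.+ V ℚ.+ 1ℚ)
  0≤M : 0ℚ ℚ.≤ M
  0≤M = 0≤* 0≤γ (0≤+ (0≤+ 0≤U 0≤V) (ℚ.nonNegative⁻¹ 1ℚ))

  bound : fromℚ γ *ᴿ y *ᴿ z ≤ᴿ fromℚ (γ ℚ.* U ℚ.* V)
  bound δ 0<δ = eventually-map₂ (λ i (p , q) r → step (seq y i) (seq z i) p q r)
    (eventually-map₂ (λ _ → _,_) (y≤U η 0<η) (z≤V η 0<η)) 0≤ζ≤z
    where
    factor = small-factor M δ 0≤M 0<δ
    η = proj₁ factor
    0<η = proj₁ (proj₂ factor)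
    η≤1 = proj₁ (proj₂ (proj₂ factor))
    Mη≤δ = proj₂ (proj₂ (proj₂ factor))

    step : ∀ y z → y ℚ.≤ U ℚ.+ η → z ℚ.≤ V ℚ.+ η → 0ℚ ℚ.+ ζ ℚ.≤ z → γ ℚ.* y ℚ.* z ℚ.≤ γ ℚ.* U ℚ.* V ℚ.+ δ
    step y z y≤ z≤ ζ≤z = begin
      γ ℚ.* y ℚ.* z
        ≡⟨ ℚ.*-assoc γ y z ⟩
      γ ℚ.* (y ℚ.* z)
        ≤⟨ ℚ.*-monoˡ-≤-nonNeg γ {{ℚ.nonNegative 0≤γ}} (*-mono-≤ {y} {U ℚ.+ η} {z} 0≤z (0≤+ 0≤U 0≤η) y≤ z≤) ⟩
      γ ℚ.* ((U ℚ.+ η) ℚ.* (V ℚ.+ η))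
        ≡⟨ solve 4 (λ γ U V η → γ :* ((U :+ η) :* (V :+ η)) := γ :* U :* V :+ γ :* (η :* (U :+ V :+ η))) refl γ U V η ⟩
      γ ℚ.* U ℚ.* V ℚ.+ γ ℚ.* (η ℚ.* (U ℚ.+ V ℚ.+ η))
        ≤⟨ ℚ.+-monoʳ-≤ (γ ℚ.* U ℚ.* V) (ℚ.*-monoˡ-≤-nonNeg γ {{ℚ.nonNegative 0≤γ}}
             (ℚ.*-monoˡ-≤-nonNeg η {{ℚ.nonNegative 0≤η}} (ℚ.+-monoʳ-≤ (U ℚ.+ V) η≤1))) ⟩
      γ ℚ.* U ℚ.* V ℚ.+ γ ℚ.* (η ℚ.* (U ℚ.+ V ℚ.+ 1ℚ))
        ≡⟨ cong (γ ℚ.* U ℚ.* V ℚ.+_) (solve 3 (λ γ η s → γ :* (η :* s) := γ :* s :* η) refl γ η (U ℚ.+ V ℚ.+ 1ℚ)) ⟩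
      γ ℚ.* U ℚ.* V ℚ.+ M ℚ.* η
        ≤⟨ ℚ.+-monoʳ-≤ (γ ℚ.* U ℚ.* V) Mη≤δ ⟩
      γ ℚ.* U ℚ.* V ℚ.+ δ ∎
      where
      0≤η = ℚ.<⇒≤ 0<η
      0≤z : 0ℚ ℚ.≤ z
      0≤z = ℚ.≤-trans (ℚ.<⇒≤ 0<ζ) (subst (ℚ._≤ z) (ℚ.+-identityˡ ζ) ζ≤z)

positive-lower-bound : ∀ {q x} → 0ℚ ℚ.< q → fromℚ q ≤ᴿ x → 0ᴿ <ᴿ x
positive-lower-bound {q} {x} 0<q q≤x = ½ ℚ.* q , 0<½* 0<q , eventually-map (λ i p → begin
  0ℚ ℚ.+ ½ ℚ.* q                               ≡⟨ cancel (½ ℚ.* q) ⟩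
  (½ ℚ.* q ℚ.+ ½ ℚ.* q) ℚ.- ½ ℚ.* q            ≡⟨ cong (ℚ._- ½ ℚ.* q) (½+½ q) ⟩
  q ℚ.- ½ ℚ.* q                                ≤⟨ ℚ.+-monoˡ-≤ (ℚ.- (½ ℚ.* q)) p ⟩
  (seq x i ℚ.+ ½ ℚ.* q) ℚ.- ½ ℚ.* q            ≡⟨ cancel′ (seq x i) (½ ℚ.* q) ⟩
  seq x i                                      ∎) (q≤x (½ ℚ.* q) (0<½* 0<q))
  where
  open ℚ.≤-Reasoning
  cancel : ∀ a → 0ℚ ℚ.+ a ≡ (a ℚ.+ a) ℚ.- a
  cancel = solve 1 (λ a → con 0ℚ :+ a := (a :+ a) :- a) refl
  cancel′ : ∀ a b → (a ℚ.+ b) ℚ.- b ≡ a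
  cancel′ = solve 2 (λ a b → (a :+ b) :- b := a) refl

-- Limits and real exponents

module _ {s l} (s⟶l : s ⟶ l) where

  private
    near : ∀ δ → 0ℚ ℚ.< δ → ∃[ m ] l -ᴿ fromℚ δ ≤ᴿ s m × s m ≤ᴿ l +ᴿ fromℚ δ
    near δ 0<δ = proj₁ close , proj₂ close (proj₁ close) ℕ.≤-refl
      where
      close : ∃[ M ] ∀ m → M ℕ.≤ m → l -ᴿ fromℚ δ ≤ᴿ s m × s m ≤ᴿ l +ᴿ fromℚ δ
      close = s⟶l (fromℚ δ) (positive-lower-bound {δ} {fromℚ δ} 0<δ (≤ᴿ-refl {fromℚ δ}))

  limit-≤ : ∀ q → (∀ m → s m ≤ᴿ fromℚ q) → l ≤ᴿ fromℚ q
  limit-≤ q s≤q δ 0<δ = go (near (½ ℚ.* δ) (0<½* 0<δ))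
    where
    open ℚ.≤-Reasoning
    step : ∀ i → seq l i ℚ.- ½ ℚ.* δ ℚ.≤ q ℚ.+ ½ ℚ.* δ → seq l i ℚ.≤ q ℚ.+ δ
    step i p = begin
      seq l i                                        ≡⟨ solve 2 (λ a b → a := (a :- b) :+ b) refl (seq l i) (½ ℚ.* δ) ⟩
      (seq l i ℚ.- ½ ℚ.* δ) ℚ.+ ½ ℚ.* δ              ≤⟨ ℚ.+-monoˡ-≤ (½ ℚ.* δ) p ⟩
      (q ℚ.+ ½ ℚ.* δ) ℚ.+ ½ ℚ.* δ                    ≡⟨ trans (ℚ.+-assoc q _ _) (cong (q ℚ.+_) (½+½ δ)) ⟩
      q ℚ.+ δ                                        ∎

    go : (∃[ m ] l -ᴿ fromℚ (½ ℚ.* δ) ≤ᴿ s m × s m ≤ᴿ l +ᴿ fromℚ (½ ℚ.* δ)) →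
         Eventually (λ i → seq l i ℚ.≤ q ℚ.+ δ)
    go (m , l-δ≤s , _) = eventually-map step
      (≤ᴿ-trans {l -ᴿ fromℚ (½ ℚ.* δ)} {s m} {fromℚ q} l-δ≤s (s≤q m) (½ ℚ.* δ) (0<½* 0<δ))

  limit-≥ : ∀ q → (∀ m → fromℚ q ≤ᴿ s m) → fromℚ q ≤ᴿ l
  limit-≥ q q≤s δ 0<δ = go (near (½ ℚ.* δ) (0<½* 0<δ))
    where
    step : ∀ i → q ℚ.≤ (seq l i ℚ.+ ½ ℚ.* δ) ℚ.+ ½ ℚ.* δ → q ℚ.≤ seq l i ℚ.+ δ
    step i = subst (q ℚ.≤_) (trans (ℚ.+-assoc (seq l i) _ _) (cong (seq l i ℚ.+_) (½+½ δ)))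

    go : (∃[ m ] l -ᴿ fromℚ (½ ℚ.* δ) ≤ᴿ s m × s m ≤ᴿ l +ᴿ fromℚ (½ ℚ.* δ)) →
         Eventually (λ i → q ℚ.≤ seq l i ℚ.+ δ)
    go (m , _ , s≤l+δ) = eventually-map step
      (≤ᴿ-trans {fromℚ q} {s m} {l +ᴿ fromℚ (½ ℚ.* δ)} (q≤s m) s≤l+δ (½ ℚ.* δ) (0<½* 0<δ))

-- The witness of 0 < ε already contains a rational δ below ε, and its denominator times δ is its
-- numerator, a positive integer.
positive-rational : ∀ {ε} → 0ᴿ <ᴿ ε → ∃[ e ] ∃[ δ ] 1ℚ ℚ.≤ ι (suc e) ℚ.* δ × 1ᴿ -ᴿ ε ≤ᴿ fromℚ (1ℚ ℚ.- δ)
positive-rational {ε} (δ , 0<δ , N , 0+δ≤ε) = ℚ.ℚ.denominator-1 δ , δ , 1≤eδ δ 0<δ , λ η 0<η →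
  N , λ i N≤i → ℚ.≤-trans
    (ℚ.+-monoʳ-≤ 1ℚ (ℚ.neg-antimono-≤ (subst (ℚ._≤ seq ε i) (ℚ.+-identityˡ δ) (0+δ≤ε i N≤i))))
    (p≤p+q (ℚ.<⇒≤ 0<η))
  where
  1≤eδ : ∀ δ → 0ℚ ℚ.< δ → 1ℚ ℚ.≤ ι (↧ₙ δ) ℚ.* δ
  1≤eδ δ@(mkℚ (+ suc a) d c) 0<δ = subst (1ℚ ℚ.≤_)
    (trans (sym (*-denominator δ)) (ℚ.*-comm δ (ι (↧ₙ δ)))) (ι-mono-≤ {1} {suc a} (s≤s z≤n))
  1≤eδ (mkℚ (+ zero) d c)  (ℚ.*<* (ℤ.+<+ ()))
  1≤eδ (mkℚ -[1+ a ] d c)  (ℚ.*<* ())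

-- a / b ≤ 1 - 1 / e for p = a / b, with denominators cleared.
exponent-bound : ∀ e δ p a → ↥ p ≡ + a → 1ℚ ℚ.≤ ι e ℚ.* δ → p ℚ.≤ 1ℚ ℚ.- δ →
                 e ℕ.* a ℕ.+ ↧ₙ p ℕ.≤ e ℕ.* ↧ₙ p
exponent-bound e δ p a ↥p≡a 1≤eδ p≤1-δ = ι-cancel-≤ (begin
  ι (e ℕ.* a ℕ.+ ↧ₙ p)
    ≡⟨ trans (ι-+ (e ℕ.* a) (↧ₙ p)) (cong (ℚ._+ ι (↧ₙ p)) (ι-* e a)) ⟩
  ι e ℚ.* ι a ℚ.+ ι (↧ₙ p)
    ≡⟨ cong (λ z → ι e ℚ.* z ℚ.+ ι (↧ₙ p)) (sym (trans (*-denominator p) (cong (ℚ._/ 1) ↥p≡a))) ⟩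
  ι e ℚ.* (p ℚ.* ι (↧ₙ p)) ℚ.+ ι (↧ₙ p)
    ≡⟨ solve 3 (λ e p b → e :* (p :* b) :+ b := (e :* p :+ con 1ℚ) :* b) refl (ι e) p (ι (↧ₙ p)) ⟩
  (ι e ℚ.* p ℚ.+ 1ℚ) ℚ.* ι (↧ₙ p)
    ≤⟨ ℚ.*-monoʳ-≤-nonNeg (ι (↧ₙ p)) {{ℚ.nonNegative (0≤ι (↧ₙ p))}} ep+1≤e ⟩
  ι e ℚ.* ι (↧ₙ p)
    ≡⟨ ι-* e (↧ₙ p) ⟨
  ι (e ℕ.* ↧ₙ p) ∎)
  where
  open ℚ.≤-Reasoning
  ep+1≤e : ι e ℚ.* p ℚ.+ 1ℚ ℚ.≤ ι e
  ep+1≤e = begin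
    ι e ℚ.* p ℚ.+ 1ℚ
      ≤⟨ ℚ.+-mono-≤ (ℚ.*-monoˡ-≤-nonNeg (ι e) {{ℚ.nonNegative (0≤ι e)}} p≤1-δ) 1≤eδ ⟩
    ι e ℚ.* (1ℚ ℚ.- δ) ℚ.+ ι e ℚ.* δ
      ≡⟨ solve 2 (λ e d → e :* (con 1ℚ :- d) :+ e :* d := e) refl (ι e) δ ⟩
    ι e ∎

-- A real power is a least upper bound, so it suffices that U bounds every rational power with
-- exponent at most 1 - ε. Such exponents a / b satisfy a / b ≤ 1 - 1 / e.
power-≤ : ∀ {n ε y e δ U} → 1 ℕ.≤ n → 1ℚ ℚ.≤ ι e ℚ.* δ → 1ᴿ -ᴿ ε ≤ᴿ fromℚ (1ℚ ℚ.- δ) → 1ℚ ℚ.≤ U →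
          (∀ a b → e ℕ.* a ℕ.+ suc b ℕ.≤ e ℕ.* suc b → ι n ^ℚ a ℚ.≤ U ^ℚ suc b) →
          IsPower n (1ᴿ -ᴿ ε) y → y ≤ᴿ fromℚ U
power-≤ {n} {ε} {y} {e} {δ} {U} 1≤n 1≤eδ 1-ε≤ 1≤U power≤ (_ , least) = least (fromℚ U) upper
  where
  0≤U : 0ℚ ℚ.≤ U
  0≤U = ℚ.≤-trans (ℚ.nonNegative⁻¹ 1ℚ) 1≤U

  1≤ιn : 1ℚ ℚ.≤ ι n
  1≤ιn = ι-mono-≤ {1} {n} 1≤n

  upper : ∀ p r → fromℚ p ≤ᴿ 1ᴿ -ᴿ ε → IsRationalPower n p r → r ≤ᴿ fromℚ U
  upper p@(mkℚ (+ a) b c) r p≤ (_ , r^b≈) = root-≤ {r} {U} b 0≤U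
    (≤ᴿ-trans {r ^ᴿ suc b} {fromℕ n ^ᴿ a} {fromℚ (U ^ℚ suc b)} (≈⇒≤ {r ^ᴿ suc b} {fromℕ n ^ᴿ a} r^b≈)
      (pointwise-≤ {fromℕ n ^ᴿ a} {fromℚ (U ^ℚ suc b)} λ i →
        subst (ℚ._≤ U ^ℚ suc b) (sym (seq-^ (fromℕ n) a i))
          (power≤ a b (exponent-bound e δ p a refl 1≤eδ
            (fromℚ-cancel-≤ (≤ᴿ-trans {fromℚ p} {1ᴿ -ᴿ ε} {fromℚ (1ℚ ℚ.- δ)} p≤ 1-ε≤))))))
  -- Negative exponent: the power of r times a number that is at least 1 equals 1, so it is at most
  -- 1 and U ≥ 1 suffices.
  upper (mkℚ -[1+ a ] b c) r p≤ (_ , r^bn^a≈1) = root-≤ {r} {U} b 0≤U λ η 0<η →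
    eventually-map (λ i q → step (seq (r ^ᴿ suc b) i) (ℚ.<⇒≤ 0<η)
        (subst (λ z → seq (r ^ᴿ suc b) i ℚ.* z ℚ.≤ 1ℚ ℚ.+ η) (seq-^ (fromℕ n) (suc a) i) q))
      (≈⇒≤ {r ^ᴿ suc b *ᴿ fromℕ n ^ᴿ suc a} {1ᴿ} r^bn^a≈1 η 0<η)
    where
    open ℚ.≤-Reasoning
    step : ∀ x {η} → 0ℚ ℚ.≤ η → x ℚ.* ι n ^ℚ suc a ℚ.≤ 1ℚ ℚ.+ η → x ℚ.≤ U ^ℚ suc b ℚ.+ η
    step x {η} 0≤η xN≤ with ℚ.≤-total 0ℚ x
    ... | inj₂ x≤0 = ℚ.≤-trans x≤0 (0≤+ (0≤^ (suc b) 0≤U) 0≤η)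
    ... | inj₁ 0≤x = begin
      x                          ≡⟨ ℚ.*-identityʳ x ⟨
      x ℚ.* 1ℚ                   ≤⟨ ℚ.*-monoˡ-≤-nonNeg x {{ℚ.nonNegative 0≤x}} (1≤^ (suc a) 1≤ιn) ⟩
      x ℚ.* ι n ^ℚ suc a         ≤⟨ xN≤ ⟩
      1ℚ ℚ.+ η                   ≤⟨ ℚ.+-monoˡ-≤ η (1≤^ (suc b) 1≤U) ⟩
      U ^ℚ suc b ℚ.+ η           ∎

-- Finite sums of rationals

module ℚ-Sums = Sums (CommutativeRing.commutativeSemiring ℚ.+-*-commutativeRing)
open ℚ-Sums using (sum; sum-cong-≋; *-distribˡ-sum; *-distribʳ-sum; ⟦_⟧; ⟦⟧-∧)

seq-∑ : ∀ {n} (x : Fin n → ℝ) k → seq (∑ x) k ≡ sum λ i → seq (x i) k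
seq-∑ {zero}  x k = refl
seq-∑ {suc n} x k = cong (seq (x zero) k ℚ.+_) (seq-∑ (x ∘ suc) k)

seq-∑∑ : ∀ {m n} (x : Fin m → Fin n → ℝ) k →
         seq (∑ λ i → ∑ λ j → x i j) k ≡ sum λ i → sum λ j → seq (x i j) k
seq-∑∑ x k = trans (seq-∑ (λ i → ∑ (x i)) k) (sum-cong-≋ λ i → seq-∑ (x i) k)

ι-suc : ∀ n → ι (suc n) ≡ 1ℚ ℚ.+ ι n
ι-suc = ι-+ 1

∙1≡ι : ∀ n → n ℚ-Sums.∙ 1ℚ ≡ ι n
∙1≡ι zero    = refl
∙1≡ι (suc n) = trans (cong (1ℚ ℚ.+_) (∙1≡ι n)) (sym (ι-suc n))

sum-const : ∀ n c → sum {n} (λ _ → c) ≡ ι n ℚ.* c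
sum-const zero    c = sym (ℚ.*-zeroˡ c)
sum-const (suc n) c = begin
  c ℚ.+ sum {n} (λ _ → c)   ≡⟨ cong (c ℚ.+_) (sum-const n c) ⟩
  c ℚ.+ ι n ℚ.* c           ≡⟨ solve 2 (λ c n → c :+ n :* c := (con 1ℚ :+ n) :* c) refl c (ι n) ⟩
  (1ℚ ℚ.+ ι n) ℚ.* c        ≡⟨ cong (ℚ._* c) (ι-suc n) ⟨
  ι (suc n) ℚ.* c           ∎
  where
  open ≡-Reasoning

sum-*-sum : ∀ {m n} (a : Fin m → ℚ) (b : Fin n → ℚ) → sum (λ i → sum λ j → a i ℚ.* b j) ≡ sum a ℚ.* sum b
sum-*-sum a b = trans (sum-cong-≋ λ i → sym (*-distribˡ-sum (a i) b)) (sym (*-distribʳ-sum (sum b) a))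

scale-sum-sum : ∀ {m n} c (a : Fin m → Fin n → ℚ) → sum (λ i → sum λ j → c ℚ.* a i j) ≡ c ℚ.* sum λ i → sum (a i)
scale-sum-sum c a = trans (sum-cong-≋ λ i → sym (*-distribˡ-sum c (a i))) (sym (*-distribˡ-sum c λ i → sum (a i)))

-- Positive semidefinite kernels and the Lovász number

Kernel : ℕ → Set
Kernel n = Fin n → Fin n → ℚ

-- An explicit decomposition into nonnegative multiples of w wᵀ, in place of a condition on
-- quadratic forms: entrywise products and pairings then follow by recursion, without a spectral
-- theorem.
data Gram {n} (K : Kernel n) : Set where
  rank-one : ∀ c (w : Fin n → ℚ) → 0ℚ ℚ.≤ c → (∀ i j → K i j ≡ c ℚ.* (w i ℚ.* w j)) → Gram K
  plus     : ∀ {L M : Kernel n} → Gram L → Gram M → (∀ i j → K i j ≡ L i j ℚ.+ M i j) → Gram K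

gram-resp : ∀ {n} {K L : Kernel n} → (∀ i j → L i j ≡ K i j) → Gram K → Gram L
gram-resp L≡K (rank-one c w 0≤c e) = rank-one c w 0≤c λ i j → trans (L≡K i j) (e i j)
gram-resp L≡K (plus U V e)         = plus U V λ i j → trans (L≡K i j) (e i j)

gram-scale : ∀ {n} {K : Kernel n} c → 0ℚ ℚ.≤ c → Gram K → Gram (λ i j → c ℚ.* K i j)
gram-scale c 0≤c (rank-one d w 0≤d e) = rank-one (c ℚ.* d) w (0≤* 0≤c 0≤d) λ i j →
  trans (cong (c ℚ.*_) (e i j)) (sym (ℚ.*-assoc c d _))
gram-scale c 0≤c (plus {L} {M} U V e) = plus (gram-scale c 0≤c U) (gram-scale c 0≤c V) λ i j →
  trans (cong (c ℚ.*_) (e i j)) (ℚ.*-distribˡ-+ c (L i j) (M i j))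

-- Schur product theorem.
gram-* : ∀ {n} {K L : Kernel n} → Gram K → Gram L → Gram (λ i j → K i j ℚ.* L i j)
gram-* {L = L} (plus {K₁} {K₂} U₁ U₂ e) V = plus (gram-* U₁ V) (gram-* U₂ V) λ i j →
  trans (cong (ℚ._* L i j) (e i j)) (ℚ.*-distribʳ-+ (L i j) (K₁ i j) (K₂ i j))
gram-* {K = K} U@(rank-one _ _ _ _) (plus {L₁} {L₂} V₁ V₂ e) = plus (gram-* U V₁) (gram-* U V₂) λ i j →
  trans (cong (K i j ℚ.*_) (e i j)) (ℚ.*-distribˡ-+ (K i j) (L₁ i j) (L₂ i j))
gram-* (rank-one c w 0≤c e) (rank-one d v 0≤d f) = rank-one (c ℚ.* d) (λ i → w i ℚ.* v i) (0≤* 0≤c 0≤d) λ i j →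
  trans (cong₂ ℚ._*_ (e i j) (f i j))
    (solve 6 (λ c d wᵢ wⱼ vᵢ vⱼ → c :* (wᵢ :* wⱼ) :* (d :* (vᵢ :* vⱼ)) := c :* d :* (wᵢ :* vᵢ :* (wⱼ :* vⱼ)))
      refl c d (w i) (w j) (v i) (v j))

gram-sum : ∀ {n d} {K : Fin d → Kernel n} → (∀ t → Gram (K t)) → Gram (λ i j → sum λ t → K t i j)
gram-sum {d = zero}  U = rank-one 0ℚ (λ _ → 0ℚ) ℚ.≤-refl λ i j → refl
gram-sum {d = suc d} U = plus (U zero) (gram-sum (U ∘ suc)) λ i j → refl

-- The Frobenius inner product.
pairing : ∀ {n} → Kernel n → Matrix n → ℝ
pairing K B = ∑ λ i → ∑ λ j → fromℚ (K i j) *ᴿ B i j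

seq-pairing : ∀ {n} (K : Kernel n) (B : Matrix n) k →
              seq (pairing K B) k ≡ sum λ i → sum λ j → K i j ℚ.* seq (B i j) k
seq-pairing K B k = seq-∑∑ (λ i j → fromℚ (K i j) *ᴿ B i j) k

0≤+ᴿ : ∀ {x y} → 0ᴿ ≤ᴿ x → 0ᴿ ≤ᴿ y → 0ᴿ ≤ᴿ x +ᴿ y
0≤+ᴿ {x} {y} 0≤x 0≤y = ≤ᴿ-trans {0ᴿ} {0ᴿ +ᴿ 0ᴿ} {x +ᴿ y}
  (pointwise-≡ {0ᴿ} {0ᴿ +ᴿ 0ᴿ} λ _ → refl) (+ᴿ-mono-≤ {0ᴿ} {x} {0ᴿ} {y} 0≤x 0≤y)

module _ {n} (B : Matrix n) (k : ℕ) where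
  open ≡-Reasoning

  private
    b : Fin n → Fin n → ℚ
    b i j = seq (B i j) k

  pairing-+ : ∀ (K L M : Kernel n) → (∀ i j → K i j ≡ L i j ℚ.+ M i j) →
              seq (pairing L B +ᴿ pairing M B) k ≡ seq (pairing K B) k
  pairing-+ K L M e = begin
    seq (pairing L B) k ℚ.+ seq (pairing M B) k
      ≡⟨ cong₂ ℚ._+_ (seq-pairing L B k) (seq-pairing M B k) ⟩
    sum (λ i → sum λ j → L i j ℚ.* b i j) ℚ.+ sum (λ i → sum λ j → M i j ℚ.* b i j)
      ≡⟨ ℚ-Sums.∑-distrib-+ (λ i → sum λ j → L i j ℚ.* b i j) (λ i → sum λ j → M i j ℚ.* b i j) ⟨
    sum (λ i → sum (λ j → L i j ℚ.* b i j) ℚ.+ sum (λ j → M i j ℚ.* b i j))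
      ≡⟨ sum-cong-≋ (λ i → sym (ℚ-Sums.∑-distrib-+ (λ j → L i j ℚ.* b i j) (λ j → M i j ℚ.* b i j))) ⟩
    sum (λ i → sum λ j → L i j ℚ.* b i j ℚ.+ M i j ℚ.* b i j)
      ≡⟨ sum-cong-≋ (λ i → sum-cong-≋ λ j → trans (sym (ℚ.*-distribʳ-+ (b i j) (L i j) (M i j)))
           (cong (ℚ._* b i j) (sym (e i j)))) ⟩
    sum (λ i → sum λ j → K i j ℚ.* b i j)
      ≡⟨ seq-pairing K B k ⟨
    seq (pairing K B) k ∎

  pairing-rank-one : ∀ (K : Kernel n) (c : ℚ) (w : Fin n → ℚ) → (∀ i j → K i j ≡ c ℚ.* (w i ℚ.* w j)) →
    seq (fromℚ c *ᴿ ∑ λ i → ∑ λ j → fromℚ (w i) *ᴿ B i j *ᴿ fromℚ (w j)) k ≡ seq (pairing K B) k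
  pairing-rank-one K c w e = begin
    c ℚ.* seq (∑ λ i → ∑ λ j → fromℚ (w i) *ᴿ B i j *ᴿ fromℚ (w j)) k
      ≡⟨ cong (c ℚ.*_) (seq-∑∑ (λ i j → fromℚ (w i) *ᴿ B i j *ᴿ fromℚ (w j)) k) ⟩
    c ℚ.* sum (λ i → sum λ j → w i ℚ.* b i j ℚ.* w j)
      ≡⟨ scale-sum-sum c (λ i j → w i ℚ.* b i j ℚ.* w j) ⟨
    sum (λ i → sum λ j → c ℚ.* (w i ℚ.* b i j ℚ.* w j))
      ≡⟨ sum-cong-≋ (λ i → sum-cong-≋ λ j → trans
           (solve 4 (λ c wᵢ b wⱼ → c :* (wᵢ :* b :* wⱼ) := c :* (wᵢ :* wⱼ) :* b) refl c (w i) (b i j) (w j))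
           (cong (ℚ._* b i j) (sym (e i j)))) ⟩
    sum (λ i → sum λ j → K i j ℚ.* b i j)
      ≡⟨ seq-pairing K B k ⟨
    seq (pairing K B) k ∎

-- A summand c w wᵀ contributes c times the quadratic form of B at w.
gram-pairing : ∀ {n} {K : Kernel n} {B : Matrix n} → Gram K → PositiveSemidefinite B → 0ᴿ ≤ᴿ pairing K B
gram-pairing {K = K} {B} (plus {L} {M} U V e) psd = ≤ᴿ-trans {0ᴿ} {pairing L B +ᴿ pairing M B} {pairing K B}
  (0≤+ᴿ {pairing L B} {pairing M B} (gram-pairing {K = L} {B} U psd) (gram-pairing {K = M} {B} V psd))
  (pointwise-≡ {pairing L B +ᴿ pairing M B} {pairing K B} λ k → pairing-+ B k K L M e)
gram-pairing {n} {K} {B} (rank-one c w 0≤c e) psd = ≤ᴿ-trans {0ᴿ} {fromℚ c *ᴿ form} {pairing K B}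
  (≤ᴿ-trans {0ᴿ} {fromℚ c *ᴿ 0ᴿ} {fromℚ c *ᴿ form}
    (pointwise-≡ {0ᴿ} {fromℚ c *ᴿ 0ᴿ} λ _ → sym (ℚ.*-zeroʳ c))
    (scale-mono-≤ {c} {0ᴿ} {form} 0≤c (proj₂ psd (fromℚ ∘ w))))
  (pointwise-≡ {fromℚ c *ᴿ form} {pairing K B} λ k → pairing-rank-one B k K c w e)
  where
  form : ℝ
  form = ∑ λ i → ∑ λ j → fromℚ (w i) *ᴿ B i j *ᴿ fromℚ (w j)

scale-zero : ∀ {c x} → x ≈ᴿ 0ᴿ → fromℚ c *ᴿ x ≤ᴿ 0ᴿ
scale-zero {c} {x} x≈0 with ℚ.≤-total 0ℚ c
... | inj₁ 0≤c = ≤ᴿ-trans {fromℚ c *ᴿ x} {fromℚ c *ᴿ 0ᴿ} {0ᴿ}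
  (scale-mono-≤ {c} {x} {0ᴿ} 0≤c (≈⇒≤ {x} {0ᴿ} x≈0))
  (pointwise-≡ {fromℚ c *ᴿ 0ᴿ} {0ᴿ} λ _ → ℚ.*-zeroʳ c)
... | inj₂ c≤0 = ≤ᴿ-trans {fromℚ c *ᴿ x} {fromℚ (ℚ.- c) *ᴿ (-ᴿ x)} {0ᴿ}
  (pointwise-≡ {fromℚ c *ᴿ x} {fromℚ (ℚ.- c) *ᴿ (-ᴿ x)} λ k →
    solve 2 (λ c x → c :* x := (:- c) :* (:- x)) refl c (seq x k))
  (≤ᴿ-trans {fromℚ (ℚ.- c) *ᴿ (-ᴿ x)} {fromℚ (ℚ.- c) *ᴿ 0ᴿ} {0ᴿ}
    (scale-mono-≤ {ℚ.- c} { -ᴿ x} {0ᴿ} (ℚ.neg-antimono-≤ c≤0) λ δ 0<δ →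
      eventually-map (λ k p → begin
        ℚ.- seq x k                  ≡⟨ solve 1 (λ x → :- x := con 0ℚ :+ :- x) refl (seq x k) ⟩
        0ℚ ℚ.- seq x k               ≤⟨ ℚ.+-monoˡ-≤ (ℚ.- seq x k) p ⟩
        (seq x k ℚ.+ δ) ℚ.- seq x k  ≡⟨ solve 2 (λ x d → (x :+ d) :- x := con 0ℚ :+ d) refl (seq x k) δ ⟩
        0ℚ ℚ.+ δ                     ∎) (≈⇒≤ {0ᴿ} {x} (≈-sym {x} {0ᴿ} x≈0) δ 0<δ))
    (pointwise-≡ {fromℚ (ℚ.- c) *ᴿ 0ᴿ} {0ᴿ} λ _ → ℚ.*-zeroʳ (ℚ.- c)))
  where
  open ℚ.≤-Reasoning

-- Pairing a kernel with x xᵀ gives its quadratic form at x, so `gram-pairing` also shows kernels to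
-- be positive semidefinite.
outer : ∀ {n} → (Fin n → ℝ) → Matrix n
outer x i j = x i *ᴿ x j

outer-psd : ∀ {n} (x : Fin n → ℝ) → PositiveSemidefinite (outer x)
outer-psd {n} x = (λ i j → pointwise-≈ {x i *ᴿ x j} {x j *ᴿ x i} λ k → ℚ.*-comm (seq (x i) k) (seq (x j) k)) ,
  λ y → pointwise-≤ {0ᴿ} {∑ λ i → ∑ λ j → y i *ᴿ outer x i j *ᴿ y j} λ k →
    subst (0ℚ ℚ.≤_) (sym (square y k)) (0≤x² (inner y k))
  where
  open ≡-Reasoning
  inner : (Fin n → ℝ) → ℕ → ℚ
  inner y k = sum λ i → seq (y i) k ℚ.* seq (x i) k

  square : ∀ y k → seq (∑ λ i → ∑ λ j → y i *ᴿ outer x i j *ᴿ y j) k ≡ inner y k ℚ.* inner y k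
  square y k = begin
    seq (∑ λ i → ∑ λ j → y i *ᴿ outer x i j *ᴿ y j) k
      ≡⟨ seq-∑∑ (λ i j → y i *ᴿ outer x i j *ᴿ y j) k ⟩
    sum (λ i → sum λ j → seq (y i) k ℚ.* (seq (x i) k ℚ.* seq (x j) k) ℚ.* seq (y j) k)
      ≡⟨ sum-cong-≋ (λ i → sum-cong-≋ λ j →
           solve 4 (λ yᵢ xᵢ xⱼ yⱼ → yᵢ :* (xᵢ :* xⱼ) :* yⱼ := (yᵢ :* xᵢ) :* (yⱼ :* xⱼ)) refl
             (seq (y i) k) (seq (x i) k) (seq (x j) k) (seq (y j) k)) ⟩
    sum (λ i → sum λ j → (seq (y i) k ℚ.* seq (x i) k) ℚ.* (seq (y j) k ℚ.* seq (x j) k))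
      ≡⟨ sum-*-sum (λ i → seq (y i) k ℚ.* seq (x i) k) (λ j → seq (y j) k ℚ.* seq (x j) k) ⟩
    inner y k ℚ.* inner y k ∎

-- The quadratic form at the all-ones vector.
gram-total : ∀ {n} {K : Kernel n} → Gram K → 0ℚ ℚ.≤ sum λ i → sum λ j → K i j
gram-total {n} {K} U = against (λ _ → 1ᴿ) λ _ _ → refl
  where
  total : ℚ
  total = sum λ i → sum λ j → K i j

  against : ∀ (x : Fin n → ℝ) → (∀ i k → seq (x i) k ≡ 1ℚ) → 0ℚ ℚ.≤ total
  against x one = constant-≤ {0ᴿ} {pairing K (outer x)} {0ℚ} {total} (λ _ → refl)
    (λ k → trans (seq-pairing K (outer x) k) (sum-cong-≋ λ i → sum-cong-≋ λ j → term i j k))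
    (gram-pairing {K = K} {outer x} U (outer-psd x))
    where
    term : ∀ i j k → K i j ℚ.* (seq (x i) k ℚ.* seq (x j) k) ≡ K i j
    term i j k = trans (cong (K i j ℚ.*_) (cong₂ ℚ._*_ (one i k) (one j k))) (ℚ.*-identityʳ (K i j))

δ : ∀ {n} → Fin n → Fin n → ℚ
δ zero    zero    = 1ℚ
δ zero    (suc _) = 0ℚ
δ (suc _) zero    = 0ℚ
δ (suc i) (suc j) = δ i j

sum-δ : ∀ {n} (v : Fin n) → sum (δ v) ≡ 1ℚ
sum-δ {suc n} zero    = cong (1ℚ ℚ.+_) (ℚ-Sums.sum-replicate-zero n)
sum-δ {suc n} (suc v) = trans (ℚ.+-identityˡ _) (sum-δ v)

δ-square : ∀ {n} (v i : Fin n) → δ v i ℚ.* δ v i ≡ δ v i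
δ-square zero    zero    = refl
δ-square zero    (suc i) = refl
δ-square (suc v) zero    = refl
δ-square (suc v) (suc i) = δ-square v i

δ-disjoint : ∀ {n} (v i j : Fin n) → i ≢ j → δ v i ℚ.* δ v j ≡ 0ℚ
δ-disjoint zero    zero    zero    i≢j = contradiction refl i≢j
δ-disjoint zero    zero    (suc j) i≢j = refl
δ-disjoint zero    (suc i) j       i≢j = ℚ.*-zeroˡ (δ zero j)
δ-disjoint (suc v) zero    j       i≢j = ℚ.*-zeroˡ (δ (suc v) j)
δ-disjoint (suc v) (suc i) zero    i≢j = ℚ.*-zeroʳ (δ v i)
δ-disjoint (suc v) (suc i) (suc j) i≢j = δ-disjoint v i j (i≢j ∘ cong suc)

-- The matrix with a single entry 1, at (v, v), is feasible. This makes ϑ(Gᶜ) positive as a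
-- denominator.
1≤lovász : ∀ {n} {G : Graph n} {ϑ} → Fin n → IsLovászNumber G ϑ → 1ᴿ ≤ᴿ ϑ
1≤lovász {n} {G} {ϑ} v (_ , maximal) = attained (fromℚ ∘ δ v) λ _ _ → refl
  where
  attained : ∀ (x : Fin n → ℝ) → (∀ i k → seq (x i) k ≡ δ v i) → 1ᴿ ≤ᴿ ϑ
  attained x x≡δ = ≤ᴿ-trans {1ᴿ} {entrySum (outer x)} {ϑ}
    (pointwise-≡ {1ᴿ} {entrySum (outer x)} λ k → sym (total k))
    (maximal (outer x) (outer-psd x ,
      pointwise-≈ {∑ λ i → outer x i i} {1ᴿ} trace ,
      λ i j adj → pointwise-≈ {outer x i j} {0ᴿ} (zeros i j adj)))
    where
    open ≡-Reasoning
    total : ∀ k → seq (entrySum (outer x)) k ≡ 1ℚ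
    total k = begin
      seq (entrySum (outer x)) k
        ≡⟨ seq-∑∑ (outer x) k ⟩
      sum (λ i → sum λ j → seq (x i) k ℚ.* seq (x j) k)
        ≡⟨ sum-*-sum (λ i → seq (x i) k) (λ j → seq (x j) k) ⟩
      sum (λ i → seq (x i) k) ℚ.* sum (λ j → seq (x j) k)
        ≡⟨ cong (λ s → s ℚ.* s) (trans (sum-cong-≋ λ i → x≡δ i k) (sum-δ v)) ⟩
      1ℚ ℚ.* 1ℚ
        ≡⟨ ℚ.*-identityʳ 1ℚ ⟩
      1ℚ ∎

    trace : ∀ k → seq (∑ λ i → outer x i i) k ≡ 1ℚ
    trace k = begin
      seq (∑ λ i → outer x i i) k
        ≡⟨ seq-∑ (λ i → outer x i i) k ⟩
      sum (λ i → seq (x i) k ℚ.* seq (x i) k)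
        ≡⟨ sum-cong-≋ (λ i → trans (cong₂ ℚ._*_ (x≡δ i k) (x≡δ i k)) (δ-square v i)) ⟩
      sum (δ v)
        ≡⟨ sum-δ v ⟩
      1ℚ ∎

    zeros : ∀ i j → Adj G i j → ∀ k → seq (x i) k ℚ.* seq (x j) k ≡ 0ℚ
    zeros i j adj k = trans (cong₂ ℚ._*_ (x≡δ i k) (x≡δ j k)) (δ-disjoint v i j λ i≡j → adj-irrefl G i≡j adj)

-- Two Lovász bounds from one kernel

module Certificate {n} (G : Graph n) (K : Kernel n) (f : ℚ) (0<f : 0ℚ ℚ.< f)
  (diagonal : ∀ i → K i i ≡ f) (symmetric : ∀ i j → K i j ≡ K j i)
  (vanishes : ∀ i j → Adj G i j → K i j ≡ 0ℚ)
  (gram-K-1 : Gram λ i j → K i j ℚ.- 1ℚ) where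

  open ≡-Reasoning

  gram-K : Gram K
  gram-K = plus gram-K-1 (rank-one 1ℚ (λ _ → 1ℚ) (ℚ.nonNegative⁻¹ 1ℚ) λ _ _ → refl) λ i j →
    solve 1 (λ k → k := (k :- con 1ℚ) :+ con 1ℚ) refl (K i j)

  -- With g = 1 / (n f) the matrix g K has trace 1. Splitting K into J and K - J, its entries sum to
  -- n² g = n / f = q plus a nonnegative total.
  lovász-≥ : ∀ {ϑ q} → 1 ℕ.≤ n → q ℚ.* f ≡ ι n → IsLovászNumber G ϑ → fromℚ q ≤ᴿ ϑ
  lovász-≥ {ϑ} {q} 1≤n qf≡n (_ , maximal) = go (inverse (ι n ℚ.* f) (0<* 0<n 0<f))
    where
    0<n : 0ℚ ℚ.< ι n
    0<n = ℚ.<-≤-trans (ℚ.positive⁻¹ 1ℚ) (ι-mono-≤ {1} {n} 1≤n)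

    go : (∃[ g ] 0ℚ ℚ.< g × ι n ℚ.* f ℚ.* g ≡ 1ℚ) → fromℚ q ≤ᴿ ϑ
    go (g , 0<g , nfg≡1) = ≤ᴿ-trans {fromℚ q} {entrySum B} {ϑ}
      (pointwise-≤ {fromℚ q} {entrySum B} λ k → subst (q ℚ.≤_) (sym (seq-∑∑ B k)) q≤total)
      (maximal B (((λ i j → pointwise-≈ {B i j} {B j i} λ _ → cong (g ℚ.*_) (symmetric i j)) , quadratic) ,
        pointwise-≈ {∑ λ i → B i i} {1ᴿ} (λ k → trans (seq-∑ (λ i → B i i) k) trace) ,
        λ i j adj → pointwise-≈ {B i j} {0ᴿ} λ _ → trans (cong (g ℚ.*_) (vanishes i j adj)) (ℚ.*-zeroʳ g)))
      where
      0≤g = ℚ.<⇒≤ 0<g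

      B : Matrix n
      B i j = fromℚ (g ℚ.* K i j)

      trace : sum (λ i → g ℚ.* K i i) ≡ 1ℚ
      trace = begin
        sum (λ i → g ℚ.* K i i)   ≡⟨ sum-cong-≋ (λ i → cong (g ℚ.*_) (diagonal i)) ⟩
        sum {n} (λ _ → g ℚ.* f)   ≡⟨ sum-const n (g ℚ.* f) ⟩
        ι n ℚ.* (g ℚ.* f)         ≡⟨ solve 3 (λ n g f → n :* (g :* f) := n :* f :* g) refl (ι n) g f ⟩
        ι n ℚ.* f ℚ.* g           ≡⟨ nfg≡1 ⟩
        1ℚ                        ∎

      total : sum (λ i → sum λ j → g ℚ.* K i j) ≡ q ℚ.+ sum λ i → sum λ j → g ℚ.* (K i j ℚ.- 1ℚ)
      total = begin
        sum (λ i → sum λ j → g ℚ.* K i j)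
          ≡⟨ sum-cong-≋ (λ i → sum-cong-≋ λ j →
               solve 2 (λ g k → g :* k := g :+ g :* (k :- con 1ℚ)) refl g (K i j)) ⟩
        sum (λ i → sum λ j → g ℚ.+ g ℚ.* (K i j ℚ.- 1ℚ))
          ≡⟨ sum-cong-≋ (λ i → ℚ-Sums.∑-distrib-+ (λ _ → g) (λ j → g ℚ.* (K i j ℚ.- 1ℚ))) ⟩
        sum (λ i → sum {n} (λ _ → g) ℚ.+ sum λ j → g ℚ.* (K i j ℚ.- 1ℚ))
          ≡⟨ ℚ-Sums.∑-distrib-+ {n} (λ _ → sum {n} λ _ → g) (λ i → sum λ j → g ℚ.* (K i j ℚ.- 1ℚ)) ⟩
        sum {n} (λ _ → sum {n} λ _ → g) ℚ.+ rest
          ≡⟨ cong (ℚ._+ rest) (trans (sum-const n (sum {n} λ _ → g)) (cong (ι n ℚ.*_) (sum-const n g))) ⟩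
        ι n ℚ.* (ι n ℚ.* g) ℚ.+ rest
          ≡⟨ cong (λ z → z ℚ.* (ι n ℚ.* g) ℚ.+ rest) (sym qf≡n) ⟩
        q ℚ.* f ℚ.* (ι n ℚ.* g) ℚ.+ rest
          ≡⟨ cong (ℚ._+ rest) (solve 4 (λ q f n g → q :* f :* (n :* g) := q :* (n :* f :* g)) refl q f (ι n) g) ⟩
        q ℚ.* (ι n ℚ.* f ℚ.* g) ℚ.+ rest
          ≡⟨ cong (ℚ._+ rest) (trans (cong (q ℚ.*_) nfg≡1) (ℚ.*-identityʳ q)) ⟩
        q ℚ.+ rest ∎
        where
        rest : ℚ
        rest = sum λ i → sum λ j → g ℚ.* (K i j ℚ.- 1ℚ)

      q≤total : q ℚ.≤ sum (λ i → sum λ j → g ℚ.* K i j)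
      q≤total = subst (q ℚ.≤_) (sym total) (p≤p+q (gram-total (gram-scale g 0≤g gram-K-1)))

      quadratic : ∀ x → 0ᴿ ≤ᴿ ∑ λ i → ∑ λ j → x i *ᴿ B i j *ᴿ x j
      quadratic x = ≤ᴿ-trans {0ᴿ} {pairing (λ i j → g ℚ.* K i j) (outer x)} {∑ λ i → ∑ λ j → x i *ᴿ B i j *ᴿ x j}
        (gram-pairing {K = λ i j → g ℚ.* K i j} {outer x} (gram-scale g 0≤g gram-K) (outer-psd x))
        (pointwise-≡ {pairing (λ i j → g ℚ.* K i j) (outer x)} {∑ λ i → ∑ λ j → x i *ᴿ B i j *ᴿ x j} λ k →
          trans (seq-pairing (λ i j → g ℚ.* K i j) (outer x) k) (trans (sum-cong-≋ λ i → sum-cong-≋ λ j →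
            solve 3 (λ b xᵢ xⱼ → b :* (xᵢ :* xⱼ) := xᵢ :* b :* xⱼ) refl (g ℚ.* K i j) (seq (x i) k) (seq (x j) k))
            (sym (seq-∑∑ (λ i j → x i *ᴿ B i j *ᴿ x j) k))))

  -- As K - J is positive semidefinite, the entry sum of B is at most the pairing of K with B. Off
  -- the diagonal that pairing vanishes: K is 0 on edges of G, B on the other pairs. The diagonal
  -- contributes f times the trace.
  lovászᶜ-≤ : ∀ {ϑ} → IsLovászNumber (complement G) ϑ → ϑ ≤ᴿ fromℚ f
  lovászᶜ-≤ {ϑ} ((B , (psd , trace , zeros) , B≈ϑ) , _) =
    ≤ᴿ-trans {ϑ} {entrySum B} {fromℚ f} (≈⇒≤ {ϑ} {entrySum B} (≈-sym {entrySum B} {ϑ} B≈ϑ))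
    (≤ᴿ-trans {entrySum B} {pairing K B} {fromℚ f} entrySum≤pairing
    (≤ᴿ-trans {pairing K B} {∑ λ i → fromℚ f *ᴿ B i i} {fromℚ f}
      (∑-mono-≤ {n} {λ i → ∑ λ j → fromℚ (K i j) *ᴿ B i j} {λ i → fromℚ f *ᴿ B i i} row)
    (≤ᴿ-trans {∑ λ i → fromℚ f *ᴿ B i i} {fromℚ f *ᴿ ∑ λ i → B i i} {fromℚ f}
      (pointwise-≡ {∑ λ i → fromℚ f *ᴿ B i i} {fromℚ f *ᴿ ∑ λ i → B i i} λ k →
        trans (seq-∑ (λ i → fromℚ f *ᴿ B i i) k) (trans (sym (*-distribˡ-sum f (λ i → seq (B i i) k)))
          (cong (f ℚ.*_) (sym (seq-∑ (λ i → B i i) k)))))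
    (≤ᴿ-trans {fromℚ f *ᴿ ∑ λ i → B i i} {fromℚ f *ᴿ 1ᴿ} {fromℚ f}
      (scale-mono-≤ {f} {∑ λ i → B i i} {1ᴿ} (ℚ.<⇒≤ 0<f) (≈⇒≤ {∑ λ i → B i i} {1ᴿ} trace))
      (pointwise-≡ {fromℚ f *ᴿ 1ᴿ} {fromℚ f} λ _ → ℚ.*-identityʳ f)))))
    where
    off-diagonal : ∀ i j → i ≢ j → fromℚ (K i j) *ᴿ B i j ≤ᴿ 0ᴿ
    off-diagonal i j i≢j with adj? G i j
    ... | yes adj = pointwise-≡ {fromℚ (K i j) *ᴿ B i j} {0ᴿ} λ k →
      trans (cong (ℚ._* seq (B i j) k) (vanishes i j adj)) (ℚ.*-zeroˡ (seq (B i j) k))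
    ... | no ¬adj = scale-zero {K i j} {B i j} (zeros i j (i≢j , ¬adj))

    row : ∀ i → ∑ (λ j → fromℚ (K i j) *ᴿ B i j) ≤ᴿ fromℚ f *ᴿ B i i
    row i = ≤ᴿ-trans {∑ λ j → fromℚ (K i j) *ᴿ B i j} {fromℚ (K i i) *ᴿ B i i} {fromℚ f *ᴿ B i i}
      (∑-≤-single (λ j → fromℚ (K i j) *ᴿ B i j) i (off-diagonal i))
      (pointwise-≡ {fromℚ (K i i) *ᴿ B i i} {fromℚ f *ᴿ B i i} λ k → cong (ℚ._* seq (B i i) k) (diagonal i))

    entrySum≤pairing : entrySum B ≤ᴿ pairing K B
    entrySum≤pairing = ≤ᴿ-trans {entrySum B} {0ᴿ +ᴿ entrySum B} {pairing K B}
      (pointwise-≡ {entrySum B} {0ᴿ +ᴿ entrySum B} λ k → sym (ℚ.+-identityˡ _))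
      (≤ᴿ-trans {0ᴿ +ᴿ entrySum B} {pairing K-1 B +ᴿ entrySum B} {pairing K B}
        (+ᴿ-mono-≤ {0ᴿ} {pairing K-1 B} {entrySum B} {entrySum B} (gram-pairing {K = K-1} {B} gram-K-1 psd) (≤ᴿ-refl {entrySum B}))
        (pointwise-≡ {pairing K-1 B +ᴿ entrySum B} {pairing K B} λ k → begin
          seq (pairing K-1 B) k ℚ.+ seq (entrySum B) k
            ≡⟨ cong₂ ℚ._+_ (seq-pairing K-1 B k) (seq-∑∑ B k) ⟩
          sum (λ i → sum λ j → (K i j ℚ.- 1ℚ) ℚ.* seq (B i j) k) ℚ.+ sum (λ i → sum λ j → seq (B i j) k)
            ≡⟨ ℚ-Sums.∑-distrib-+ (λ i → sum λ j → (K i j ℚ.- 1ℚ) ℚ.* seq (B i j) k) (λ i → sum λ j → seq (B i j) k) ⟨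
          sum (λ i → sum (λ j → (K i j ℚ.- 1ℚ) ℚ.* seq (B i j) k) ℚ.+ sum (λ j → seq (B i j) k))
            ≡⟨ sum-cong-≋ (λ i → sym (ℚ-Sums.∑-distrib-+ (λ j → (K i j ℚ.- 1ℚ) ℚ.* seq (B i j) k) (λ j → seq (B i j) k))) ⟩
          sum (λ i → sum λ j → (K i j ℚ.- 1ℚ) ℚ.* seq (B i j) k ℚ.+ seq (B i j) k)
            ≡⟨ sum-cong-≋ (λ i → sum-cong-≋ λ j →
                 solve 2 (λ k b → (k :- con 1ℚ) :* b :+ b := k :* b) refl (K i j) (seq (B i j) k)) ⟩
          sum (λ i → sum λ j → K i j ℚ.* seq (B i j) k)
            ≡⟨ seq-pairing K B k ⟨
          seq (pairing K B) k ∎))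
      where
      K-1 : Kernel n
      K-1 i j = K i j ℚ.- 1ℚ

-- Kernels on k-subsets

ι-∣∷∣ : ∀ {n} b (X : Subset n) → ι ∣ b ∷ X ∣ ≡ ⟦ b ⟧ ℚ.+ ι ∣ X ∣
ι-∣∷∣ true  X = ι-suc ∣ X ∣
ι-∣∷∣ false X = sym (ℚ.+-identityˡ (ι ∣ X ∣))

module _ (μ κ : ℚ) where

  centred : ∀ {n} → Subset n → Subset n → Fin n → ℚ
  centred (s ∷ S) (a ∷ A) zero    = if s then 0ℚ else μ ℚ.* ⟦ a ⟧ ℚ.- κ
  centred (s ∷ S) (a ∷ A) (suc e) = centred S A e

  private
    -- The sum of (μ [e ∈ A] - κ)(μ [e ∈ B] - κ) over e ∉ S, expanded in x = |A ∩ B|, a = |A|, b =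
    -- |B|, l = |S| and n, for S inside both A and B.
    form : ℚ → ℚ → ℚ → ℚ → ℚ → ℚ
    form x a b l n = μ ℚ.* μ ℚ.* (x ℚ.- l) ℚ.- μ ℚ.* κ ℚ.* (a ℚ.- l) ℚ.- μ ℚ.* κ ℚ.* (b ℚ.- l) ℚ.+ κ ℚ.* κ ℚ.* (n ℚ.- l)

    form-+ : ∀ x a b l n x′ a′ b′ l′ n′ →
             form x a b l n ℚ.+ form x′ a′ b′ l′ n′ ≡ form (x ℚ.+ x′) (a ℚ.+ a′) (b ℚ.+ b′) (l ℚ.+ l′) (n ℚ.+ n′)
    form-+ = solve 12 (λ μ κ x a b l n x′ a′ b′ l′ n′ →
      (μ :* μ :* (x :- l) :- μ :* κ :* (a :- l) :- μ :* κ :* (b :- l) :+ κ :* κ :* (n :- l)) :+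
      (μ :* μ :* (x′ :- l′) :- μ :* κ :* (a′ :- l′) :- μ :* κ :* (b′ :- l′) :+ κ :* κ :* (n′ :- l′)) :=
      (μ :* μ :* ((x :+ x′) :- (l :+ l′)) :- μ :* κ :* ((a :+ a′) :- (l :+ l′))
        :- μ :* κ :* ((b :+ b′) :- (l :+ l′)) :+ κ :* κ :* ((n :+ n′) :- (l :+ l′)))) refl μ κ

    form-cong : ∀ {x x′ a a′ b b′ l l′ n n′} → x ≡ x′ → a ≡ a′ → b ≡ b′ → l ≡ l′ → n ≡ n′ →
                form x a b l n ≡ form x′ a′ b′ l′ n′
    form-cong refl refl refl refl refl = refl

  -- `form` is linear in its five counts, so one coordinate at a time suffices. A coordinate in S
  -- adds 1 to every count, and `form` sees only differences with l, so it contributes 0 on both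
  -- sides.
  centred-inner : ∀ {n} (S A B : Subset n) → (S ⊆ᵇ A) ≡ true → (S ⊆ᵇ B) ≡ true →
    sum (λ e → centred S A e ℚ.* centred S B e) ≡ form (ι ∣ A ∩ B ∣) (ι ∣ A ∣) (ι ∣ B ∣) (ι ∣ S ∣) (ι n)
  centred-inner [] [] [] _ _ = solve 2 (λ μ κ → con 0ℚ :=
    μ :* μ :* (con 0ℚ :- con 0ℚ) :- μ :* κ :* (con 0ℚ :- con 0ℚ) :- μ :* κ :* (con 0ℚ :- con 0ℚ) :+ κ :* κ :* (con 0ℚ :- con 0ℚ)) refl μ κ
  centred-inner {suc n} (s ∷ S) (a ∷ A) (b ∷ B) S⊆A S⊆B = begin
    first s a b ℚ.+ sum (λ e → centred S A e ℚ.* centred S B e)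
      ≡⟨ cong₂ ℚ._+_ (head s a b (proj₁ (∧-true⁻ S⊆A)) (proj₁ (∧-true⁻ S⊆B)))
           (centred-inner S A B (proj₂ (∧-true⁻ {not s ∨ a} S⊆A)) (proj₂ (∧-true⁻ {not s ∨ b} S⊆B))) ⟩
    form ⟦ a ∧ b ⟧ ⟦ a ⟧ ⟦ b ⟧ ⟦ s ⟧ 1ℚ ℚ.+ form (ι ∣ A ∩ B ∣) (ι ∣ A ∣) (ι ∣ B ∣) (ι ∣ S ∣) (ι n)
      ≡⟨ form-+ ⟦ a ∧ b ⟧ ⟦ a ⟧ ⟦ b ⟧ ⟦ s ⟧ 1ℚ (ι ∣ A ∩ B ∣) (ι ∣ A ∣) (ι ∣ B ∣) (ι ∣ S ∣) (ι n) ⟩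
    form (⟦ a ∧ b ⟧ ℚ.+ ι ∣ A ∩ B ∣) (⟦ a ⟧ ℚ.+ ι ∣ A ∣) (⟦ b ⟧ ℚ.+ ι ∣ B ∣) (⟦ s ⟧ ℚ.+ ι ∣ S ∣) (1ℚ ℚ.+ ι n)
      ≡⟨ form-cong (sym (ι-∣∷∣ (a ∧ b) (A ∩ B))) (sym (ι-∣∷∣ a A)) (sym (ι-∣∷∣ b B)) (sym (ι-∣∷∣ s S)) (sym (ι-suc n)) ⟩
    form (ι ∣ (a ∷ A) ∩ (b ∷ B) ∣) (ι ∣ a ∷ A ∣) (ι ∣ b ∷ B ∣) (ι ∣ s ∷ S ∣) (ι (suc n)) ∎
    where
    open ≡-Reasoning
    first : Bool → Bool → Bool → ℚ
    first s a b = (if s then 0ℚ else μ ℚ.* ⟦ a ⟧ ℚ.- κ) ℚ.* (if s then 0ℚ else μ ℚ.* ⟦ b ⟧ ℚ.- κ)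

    product : ∀ a b → (μ ℚ.* a ℚ.- κ) ℚ.* (μ ℚ.* b ℚ.- κ) ≡ form (a ℚ.* b) a b 0ℚ 1ℚ
    product a b = solve 4 (λ μ κ a b → (μ :* a :- κ) :* (μ :* b :- κ) :=
      μ :* μ :* (a :* b :- con 0ℚ) :- μ :* κ :* (a :- con 0ℚ) :- μ :* κ :* (b :- con 0ℚ) :+ κ :* κ :* (con 1ℚ :- con 0ℚ))
      refl μ κ a b

    head : ∀ s a b → not s ∨ a ≡ true → not s ∨ b ≡ true → first s a b ≡ form ⟦ a ∧ b ⟧ ⟦ a ⟧ ⟦ b ⟧ ⟦ s ⟧ 1ℚ
    head false a    b    _ _ = trans (product ⟦ a ⟧ ⟦ b ⟧)
      (cong (λ x → form x ⟦ a ⟧ ⟦ b ⟧ 0ℚ 1ℚ) (sym (⟦⟧-∧ a b)))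
    head true  true true _ _ = solve 2 (λ μ κ → con 0ℚ :* con 0ℚ :=
      μ :* μ :* (con 1ℚ :- con 1ℚ) :- μ :* κ :* (con 1ℚ :- con 1ℚ) :- μ :* κ :* (con 1ℚ :- con 1ℚ) :+ κ :* κ :* (con 1ℚ :- con 1ℚ))
      refl μ κ

  module _ (n k l : ℕ) where

    -- For each l-set S the vectors indexed by e ∉ S are μ [e ∈ A] - κ, restricted to the A ⊇ S.  With
    -- μ = n - l and κ = k - l the row of A sums to 0, which makes the kernel negative at intersection size l.
    level-value : ℕ → ℚ
    level-value x = form (ι x) (ι k) (ι k) (ι l) (ι n)

    -- Only the sets S inside A ∩ B contribute. There are C(|A ∩ B|, l) of them, and each yields the
    -- same inner product.
    level-gram : Gram {n choose k} λ i j → ι (binom (meet n k i j) l) ℚ.* level-value (meet n k i j)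
    level-gram = gram-resp total (gram-sum λ t → gram-sum λ e → rank-one 1ℚ (weight t e) (ℚ.nonNegative⁻¹ 1ℚ) λ i j → refl)
      where
      open ≡-Reasoning
      S = subsetsOfSize n l
      A = kSubset n k

      weight : Fin (binom n l) → Fin n → Fin (n choose k) → ℚ
      weight t e i = ⟦ S t ⊆ᵇ A i ⟧ ℚ.* centred (S t) (A i) e

      summand : ∀ t i j → sum (λ e → 1ℚ ℚ.* (weight t e i ℚ.* weight t e j)) ≡
                ⟦ S t ⊆ᵇ A i ∩ A j ⟧ ℚ.* level-value (meet n k i j)
      summand t i j = begin
        sum (λ e → 1ℚ ℚ.* (weight t e i ℚ.* weight t e j))
          ≡⟨ sum-cong-≋ (λ e → solve 4 (λ a b c d → con 1ℚ :* (a :* b :* (c :* d)) := (a :* c) :* (b :* d)) refl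
               ⟦ S t ⊆ᵇ A i ⟧ (centred (S t) (A i) e) ⟦ S t ⊆ᵇ A j ⟧ (centred (S t) (A j) e)) ⟩
        sum (λ e → ⟦ S t ⊆ᵇ A i ⟧ ℚ.* ⟦ S t ⊆ᵇ A j ⟧ ℚ.* (centred (S t) (A i) e ℚ.* centred (S t) (A j) e))
          ≡⟨ *-distribˡ-sum (⟦ S t ⊆ᵇ A i ⟧ ℚ.* ⟦ S t ⊆ᵇ A j ⟧) (λ e → centred (S t) (A i) e ℚ.* centred (S t) (A j) e) ⟨
        ⟦ S t ⊆ᵇ A i ⟧ ℚ.* ⟦ S t ⊆ᵇ A j ⟧ ℚ.* inner
          ≡⟨ cong (ℚ._* inner) (sym (⟦⟧-∧ (S t ⊆ᵇ A i) (S t ⊆ᵇ A j))) ⟩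
        ⟦ (S t ⊆ᵇ A i) ∧ (S t ⊆ᵇ A j) ⟧ ℚ.* inner
          ≡⟨ both (S t ⊆ᵇ A i) (S t ⊆ᵇ A j) refl refl ⟩
        ⟦ (S t ⊆ᵇ A i) ∧ (S t ⊆ᵇ A j) ⟧ ℚ.* level-value (meet n k i j)
          ≡⟨ cong (λ z → ⟦ z ⟧ ℚ.* level-value (meet n k i j)) (⊆ᵇ-∩ (S t) (A i) (A j)) ⟨
        ⟦ S t ⊆ᵇ A i ∩ A j ⟧ ℚ.* level-value (meet n k i j) ∎
        where
        inner : ℚ
        inner = sum λ e → centred (S t) (A i) e ℚ.* centred (S t) (A j) e

        sizes : inner ≡ form (ι ∣ A i ∩ A j ∣) (ι ∣ A i ∣) (ι ∣ A j ∣) (ι ∣ S t ∣) (ι n) → inner ≡ level-value (meet n k i j)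
        sizes e = trans e (form-cong {x = ι ∣ A i ∩ A j ∣} {n = ι n} refl (cong ι (∣kSubset∣ n k i)) (cong ι (∣kSubset∣ n k j))
          (cong ι (∣subsetsOfSize∣ n l t)) refl)

        -- The closed form of the inner product is available only when S lies in both sets;
        -- otherwise the indicator is 0.
        both : ∀ p q → (S t ⊆ᵇ A i) ≡ p → (S t ⊆ᵇ A j) ≡ q →
               ⟦ p ∧ q ⟧ ℚ.* inner ≡ ⟦ p ∧ q ⟧ ℚ.* level-value (meet n k i j)
        both true  true  ⊆i ⊆j = cong (1ℚ ℚ.*_) (sizes (centred-inner (S t) (A i) (A j) ⊆i ⊆j))
        both true  false _  _  = trans (ℚ.*-zeroˡ inner) (sym (ℚ.*-zeroˡ (level-value (meet n k i j))))
        both false _     _  _  = trans (ℚ.*-zeroˡ inner) (sym (ℚ.*-zeroˡ (level-value (meet n k i j))))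

      total : ∀ i j → ι (binom (meet n k i j) l) ℚ.* level-value (meet n k i j) ≡
              sum (λ t → sum λ e → 1ℚ ℚ.* (weight t e i ℚ.* weight t e j))
      total i j = sym (begin
        sum (λ t → sum λ e → 1ℚ ℚ.* (weight t e i ℚ.* weight t e j))
          ≡⟨ sum-cong-≋ (λ t → summand t i j) ⟩
        sum (λ t → ⟦ S t ⊆ᵇ A i ∩ A j ⟧ ℚ.* level-value (meet n k i j))
          ≡⟨ *-distribʳ-sum (level-value (meet n k i j)) (λ t → ⟦ S t ⊆ᵇ A i ∩ A j ⟧) ⟨
        sum (λ t → ⟦ S t ⊆ᵇ A i ∩ A j ⟧) ℚ.* level-value (meet n k i j)
          ≡⟨ cong (ℚ._* level-value (meet n k i j)) (trans (ℚ-Sums.sum-⊆ l (A i ∩ A j)) (∙1≡ι (binom (meet n k i j) l))) ⟩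
        ι (binom (meet n k i j) l) ℚ.* level-value (meet n k i j) ∎)

    module _ (ιk : ι k ≡ ι l ℚ.+ κ) (ιn : ι n ≡ ι l ℚ.+ μ) where
      open ≡-Reasoning

      level-value-l : level-value l ≡ ℚ.- (μ ℚ.* (κ ℚ.* κ))
      level-value-l = trans (form-cong {x = ι l} {l = ι l} refl ιk ιk refl ιn) (solve 3 (λ μ κ l →
        μ :* μ :* (l :- l) :- μ :* κ :* ((l :+ κ) :- l) :- μ :* κ :* ((l :+ κ) :- l) :+ κ :* κ :* ((l :+ μ) :- l) :=
        :- (μ :* (κ :* κ))) refl μ κ (ι l))

      level-value-k : level-value k ≡ μ ℚ.* κ ℚ.* (μ ℚ.- κ)
      level-value-k = trans (form-cong {l = ι l} ιk ιk ιk refl ιn) (solve 3 (λ μ κ l →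
        μ :* μ :* ((l :+ κ) :- l) :- μ :* κ :* ((l :+ κ) :- l) :- μ :* κ :* ((l :+ κ) :- l) :+ κ :* κ :* ((l :+ μ) :- l) :=
        μ :* κ :* (μ :- κ)) refl μ κ (ι l))

-- Only the values at l and k are constrained: 1 + `value` must vanish at l, and its size on the
-- diagonal is the cost. Other sizes are left to other factors of the product.
record Level (n k l r : ℕ) : Set where
  field
    value        : ℕ → ℚ
    value-l      : value l ≡ ℚ.- 1ℚ
    0≤value-k    : 0ℚ ℚ.≤ value k
    value-k≤     : value k ℚ.≤ ι r
    gram         : Gram {n choose k} λ i j → value (meet n k i j)

-- Scaling by c = 1 / (μ κ²) makes the value at l equal to -1. Since μ - κ = i, the value at k
-- becomes C(k, l) i / κ, and κ ≥ 1.
level : ∀ l o i → Level (suc l ℕ.+ o ℕ.+ i) (suc l ℕ.+ o) l (binom (suc l ℕ.+ o) l ℕ.* i)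
level l o i = go (inverse (μ ℚ.* (κ ℚ.* κ)) (0<* 0<μ (0<* 0<κ 0<κ)))
  where
  k n : ℕ
  k = suc l ℕ.+ o
  n = k ℕ.+ i
  κ μ : ℚ
  κ = ι (suc o)
  μ = ι (suc o ℕ.+ i)
  1≤κ : 1ℚ ℚ.≤ κ
  1≤κ = ι-mono-≤ {1} {suc o} (s≤s z≤n)
  0<κ : 0ℚ ℚ.< κ
  0<κ = ℚ.<-≤-trans (ℚ.positive⁻¹ 1ℚ) 1≤κ
  0<μ : 0ℚ ℚ.< μ
  0<μ = ℚ.<-≤-trans (ℚ.positive⁻¹ 1ℚ) (ι-mono-≤ {1} {suc o ℕ.+ i} (s≤s z≤n))

  ιk : ι k ≡ ι l ℚ.+ κ
  ιk = trans (cong ι (sym (ℕ.+-suc l o))) (ι-+ l (suc o))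
  ιn : ι n ≡ ι l ℚ.+ μ
  ιn = trans (cong ι (trans (cong (ℕ._+ i) (sym (ℕ.+-suc l o))) (ℕ.+-assoc l (suc o) i))) (ι-+ l (suc o ℕ.+ i))
  μ-κ : μ ℚ.- κ ≡ ι i
  μ-κ = trans (cong (ℚ._- κ) (ι-+ (suc o) i)) (solve 2 (λ κ i → (κ :+ i) :- κ := i) refl κ (ι i))

  go : (∃[ c ] 0ℚ ℚ.< c × μ ℚ.* (κ ℚ.* κ) ℚ.* c ≡ 1ℚ) → Level n k l (binom k l ℕ.* i)
  go (c , 0<c , inv) = record
    { value     = λ x → c ℚ.* (ι (binom x l) ℚ.* level-value μ κ n k l x)
    ; value-l   = begin
        c ℚ.* (ι (binom l l) ℚ.* level-value μ κ n k l l)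
          ≡⟨ cong₂ (λ b v → c ℚ.* (ι b ℚ.* v)) (binom-diagonal l) (level-value-l μ κ n k l ιk ιn) ⟩
        c ℚ.* (1ℚ ℚ.* ℚ.- (μ ℚ.* (κ ℚ.* κ)))
          ≡⟨ solve 3 (λ c μ κ → c :* (con 1ℚ :* (:- (μ :* (κ :* κ)))) := :- (μ :* (κ :* κ) :* c)) refl c μ κ ⟩
        ℚ.- (μ ℚ.* (κ ℚ.* κ) ℚ.* c)
          ≡⟨ cong ℚ.-_ inv ⟩
        ℚ.- 1ℚ ∎
    ; 0≤value-k = subst (0ℚ ℚ.≤_) (sym at-k) (0≤* 0≤bi (0≤* 0≤cμ 0≤κ))
    ; value-k≤  = ℚ.≤-trans (ℚ.≤-reflexive at-k) (subst₂ ℚ._≤_ refl bound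
        (ℚ.*-monoˡ-≤-nonNeg (ι b ℚ.* ι i) {{ℚ.nonNegative 0≤bi}}
          (ℚ.*-monoˡ-≤-nonNeg (c ℚ.* μ) {{ℚ.nonNegative 0≤cμ}} κ≤κ²)))
    ; gram      = gram-scale c (ℚ.<⇒≤ 0<c) (level-gram μ κ n k l)
    }
    where
    open ≡-Reasoning
    b : ℕ
    b = binom k l
    0≤bi : 0ℚ ℚ.≤ ι b ℚ.* ι i
    0≤bi = 0≤* (0≤ι b) (0≤ι i)
    0≤cμ : 0ℚ ℚ.≤ c ℚ.* μ
    0≤cμ = 0≤* (ℚ.<⇒≤ 0<c) (ℚ.<⇒≤ 0<μ)
    0≤κ : 0ℚ ℚ.≤ κ
    0≤κ = ℚ.<⇒≤ 0<κ
    κ≤κ² : κ ℚ.≤ κ ℚ.* κ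
    κ≤κ² = subst (ℚ._≤ κ ℚ.* κ) (ℚ.*-identityʳ κ) (ℚ.*-monoˡ-≤-nonNeg κ {{ℚ.nonNegative 0≤κ}} 1≤κ)

    at-k : c ℚ.* (ι b ℚ.* level-value μ κ n k l k) ≡ ι b ℚ.* ι i ℚ.* (c ℚ.* μ ℚ.* κ)
    at-k = begin
      c ℚ.* (ι b ℚ.* level-value μ κ n k l k)
        ≡⟨ cong (λ v → c ℚ.* (ι b ℚ.* v)) (trans (level-value-k μ κ n k l ιk ιn) (cong (μ ℚ.* κ ℚ.*_) μ-κ)) ⟩
      c ℚ.* (ι b ℚ.* (μ ℚ.* κ ℚ.* ι i))
        ≡⟨ solve 5 (λ c b μ κ i → c :* (b :* (μ :* κ :* i)) := b :* i :* (c :* μ :* κ)) refl c (ι b) μ κ (ι i) ⟩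
      ι b ℚ.* ι i ℚ.* (c ℚ.* μ ℚ.* κ) ∎

    bound : ι b ℚ.* ι i ℚ.* (c ℚ.* μ ℚ.* (κ ℚ.* κ)) ≡ ι (b ℕ.* i)
    bound = begin
      ι b ℚ.* ι i ℚ.* (c ℚ.* μ ℚ.* (κ ℚ.* κ))
        ≡⟨ cong (ι b ℚ.* ι i ℚ.*_) (solve 3 (λ c μ s → c :* μ :* s := μ :* s :* c) refl c μ (κ ℚ.* κ)) ⟩
      ι b ℚ.* ι i ℚ.* (μ ℚ.* (κ ℚ.* κ) ℚ.* c)
        ≡⟨ trans (cong (ι b ℚ.* ι i ℚ.*_) inv) (ℚ.*-identityʳ _) ⟩
      ι b ℚ.* ι i
        ≡⟨ ι-* b i ⟨
      ι (b ℕ.* i) ∎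

level-below : ∀ {l k} i → l ℕ.< k → ∃[ r ] r ℕ.≤ k ℕ.^ k ℕ.* i × Level (k ℕ.+ i) k l r
level-below {l} i l<k with ℕ.m≤n⇒∃[o]m+o≡n l<k
... | o , refl = _ , ℕ.*-monoˡ-≤ i (ℕ.≤-trans (binom≤^ (suc l ℕ.+ o) l) (ℕ.^-monoʳ-≤ (suc l ℕ.+ o) (ℕ.<⇒≤ l<k))) , level l o i

-- Kernels vanishing at prescribed intersection sizes

record Barrier (n k : ℕ) (zeros : ℕ → ℕ) (count T : ℕ) : Set where
  field
    value   : ℕ → ℚ
    zero-at : ∀ j → j ℕ.< count → value (zeros j) ≡ 0ℚ
    1≤value : 1ℚ ℚ.≤ value k
    value≤  : value k ℚ.≤ ι T
    gram    : Gram {n choose k} λ i j → value (meet n k i j) ℚ.- 1ℚ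

barrier : ∀ k i zeros count → (∀ j → j ℕ.< count → zeros j ℕ.< k) →
          Barrier (k ℕ.+ i) k zeros count ((suc (k ℕ.^ k) ℕ.* (k ℕ.+ i)) ℕ.^ count)
barrier k i zeros zero _ = record
  { value   = λ _ → 1ℚ
  ; zero-at = λ _ ()
  ; 1≤value = ℚ.≤-refl
  ; value≤  = ℚ.≤-refl
  ; gram    = rank-one 0ℚ (λ _ → 0ℚ) ℚ.≤-refl λ _ _ → refl
  }
barrier k i zeros (suc count) zeros<k with level-below i (zeros<k count ℕ.≤-refl) | barrier k i zeros count (λ j → zeros<k j ∘ ℕ.m≤n⇒m≤1+n)
... | r , r≤ , H | F = record
  { value   = λ x → (1ℚ ℚ.+ h x) ℚ.* f x
  ; zero-at = zero-at
  ; 1≤value = *-mono-≤ {1ℚ} {1ℚ ℚ.+ h k} {1ℚ} (ℚ.nonNegative⁻¹ 1ℚ) 0≤1+h (p≤p+q (Level.0≤value-k H)) (Barrier.1≤value F)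
  ; value≤  = ℚ.≤-trans (*-mono-≤ {1ℚ ℚ.+ h k} {ι factor} {f k} 0≤f (0≤ι factor) 1+h≤ (Barrier.value≤ F))
                (ℚ.≤-reflexive (sym (ι-* factor (factor ℕ.^ count))))
  -- (1 + h) f - 1 = h + (f - 1) + h (f - 1): carrying f - 1 through the induction, rather than f,
  -- makes all three terms positive semidefinite.
  ; gram    = plus (plus (Level.gram H) (Barrier.gram F) λ _ _ → refl) (gram-* (Level.gram H) (Barrier.gram F)) λ u v →
      solve 2 (λ h f → (con 1ℚ :+ h) :* f :- con 1ℚ := (h :+ (f :- con 1ℚ)) :+ h :* (f :- con 1ℚ)) refl
        (h (meet (k ℕ.+ i) k u v)) (f (meet (k ℕ.+ i) k u v))
  }
  where
  h f : ℕ → ℚ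
  h = Level.value H
  f = Barrier.value F
  factor : ℕ
  factor = suc (k ℕ.^ k) ℕ.* (k ℕ.+ i)

  0≤1+h : 0ℚ ℚ.≤ 1ℚ ℚ.+ h k
  0≤1+h = 0≤+ (ℚ.nonNegative⁻¹ 1ℚ) (Level.0≤value-k H)
  0≤f : 0ℚ ℚ.≤ f k
  0≤f = ℚ.≤-trans (ℚ.nonNegative⁻¹ 1ℚ) (Barrier.1≤value F)

  -- The 1 is absorbed by n = k + i ≥ 1 and r by k^k n, so that every factor has the same bound.
  factor-bound : suc r ℕ.≤ factor
  factor-bound = ℕ.+-mono-≤
    (ℕ.≤-trans (ℕ.≤-trans (s≤s z≤n) (zeros<k count ℕ.≤-refl)) (ℕ.m≤m+n k i))
    (ℕ.≤-trans r≤ (ℕ.*-monoʳ-≤ (k ℕ.^ k) (ℕ.m≤n+m i k)))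

  1+h≤ : 1ℚ ℚ.+ h k ℚ.≤ ι factor
  1+h≤ = begin
    1ℚ ℚ.+ h k     ≤⟨ ℚ.+-monoʳ-≤ 1ℚ (Level.value-k≤ H) ⟩
    1ℚ ℚ.+ ι r     ≡⟨ ι-suc r ⟨
    ι (suc r)      ≤⟨ ι-mono-≤ factor-bound ⟩
    ι factor       ∎
    where open ℚ.≤-Reasoning

  zero-at : ∀ j → j ℕ.< suc count → (1ℚ ℚ.+ h (zeros j)) ℚ.* f (zeros j) ≡ 0ℚ
  zero-at j j≤count with ℕ.m≤n⇒m<n∨m≡n (ℕ.≤-pred j≤count)
  ... | inj₁ j<count = trans (cong ((1ℚ ℚ.+ h (zeros j)) ℚ.*_) (Barrier.zero-at F j j<count)) (ℚ.*-zeroʳ (1ℚ ℚ.+ h (zeros j)))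
  ... | inj₂ refl = trans (cong (λ z → (1ℚ ℚ.+ z) ℚ.* f (zeros count)) (Level.value-l H)) (ℚ.*-zeroˡ (f (zeros count)))

-- The three quotients

-- γ U is N / (T R), and U bounds the real power y. Hence ϑ ≥ N / T = γ U R against α, c ≤ R, and χ
-- ≥ N / R = γ U T against ϑ(Gᶜ) ≤ T.
module Ratios {N : ℕ} (G : Graph N) (v : Fin N) {R T : ℕ} (1≤R : 1 ℕ.≤ R) (1≤T : 1 ℕ.≤ T)
  (rep : Representation G R)
  (K : Kernel N) (f : ℚ) (1≤f : 1ℚ ℚ.≤ f) (f≤T : f ℚ.≤ ι T)
  (diagonal : ∀ i → K i i ≡ f) (symmetric : ∀ i j → K i j ≡ K j i)
  (vanishes : ∀ i j → Adj G i j → K i j ≡ 0ℚ)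
  (gram-K-1 : Gram λ i j → K i j ℚ.- 1ℚ)
  {γ U : ℚ} (0≤γ : 0ℚ ℚ.≤ γ) (0≤U : 0ℚ ℚ.≤ U) (γUTR≡N : γ ℚ.* U ℚ.* ι (T ℕ.* R) ≡ ι N)
  {y : ℝ} (y≤U : y ≤ᴿ fromℚ U) where

  0<f : 0ℚ ℚ.< f
  0<f = ℚ.<-≤-trans (ℚ.positive⁻¹ 1ℚ) 1≤f

  open Certificate G K f 0<f diagonal symmetric vanishes gram-K-1

  1≤N : 1 ℕ.≤ N
  1≤N = nonempty v
    where
    nonempty : ∀ {N} → Fin N → 1 ℕ.≤ N
    nonempty {suc N} _ = s≤s z≤n

  γUR≤ϑ : ∀ {ϑ} → IsLovászNumber G ϑ → fromℚ (γ ℚ.* U ℚ.* ι R) ≤ᴿ ϑ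
  γUR≤ϑ {ϑ} isϑ = go (inverse f 0<f)
    where
    go : (∃[ g ] 0ℚ ℚ.< g × f ℚ.* g ≡ 1ℚ) → fromℚ (γ ℚ.* U ℚ.* ι R) ≤ᴿ ϑ
    go (g , 0<g , fg≡1) = ≤ᴿ-trans {fromℚ (γ ℚ.* U ℚ.* ι R)} {fromℚ (ι N ℚ.* g)} {ϑ}
      (fromℚ-mono-≤ bound) (lovász-≥ {ϑ} {ι N ℚ.* g} 1≤N
        (trans (ℚ.*-assoc (ι N) g f) (trans (cong (ι N ℚ.*_) (trans (ℚ.*-comm g f) fg≡1)) (ℚ.*-identityʳ (ι N)))) isϑ)
      where
      open ℚ.≤-Reasoning
      bound : γ ℚ.* U ℚ.* ι R ℚ.≤ ι N ℚ.* g
      bound = begin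
        γ ℚ.* U ℚ.* ι R
          ≡⟨ trans (cong (γ ℚ.* U ℚ.* ι R ℚ.*_) fg≡1) (ℚ.*-identityʳ (γ ℚ.* U ℚ.* ι R)) ⟨
        γ ℚ.* U ℚ.* ι R ℚ.* (f ℚ.* g)
          ≤⟨ ℚ.*-monoˡ-≤-nonNeg (γ ℚ.* U ℚ.* ι R) {{ℚ.nonNegative (0≤* (0≤* 0≤γ 0≤U) (0≤ι R))}}
               (ℚ.*-monoʳ-≤-nonNeg g {{ℚ.nonNegative (ℚ.<⇒≤ 0<g)}} f≤T) ⟩
        γ ℚ.* U ℚ.* ι R ℚ.* (ι T ℚ.* g)
          ≡⟨ solve 4 (λ z r t g → z :* r :* (t :* g) := z :* (t :* r) :* g) refl (γ ℚ.* U) (ι R) (ι T) g ⟩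
        γ ℚ.* U ℚ.* (ι T ℚ.* ι R) ℚ.* g
          ≡⟨ cong (λ z → γ ℚ.* U ℚ.* z ℚ.* g) (ι-* T R) ⟨
        γ ℚ.* U ℚ.* ι (T ℕ.* R) ℚ.* g
          ≡⟨ cong (ℚ._* g) γUTR≡N ⟩
        ι N ℚ.* g ∎

  ϑ/α : ∀ {ϑ} → IsLovászNumber G ϑ → ϑ / fromℕ (α G) ≥ᴿ (fromℚ γ *ᴿ y)
  ϑ/α {ϑ} isϑ = quotient-≥ {γ} {U} {ι R} {ϑ} {y} {fromℕ (α G)} 0≤γ 0≤U (0≤ι R) y≤U
    (positive-lower-bound {1ℚ} {fromℕ (α G)} (ℚ.positive⁻¹ 1ℚ) (fromℚ-mono-≤ {1ℚ} {ι (α G)} (ι-mono-≤ {1} {α G} (1≤α G v))))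
    (fromℚ-mono-≤ {ι (α G)} {ι R} (ι-mono-≤ {α G} {R} (α≤dimension rep))) (γUR≤ϑ {ϑ} isϑ)

  -- The m-th strong power has a representation of dimension R^m, so every root in the sequence, and
  -- with it c, is at most R. The lower bound ½ on the roots serves only to make c positive.
  ϑ/c : ∀ {ϑ c} → IsLovászNumber G ϑ → IsShannonCapacity G c → ϑ / c ≥ᴿ (fromℚ γ *ᴿ y)
  ϑ/c {ϑ} {c} isϑ (s , root , s⟶c) = quotient-≥ {γ} {U} {ι R} {ϑ} {y} {c} 0≤γ 0≤U (0≤ι R) y≤U
    (positive-lower-bound {½} {c} (ℚ.positive⁻¹ ½) (limit-≥ {s} {c} s⟶c ½ s≥½))
    (limit-≤ {s} {c} s⟶c (ι R) s≤R) (γUR≤ϑ {ϑ} isϑ)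
    where
    power-vertex : ∀ m → Fin (N ℕ.^ m)
    power-vertex zero    = zero
    power-vertex (suc m) = Fin.combine v (power-vertex m)

    s≤R : ∀ m → s m ≤ᴿ fromℚ (ι R)
    s≤R m = root-≤ {s m} {ι R} m (0≤ι R)
      (≤ᴿ-trans {s m ^ᴿ suc m} {fromℕ (α (G ^⊠ suc m))} {fromℚ (ι R ^ℚ suc m)}
        (≈⇒≤ {s m ^ᴿ suc m} {fromℕ (α (G ^⊠ suc m))} (proj₂ (root m)))
        (fromℚ-mono-≤ {ι (α (G ^⊠ suc m))} {ι R ^ℚ suc m} (subst (ι (α (G ^⊠ suc m)) ℚ.≤_) (ι-^ R (suc m))
          (ι-mono-≤ {α (G ^⊠ suc m)} {R ℕ.^ suc m} (α≤dimension (^⊠-representation rep (suc m)))))))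

    s≥½ : ∀ m → fromℚ ½ ≤ᴿ s m
    s≥½ m = ½≤root {s m} m (proj₁ (root m))
      (≤ᴿ-trans {1ᴿ} {fromℕ (α (G ^⊠ suc m))} {s m ^ᴿ suc m}
        (fromℚ-mono-≤ {1ℚ} {ι (α (G ^⊠ suc m))} (ι-mono-≤ {1} {α (G ^⊠ suc m)} (1≤α (G ^⊠ suc m) (power-vertex (suc m)))))
        (≈⇒≤ {fromℕ (α (G ^⊠ suc m))} {s m ^ᴿ suc m} (≈-sym {s m ^ᴿ suc m} {fromℕ (α (G ^⊠ suc m))} (proj₂ (root m)))))

  χ/ϑᶜ : ∀ {ϑᶜ} → IsLovászNumber (complement G) ϑᶜ → fromℕ (χ G) / ϑᶜ ≥ᴿ (fromℚ γ *ᴿ y)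
  χ/ϑᶜ {ϑᶜ} isϑᶜ = quotient-≥ {γ} {U} {ι T} {fromℕ (χ G)} {y} {ϑᶜ} 0≤γ 0≤U (0≤ι T) y≤U
    (positive-lower-bound {1ℚ} {ϑᶜ} (ℚ.positive⁻¹ 1ℚ) (1≤lovász {G = complement G} {ϑᶜ} v isϑᶜ))
    (≤ᴿ-trans {ϑᶜ} {fromℚ f} {fromℚ (ι T)} (lovászᶜ-≤ {ϑᶜ} isϑᶜ) (fromℚ-mono-≤ f≤T))
    (fromℚ-mono-≤ {γ ℚ.* U ℚ.* ι T} {ι (χ G)} γUT≤χ)
    where
    open ℚ.≤-Reasoning
    γUT≤χ : γ ℚ.* U ℚ.* ι T ℚ.≤ ι (χ G)
    γUT≤χ = ℚ.*-cancelʳ-≤-pos (ι R) {{ℚ.positive (ℚ.<-≤-trans (ℚ.positive⁻¹ 1ℚ) (ι-mono-≤ {1} {R} 1≤R))}} (begin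
      γ ℚ.* U ℚ.* ι T ℚ.* ι R
        ≡⟨ ℚ.*-assoc (γ ℚ.* U) (ι T) (ι R) ⟩
      γ ℚ.* U ℚ.* (ι T ℚ.* ι R)
        ≡⟨ cong (γ ℚ.* U ℚ.*_) (ι-* T R) ⟨
      γ ℚ.* U ℚ.* ι (T ℕ.* R)
        ≡⟨ γUTR≡N ⟩
      ι N
        ≤⟨ ι-mono-≤ {N} {χ G ℕ.* R} (order≤χ*dimension rep) ⟩
      ι (χ G ℕ.* R)
        ≡⟨ ι-* (χ G) R ⟩
      ι (χ G) ℚ.* ι R ∎)

-- With q = r + 1, a power of 2, k = q² - 1 and the intersection sizes making vertices adjacent are the
-- l < k with l ≡ -1 mod q.
module Construction (e′ : ℕ) where

  e r k K constant : ℕ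
  e = suc e′
  -- One digit more than e, so that r ≥ 2 e by `n≤mersenne`.
  r = mersenne (suc e)
  -- This is (r + 1)² - 1, written as r + j (r + 1) with j = r to match `odd-binom-mersenne⁺`.
  k = r ℕ.+ r ℕ.* suc r
  K = suc (k ℕ.^ k)
  -- K^r comes from T = (K n)^r, and k^k k! from comparing n^k with N.
  constant = K ℕ.^ r ℕ.* (k ℕ.^ k ℕ.* k !)

  1≤k : 1 ℕ.≤ k
  1≤k = s≤s z≤n

  1≤constant : 1 ℕ.≤ constant
  1≤constant = ℕ.*-mono-≤ (1≤^ₙ {K} r (s≤s z≤n)) (ℕ.*-mono-≤ (1≤^ₙ {k} k 1≤k) (ℕ.1≤n! k))

  J : ℕ → JohnsonParameters
  J i = record { ground = k ℕ.+ i ; k = k ; L = evenBinomials k r }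

  module _ (i : ℕ) where

    n R T N : ℕ
    n = k ℕ.+ i
    R = binom n r
    T = (K ℕ.* n) ℕ.^ r
    N = order (J i)

    1≤n : 1 ℕ.≤ n
    1≤n = s≤s z≤n

    1≤R : 1 ℕ.≤ R
    1≤R = 1≤binom (ℕ.≤-trans (ℕ.m≤m+n r (r ℕ.* suc r)) (ℕ.m≤m+n k i))

    1≤T : 1 ℕ.≤ T
    1≤T = 1≤^ₙ r (ℕ.*-mono-≤ {1} {K} {1} (s≤s z≤n) 1≤n)

    1≤N : 1 ℕ.≤ N
    1≤N = subst (1 ℕ.≤_) (binom≡C n k) (1≤binom (ℕ.m≤m+n k i))

    -- T R is at most K^r n^(2r), and 2 r e ≤ k, so its e-th power grows no faster than n^k, that
    -- is, than N up to a constant.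
    TR^e≤ : (T ℕ.* R) ℕ.^ e ℕ.≤ constant ℕ.^ e ℕ.* N
    TR^e≤ = begin
      (T ℕ.* R) ℕ.^ e
        ≤⟨ ℕ.^-monoˡ-≤ e (ℕ.*-monoʳ-≤ T (binom≤^ n r)) ⟩
      ((K ℕ.* n) ℕ.^ r ℕ.* n ℕ.^ r) ℕ.^ e
        ≡⟨ cong (ℕ._^ e) (trans (cong (ℕ._* n ℕ.^ r) (^-distribʳ-* K n r)) (trans (ℕ.*-assoc (K ℕ.^ r) (n ℕ.^ r) (n ℕ.^ r))
             (cong (K ℕ.^ r ℕ.*_) (sym (ℕ.^-distribˡ-+-* n r r))))) ⟩
      (K ℕ.^ r ℕ.* n ℕ.^ (r ℕ.+ r)) ℕ.^ e
        ≡⟨ trans (^-distribʳ-* (K ℕ.^ r) (n ℕ.^ (r ℕ.+ r)) e) (cong ((K ℕ.^ r) ℕ.^ e ℕ.*_) (ℕ.^-*-assoc n (r ℕ.+ r) e)) ⟩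
      (K ℕ.^ r) ℕ.^ e ℕ.* n ℕ.^ ((r ℕ.+ r) ℕ.* e)
        ≤⟨ ℕ.*-monoʳ-≤ ((K ℕ.^ r) ℕ.^ e) (ℕ.^-monoʳ-≤ n {{ℕ.>-nonZero 1≤n}} 2re≤k) ⟩
      (K ℕ.^ r) ℕ.^ e ℕ.* n ℕ.^ k
        ≤⟨ ℕ.*-monoʳ-≤ ((K ℕ.^ r) ℕ.^ e) (^≤binom k i 1≤k) ⟩
      (K ℕ.^ r) ℕ.^ e ℕ.* (k ℕ.^ k ℕ.* k ! ℕ.* binom n k)
        ≤⟨ ℕ.*-monoʳ-≤ ((K ℕ.^ r) ℕ.^ e) (ℕ.*-monoˡ-≤ (binom n k) (x≤x^e (ℕ.*-mono-≤ (1≤^ₙ {k} k 1≤k) (ℕ.1≤n! k)))) ⟩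
      (K ℕ.^ r) ℕ.^ e ℕ.* ((k ℕ.^ k ℕ.* k !) ℕ.^ e ℕ.* binom n k)
        ≡⟨ ℕ.*-assoc ((K ℕ.^ r) ℕ.^ e) ((k ℕ.^ k ℕ.* k !) ℕ.^ e) (binom n k) ⟨
      (K ℕ.^ r) ℕ.^ e ℕ.* (k ℕ.^ k ℕ.* k !) ℕ.^ e ℕ.* binom n k
        ≡⟨ cong₂ ℕ._*_ (sym (^-distribʳ-* (K ℕ.^ r) (k ℕ.^ k ℕ.* k !) e)) (binom≡C n k) ⟩
      constant ℕ.^ e ℕ.* N ∎
      where
      open ℕ.≤-Reasoning
      x≤x^e : ∀ {x} → 1 ℕ.≤ x → x ℕ.≤ x ℕ.^ e
      x≤x^e {x} 1≤x = subst (ℕ._≤ x ℕ.^ e) (ℕ.*-identityʳ x) (ℕ.*-monoʳ-≤ x (1≤^ₙ e′ 1≤x))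

      2e≤r : e ℕ.+ e ℕ.≤ r
      2e≤r = ℕ.≤-trans (ℕ.+-mono-≤ (n≤mersenne e) (n≤mersenne e))
        (ℕ.≤-trans (ℕ.≤-reflexive (sym (double≡ (mersenne e)))) (ℕ.n≤1+n _))

      2re≤k : (r ℕ.+ r) ℕ.* e ℕ.≤ k
      2re≤k = begin
        (r ℕ.+ r) ℕ.* e      ≡⟨ ℕ.*-distribʳ-+ e r r ⟩
        r ℕ.* e ℕ.+ r ℕ.* e  ≡⟨ ℕ.*-distribˡ-+ r e e ⟨
        r ℕ.* (e ℕ.+ e)      ≤⟨ ℕ.*-monoʳ-≤ r (ℕ.≤-trans 2e≤r (ℕ.n≤1+n r)) ⟩
        r ℕ.* suc r          ≤⟨ ℕ.m≤n+m (r ℕ.* suc r) r ⟩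
        k                    ∎

    TR≤ : T ℕ.* R ℕ.≤ constant ℕ.* N
    TR≤ = ^-cancelˡ-≤ e′ (begin
      (T ℕ.* R) ℕ.^ e            ≤⟨ TR^e≤ ⟩
      constant ℕ.^ e ℕ.* N       ≤⟨ ℕ.*-monoʳ-≤ (constant ℕ.^ e) (subst (ℕ._≤ N ℕ.^ e) (ℕ.*-identityʳ N) (ℕ.*-monoʳ-≤ N (1≤^ₙ e′ 1≤N))) ⟩
      constant ℕ.^ e ℕ.* N ℕ.^ e ≡⟨ ^-distribʳ-* constant N e ⟨
      (constant ℕ.* N) ℕ.^ e     ∎)
      where open ℕ.≤-Reasoning

    0<TR : 0ℚ ℚ.< ι (T ℕ.* R)
    0<TR = ℚ.<-≤-trans (ℚ.positive⁻¹ 1ℚ) (ι-mono-≤ {1} {T ℕ.* R} (ℕ.*-mono-≤ 1≤T 1≤R))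

    -- The factor `constant` makes U large enough to dominate N^(1-ε); γ = 1 / `constant` takes it
    -- out again.
    U-exists : ∃[ U ] U ℚ.* ι (T ℕ.* R) ≡ ι (constant ℕ.* N)
    U-exists = go (inverse (ι (T ℕ.* R)) 0<TR)
      where
      go : (∃[ d ] 0ℚ ℚ.< d × ι (T ℕ.* R) ℚ.* d ≡ 1ℚ) → ∃[ U ] U ℚ.* ι (T ℕ.* R) ≡ ι (constant ℕ.* N)
      go (d , _ , TRd≡1) = ι (constant ℕ.* N) ℚ.* d , trans (ℚ.*-assoc (ι (constant ℕ.* N)) d (ι (T ℕ.* R)))
        (trans (cong (ι (constant ℕ.* N) ℚ.*_) (trans (ℚ.*-comm d (ι (T ℕ.* R))) TRd≡1)) (ℚ.*-identityʳ (ι (constant ℕ.* N))))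

    module _ {U : ℚ} (U-eq : U ℚ.* ι (T ℕ.* R) ≡ ι (constant ℕ.* N)) where

      1≤U : 1ℚ ℚ.≤ U
      1≤U = ℚ.*-cancelʳ-≤-pos (ι (T ℕ.* R)) {{ℚ.positive 0<TR}} (begin
        1ℚ ℚ.* ι (T ℕ.* R)     ≡⟨ ℚ.*-identityˡ (ι (T ℕ.* R)) ⟩
        ι (T ℕ.* R)            ≤⟨ ι-mono-≤ TR≤ ⟩
        ι (constant ℕ.* N)     ≡⟨ U-eq ⟨
        U ℚ.* ι (T ℕ.* R)      ∎)
        where open ℚ.≤-Reasoning

      N^a≤U^b : ∀ a b → e ℕ.* a ℕ.+ suc b ℕ.≤ e ℕ.* suc b → ι N ^ℚ a ℚ.≤ U ^ℚ suc b
      N^a≤U^b a b ea+b≤eb = ℚ.*-cancelʳ-≤-pos (ι D ^ℚ suc b) {{ℚ.positive (0<^ (suc b) 0<TR)}} (begin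
        ι N ^ℚ a ℚ.* ι D ^ℚ suc b        ≡⟨ cong₂ ℚ._*_ (ι-^ N a) (ι-^ D (suc b)) ⟨
        ι (N ℕ.^ a) ℚ.* ι (D ℕ.^ suc b)  ≡⟨ ι-* (N ℕ.^ a) (D ℕ.^ suc b) ⟨
        ι (N ℕ.^ a ℕ.* D ℕ.^ suc b)      ≤⟨ ι-mono-≤ (power-tradeoff e′ {D} {constant} {N} TR^e≤ 1≤N a b ea+b≤eb) ⟩
        ι ((constant ℕ.* N) ℕ.^ suc b)   ≡⟨ ι-^ (constant ℕ.* N) (suc b) ⟩
        ι (constant ℕ.* N) ^ℚ suc b      ≡⟨ cong (_^ℚ suc b) U-eq ⟨
        (U ℚ.* ι D) ^ℚ suc b             ≡⟨ ^-distrib-* U (ι D) (suc b) ⟩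
        U ^ℚ suc b ℚ.* ι D ^ℚ suc b      ∎)
        where
        open ℚ.≤-Reasoning
        D : ℕ
        D = T ℕ.* R

    vertex : Fin N
    vertex = fromℕ< 1≤N

    zeros : ℕ → ℕ
    zeros j = r ℕ.+ j ℕ.* suc r

    -- The index j stops before r because j = r would give k itself, the size on the diagonal.
    certificate : Barrier n k zeros r T
    certificate = barrier k i zeros r λ j j<r → ℕ.+-monoʳ-< r (ℕ.*-monoˡ-< (suc r) j<r)

    open Barrier certificate

    vanishes : ∀ u v → Adj (graph (J i)) u v → value (meet n k u v) ≡ 0ℚ
    vanishes u v adj = go (odd-binom-mersenne⁻ (suc e) (meet n k u v) (adjacent⇒odd {n} {k} {r} adj))
      where
      go : (∃[ j ] meet n k u v ≡ zeros j) → value (meet n k u v) ≡ 0ℚ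
      go (j , eq) = trans (cong value eq) (zero-at j (ℕ.*-cancelʳ-< (suc r) j r
        (ℕ.+-cancelˡ-< r (j ℕ.* suc r) (r ℕ.* suc r) (subst (ℕ._< k) eq (meet<k n k (proj₁ adj))))))

    γUTR≡N : ∀ {γ U} → ι constant ℚ.* γ ≡ 1ℚ → U ℚ.* ι (T ℕ.* R) ≡ ι (constant ℕ.* N) → γ ℚ.* U ℚ.* ι (T ℕ.* R) ≡ ι N
    γUTR≡N {γ} {U} γ-eq U-eq = begin
      γ ℚ.* U ℚ.* ι (T ℕ.* R)       ≡⟨ ℚ.*-assoc γ U (ι (T ℕ.* R)) ⟩
      γ ℚ.* (U ℚ.* ι (T ℕ.* R))     ≡⟨ cong (γ ℚ.*_) (trans U-eq (ι-* constant N)) ⟩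
      γ ℚ.* (ι constant ℚ.* ι N)    ≡⟨ ℚ.*-assoc γ (ι constant) (ι N) ⟨
      γ ℚ.* ι constant ℚ.* ι N      ≡⟨ cong (ℚ._* ι N) (trans (ℚ.*-comm γ (ι constant)) γ-eq) ⟩
      1ℚ ℚ.* ι N                    ≡⟨ ℚ.*-identityˡ (ι N) ⟩
      ι N                           ∎
      where open ≡-Reasoning

    module Bounds {γ U y} (0≤γ : 0ℚ ℚ.≤ γ) (γ-eq : ι constant ℚ.* γ ≡ 1ℚ)
                  (U-eq : U ℚ.* ι (T ℕ.* R) ≡ ι (constant ℕ.* N)) (y≤U : y ≤ᴿ fromℚ U) =
      Ratios {order (J i)} (graph (J i)) vertex {R} {T} 1≤R 1≤T
        (johnson-representation {n} {k} {r} (odd-binom-mersenne⁺ (suc e) r))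
        (λ u v → value (meet n k u v)) (value k) 1≤value value≤
        (λ u → cong value (meet-diagonal n k u))
        (λ u v → cong (λ S → value ∣ S ∣) (∩-comm (kSubset n k u) (kSubset n k v)))
        vanishes gram {γ} {U} 0≤γ (ℚ.≤-trans (ℚ.nonNegative⁻¹ 1ℚ) (1≤U U-eq)) (γUTR≡N {γ} {U} γ-eq U-eq) {y} y≤U

  -- By Pascal's rule the increment is C(k + i, k - 1), which is at least 1.
  order-increasing : ∀ i → order (J i) < order (J (suc i))
  order-increasing i = increasing k 1≤k
    where
    increasing : ∀ k → 1 ℕ.≤ k → (k ℕ.+ i) choose k ℕ.< (k ℕ.+ suc i) choose k
    increasing (suc k) _ rewrite ℕ.+-suc k i | sym (binom≡C (suc (k ℕ.+ i)) (suc k)) | sym (binom≡C (suc (suc (k ℕ.+ i))) (suc k)) =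
      ℕ.+-monoˡ-≤ (binom (suc (k ℕ.+ i)) (suc k)) (1≤binom (ℕ.m≤n⇒m≤1+n (ℕ.m≤m+n k i)))

  module Asymptotics {ε δ} (1≤eδ : 1ℚ ℚ.≤ ι e ℚ.* δ) (1-ε≤1-δ : 1ᴿ -ᴿ ε ≤ᴿ fromℚ (1ℚ ℚ.- δ)) where

    γ-exists : ∃[ γ ] 0ℚ ℚ.< γ × ι constant ℚ.* γ ≡ 1ℚ
    γ-exists = inverse (ι constant) (ℚ.<-≤-trans (ℚ.positive⁻¹ 1ℚ) (ι-mono-≤ {1} {constant} 1≤constant))

    γ : ℚ
    γ = proj₁ γ-exists

    0<γ : 0ᴿ <ᴿ fromℚ γ
    0<γ = positive-lower-bound {γ} {fromℚ γ} (proj₁ (proj₂ γ-exists)) (≤ᴿ-refl {fromℚ γ})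

    U : ℕ → ℚ
    U i = proj₁ (U-exists i)

    y≤U : ∀ i {y} → IsPower (order (J i)) (1ᴿ -ᴿ ε) y → y ≤ᴿ fromℚ (U i)
    y≤U i {y} = power-≤ {N i} {ε} {y} {e} {δ} {U i} (1≤N i) 1≤eδ 1-ε≤1-δ
      (1≤U i {U i} (proj₂ (U-exists i))) (N^a≤U^b i {U i} (proj₂ (U-exists i)))

    module RatiosAt (i : ℕ) {y : ℝ} (isPower : IsPower (order (J i)) (1ᴿ -ᴿ ε) y) =
      Bounds i {γ} {U i} {y} (ℚ.<⇒≤ (proj₁ (proj₂ γ-exists))) (proj₂ (proj₂ γ-exists)) (proj₂ (U-exists i)) (y≤U i {y} isPower)

    ϑ/α-bound : ∀ i y ϑ → IsPower (order (J i)) (1ᴿ -ᴿ ε) y → IsLovászNumber (graph (J i)) ϑ →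
                ϑ / fromℕ (α (graph (J i))) ≥ᴿ (fromℚ γ *ᴿ y)
    ϑ/α-bound i y ϑ isPower = RatiosAt.ϑ/α i {y} isPower {ϑ}

    ϑ/c-bound : ∀ i y ϑ c → IsPower (order (J i)) (1ᴿ -ᴿ ε) y → IsLovászNumber (graph (J i)) ϑ →
                IsShannonCapacity (graph (J i)) c → ϑ / c ≥ᴿ (fromℚ γ *ᴿ y)
    ϑ/c-bound i y ϑ c isPower = RatiosAt.ϑ/c i {y} isPower {ϑ} {c}

    χ/ϑᶜ-bound : ∀ i y ϑᶜ → IsPower (order (J i)) (1ᴿ -ᴿ ε) y → IsLovászNumber (complement (graph (J i))) ϑᶜ →
                 fromℕ (χ (graph (J i))) / ϑᶜ ≥ᴿ (fromℚ γ *ᴿ y)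
    χ/ϑᶜ-bound i y ϑᶜ isPower = RatiosAt.χ/ϑᶜ i {y} isPower {ϑᶜ}

theorem5 : (ε : ℝ) → 0ᴿ <ᴿ ε →
    Σ[ J ∈ (ℕ → JohnsonParameters) ]
    (∀ i → order (J i) < order (J (suc i))) ×
    (Σ[ C ∈ ℝ ] 0ᴿ <ᴿ C ×
    (∀ i y ϑ → IsPower (order (J i)) (1ᴿ -ᴿ ε) y →
    IsLovászNumber (graph (J i)) ϑ →
    ϑ / fromℕ (α (graph (J i))) ≥ᴿ (C *ᴿ y))) ×
    (Σ[ C ∈ ℝ ] 0ᴿ <ᴿ C ×
    (∀ i y ϑ c → IsPower (order (J i)) (1ᴿ -ᴿ ε) y →
    IsLovászNumber (graph (J i)) ϑ →
    IsShannonCapacity (graph (J i)) c →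
    ϑ / c ≥ᴿ (C *ᴿ y))) ×
    (Σ[ C ∈ ℝ ] 0ᴿ <ᴿ C ×
    (∀ i y ϑᶜ → IsPower (order (J i)) (1ᴿ -ᴿ ε) y →
    IsLovászNumber (complement (graph (J i))) ϑᶜ →
    fromℕ (χ (graph (J i))) / ϑᶜ ≥ᴿ (C *ᴿ y)))
theorem5 ε 0<ε = J , order-increasing ,
  (fromℚ γ , 0<γ , ϑ/α-bound) , (fromℚ γ , 0<γ , ϑ/c-bound) , (fromℚ γ , 0<γ , χ/ϑᶜ-bound)
  where
  rational-part : ∃[ e ] ∃[ δ ] 1ℚ ℚ.≤ ι (suc e) ℚ.* δ × 1ᴿ -ᴿ ε ≤ᴿ fromℚ (1ℚ ℚ.- δ)
  rational-part = positive-rational {ε} 0<ε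

  open Construction (proj₁ rational-part)
  open Asymptotics {ε} {proj₁ (proj₂ rational-part)}
    (proj₁ (proj₂ (proj₂ rational-part))) (proj₂ (proj₂ (proj₂ rational-part)))
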